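{- Let $M$ be a matroid on a finite ground set $E$. The map $\mathcal{M}\mapsto \mathcal{E}_{\mathcal{M}}$, sending an orientation $\mathcal{M}$ of $M$ to the real phase structure $\mathcal{E}_{\mathcal{M}}$ on the matroid fan $\Sigma_M$ defined below, is a bijection between the set of orientations of $M$ and the set of real phase structures on $\Sigma_M$. (In other words, oriented matroids and real phase structures on matroid fans are cryptomorphic.)
   Context: Write $\mathbb{Z}_2=\mathbb{Z}/2\mathbb{Z}$. For a rational polyhedral cone $\sigma\subset\mathbb{R}^n$, $T_{\mathbb{Z}_2}(\sigma)\subseteq\mathbb{Z}_2^n$ is the reduction mod 2 of the integer points of the real linear span of $\sigma$. A collection of subsets of a set is an even covering if every element of their union lies in an even number of them. For a rational polyhedral fan $\Sigma\subset\mathbb{R}^n$ of pure dimension $d$, a real phase structure is a map $\mathcal{E}$ from the set of facets (maximal cones) of $\Sigma$ to the set of $d$-dimensional affine subspaces of $\mathbb{Z}_2^n$ such that (1) for every facet $\sigma$, the tangent (direction) space of $\mathcal{E}(\sigma)$ equals $T_{\mathbb{Z}_2}(\sigma)$; (2) for every codimension one face $\tau$ with adjacent facets $\sigma_1,\dots,\sigma_k$, the sets $\mathcal{E}(\sigma_1),\dots,\mathcal{E}(\sigma_k)$ form an even covering. Matroid fan: for a loopfree matroid $M$ on $E$, let $v_i=-e_i\in\mathbb{R}^E$ and $v_I=\sum_{i\in I}v_i$. For each chain of flats $\mathcal{F}=\{\emptyset\subsetneq F_1\subsetneq\dots\subsetneq F_k\subsetneq E\}$ let $\sigma_{\mathcal{F}}$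 be the cone generated by $v_{F_1},\dots,v_{F_k},v_E,-v_E$; $\Sigma_M$ is the fan of all these cones (its facets correspond to maximal chains of flats). If $M$ has loops $L=\mathrm{cl}(\emptyset)$, set $\Sigma_M:=\Sigma_{M/L}\subset\mathbb{R}^{E\setminus L}$. Oriented matroids (covector axioms): a set $\mathcal{C}\subseteq\{0,+1,-1\}^E$ with $0\in\mathcal{C}$; $X\in\mathcal{C}\iff -X\in\mathcal{C}$; $X,Y\in\mathcal{C}\Rightarrow X\circ Y\in\mathcal{C}$, where $(X\circ Y)_i=X_i$ if $X_i\neq0$ and $Y_i$ otherwise; and if $X,Y\in\mathcal{C}$ and $i\in S(X,Y)=\{j: X_j=-Y_j\neq 0\}$ then there is $Z\in\mathcal{C}$ with $Z_i=0$ and $Z_j=(X\circ Y)_j$ for all $j\notin S(X,Y)$. The underlying matroid $\underline{\mathcal{M}}$ has as flats exactly the sets $E\setminus\mathrm{Supp}(X)$, $X\in\mathcal{C}$. An orientation of $M$ is an oriented matroid $\mathcal{M}$ with $\underline{\mathcal{M}}=M$. Topes are the covectors maximal for the coordinatewise order $0<+1,-1$. For a tope $T$ and $F\subseteq E$, $T\setminus F$ is $T$ with coordinates in $F$ set to $0$. For a chain of flats $\mathcal{F}=\{F_0\subsetneq\dots\subsetneq F_k\}$, $\mathcal{T}(\mathcal{F})$ is the set of topes $T$ with $T\setminus F_i\in\mathcal{C}$ for all $i$. For $\varepsilon\in\mathbb{Z}_2^E$ write $(-1)^\varepsilon=((-1)^{\varepsilon_e})_{e\in E}$. For loopfree $\mathcal{M}$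 define $\mathcal{E}_{\mathcal{M}}(\sigma_{\mathcal{F}})=\{\varepsilon\in\mathbb{Z}_2^E : (-1)^\varepsilon\in\mathcal{T}(\mathcal{F})\}$ for each facet $\sigma_{\mathcal{F}}$ of $\Sigma_M$; if $\mathcal{M}$ has loops $L$, $\mathcal{E}_{\mathcal{M}}:=\mathcal{E}_{\mathcal{M}\setminus L}$ with values in $\mathbb{Z}_2^{E\setminus L}$. (It is a fact that $\mathcal{E}_{\mathcal{M}}$ is a real phase structure on $\Sigma_M$.) -}

module Defs where

open import Data.Bool using (Bool; true; false; _∧_; _∨_; not; if_then_else_)
open import Data.Nat using (ℕ; zero; suc; _%_; _≡ᵇ_)
open import Data.Fin using (Fin)
open import Data.Vec using (Vec; []; _∷_; lookup; map; zipWith; replicate; tabulate; foldr)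
open import Data.List using (List; []; _∷_; _++_; [_]; length; filter; concatMap; upTo; removeAt)
open import Data.Bool.ListAction using (all; any)
open import Data.List.Relation.Unary.All using (All)
import Data.List as L
open import Data.Integer using (ℤ; ∣_∣)
open import Data.Rational using (ℚ; 0ℚ; 1ℚ; _/_) renaming (_+_ to _+ℚ_; _*_ to _*ℚ_; -_ to -ℚ_)
open import Data.Product using (Σ; ∃; _×_; _,_)
open import Data.Sum using (_⊎_)
open import Data.Unit using (⊤)
open import Data.Bool.Properties using () renaming (_≟_ to _≟B_)
open import Relation.Nullary using (¬_)
open import Relation.Binary.PropositionalEquality using (_≡_; _≢_)

-- Ground set E = Fin n.  Subsets of E are Vec Bool n (true = member).
-- Elements of Z₂^E are also Vec Bool n (true = 1).

Subset : ℕ → Set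
Subset n = Vec Bool n

module _ {n : ℕ} where

  _∈ₛ_ : Fin n → Subset n → Set
  e ∈ₛ A = lookup A e ≡ true

  _⊆_ : Subset n → Subset n → Set
  A ⊆ B = ∀ e → e ∈ₛ A → e ∈ₛ B

  _⊊_ : Subset n → Subset n → Set
  A ⊊ B = A ⊆ B × A ≢ B

  _∩_ : Subset n → Subset n → Subset n
  A ∩ B = zipWith _∧_ A B

  _∖_ : Subset n → Subset n → Subset n
  A ∖ B = zipWith (λ a b → a ∧ not b) A B

  fullSet : Subset n
  fullSet = replicate n true

  ∁ : Subset n → Subset n
  ∁ A = map not A

_⊆ᵇ_ : {n : ℕ} → Subset n → Subset n → Bool
[] ⊆ᵇ [] = true
(a ∷ A) ⊆ᵇ (b ∷ B) = (not a ∨ b) ∧ (A ⊆ᵇ B)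

_=ᵇ_ : {n : ℕ} → Subset n → Subset n → Bool
A =ᵇ B = (A ⊆ᵇ B) ∧ (B ⊆ᵇ A)

_⊊ᵇ_ : {n : ℕ} → Subset n → Subset n → Bool
A ⊊ᵇ B = (A ⊆ᵇ B) ∧ not (B ⊆ᵇ A)

allSubsets : (n : ℕ) → List (Subset n)
allSubsets zero = [ [] ]
allSubsets (suc n) = L.map (true ∷_) (allSubsets n) ++ L.map (false ∷_) (allSubsets n)

allListsOfLength : {A : Set} → ℕ → List A → List (List A)
allListsOfLength zero xs = [ [] ]
allListsOfLength (suc k) xs = concatMap (λ a → L.map (a ∷_) (allListsOfLength k xs)) xs

record Matroid (n : ℕ) : Set where
  field
    isFlat : Subset n → Bool

  IsFlat : Subset n → Set
  IsFlat F = isFlat F ≡ true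

  Covers : Subset n → Subset n → Set
  Covers F G = IsFlat G × F ⊊ G ×
    (∀ H → IsFlat H → F ⊆ H → H ⊆ G → H ≡ F ⊎ H ≡ G)

  field
    flat-E : IsFlat fullSet
    flat-∩ : ∀ F G → IsFlat F → IsFlat G → IsFlat (F ∩ G)
    flat-cover : ∀ F → IsFlat F → ∀ e → lookup F e ≡ false →
      Σ (Subset n) (λ G → Covers F G × e ∈ₛ G)
      × (∀ G G' → Covers F G → e ∈ₛ G → Covers F G' → e ∈ₛ G' → G ≡ G')

open Matroid public

module _ {n : ℕ} (M : Matroid n) where

  -- the set of loops L = cl(∅) = intersection of all flats
  loops : Subset n
  loops = tabulate (λ e → all (λ S → not (isFlat M S) ∨ lookup S e) (allSubsets n))

  -- Vectors indexed by E that vanish on L: this is how we represent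
  -- (Z₂ or Q or sign) vectors indexed by E ∖ L (coordinate subspace).
  ZeroOnL : Subset n → Set
  ZeroOnL x = ∀ e → e ∈ₛ loops → lookup x e ≡ false

  -- Chains of flats of M/L.  A flat of M/L is F ∖ L for a flat F of M;
  -- we represent it by F.  A chain ∅ ⊊ F₁ ⊊ … ⊊ F_k ⊊ E∖L of flats of M/L
  -- is represented by the list F₁ ∷ … ∷ F_k of flats of M, each strictly
  -- between L and E, strictly increasing.

  properFlatᵇ : Subset n → Bool
  properFlatᵇ F = isFlat M F ∧ (loops ⊊ᵇ F) ∧ (F ⊊ᵇ fullSet)

  increasingᵇ : List (Subset n) → Bool
  increasingᵇ [] = true
  increasingᵇ (F ∷ []) = true
  increasingᵇ (F ∷ G ∷ Fs) = (F ⊊ᵇ G) ∧ increasingᵇ (G ∷ Fs)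

  isChainᵇ : List (Subset n) → Bool
  isChainᵇ C = all properFlatᵇ C ∧ increasingᵇ C

  comparableᵇ : Subset n → Subset n → Bool
  comparableᵇ F G = (F ⊆ᵇ G) ∨ (G ⊆ᵇ F)

  isMaxChainᵇ : List (Subset n) → Bool
  isMaxChainᵇ C = isChainᵇ C ∧
    all (λ G → not (properFlatᵇ G ∧ all (comparableᵇ G) C) ∨ any (G =ᵇ_) C)
        (allSubsets n)

  IsFacet : List (Subset n) → Set
  IsFacet C = isMaxChainᵇ C ≡ true

  -- the list of all facets (each listed exactly once)
  facets : List (List (Subset n))
  facets = filter (λ C → isMaxChainᵇ C ≟B true)
                  (concatMap (λ k → allListsOfLength k (allSubsets n)) (upTo (suc n)))

  IsCodimOne : List (Subset n) → Set
  IsCodimOne G = Σ (List (Subset n)) (λ C → IsFacet C ×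
                   Σ (Fin (length C)) (λ i → G ≡ removeAt C i))

  containsᵇ : List (Subset n) → List (Subset n) → Bool
  containsᵇ G C = all (λ F → any (F =ᵇ_) C) G

  -- T_{Z₂}(σ_C): mod 2 reduction of the integer points of the linear span
  -- (over Q) of the generators v_{F₁∖L},…,v_{F_k∖L}, v_{E∖L}, −v_{E∖L}.

  toℚ : ℤ → ℚ
  toℚ z = z / 1

  vec : Subset n → Vec ℚ n
  vec S = map (λ b → if b then -ℚ 1ℚ else 0ℚ) S

  generators : List (Subset n) → List (Vec ℚ n)
  generators C = L.map (λ F → vec (F ∖ loops)) C
                 ++ (vec (∁ loops) ∷ map -ℚ_ (vec (∁ loops)) ∷ [])

  zeroVec : Vec ℚ n
  zeroVec = replicate n 0ℚ

  linComb : List ℚ → List (Vec ℚ n) → Vec ℚ n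
  linComb (c ∷ cs) (g ∷ gs) = zipWith _+ℚ_ (map (c *ℚ_) g) (linComb cs gs)
  linComb _ _ = zeroVec

  InSpan : List (Vec ℚ n) → Vec ℚ n → Set
  InSpan gs v = Σ (List ℚ) (λ cs → v ≡ linComb cs gs)

  parity : ℤ → Bool
  parity z = (∣ z ∣ % 2) ≡ᵇ 1

  TZ2 : List (Subset n) → Vec Bool n → Set
  TZ2 C x = Σ (Vec ℤ n) (λ z → InSpan (generators C) (map toℚ z) × x ≡ map parity z)

  _⊕_ : Vec Bool n → Vec Bool n → Vec Bool n
  x ⊕ y = zipWith (λ a b → (a ∧ not b) ∨ (not a ∧ b)) x y

  AffineWithDirection : (Vec Bool n → Bool) → (Vec Bool n → Set) → Set
  AffineWithDirection A T = Σ (Vec Bool n) (λ a → ZeroOnL a ×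
     (∀ x → ZeroOnL x → (A x ≡ true → T (x ⊕ a)) × (T (x ⊕ a) → A x ≡ true)))

  count : {X : Set} → (X → Bool) → List X → ℕ
  count p xs = length (filter (λ x → p x ≟B true) xs)

  -- Real phase structures on Σ_M.  The map from facets is given as a
  -- function on lists of flats (only its values on facets matter), with
  -- values subsets of Z₂^{E∖L} (given by Boolean membership).

  record RealPhaseStructure : Set where
    field
      phase : List (Subset n) → Vec Bool n → Bool
      phase-affine : ∀ C → IsFacet C → AffineWithDirection (phase C) (TZ2 C)
      phase-even : ∀ G → IsCodimOne G → ∀ x → ZeroOnL x →
        count (λ C → containsᵇ G C ∧ phase C x) facets % 2 ≡ 0

  open RealPhaseStructure public

  SameRPS : RealPhaseStructure → RealPhaseStructure → Set
  SameRPS P Q = ∀ C → IsFacet C → ∀ x → ZeroOnL x → phase P C x ≡ phase Q C x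

data Sign : Set where
  0s +s -s : Sign

SignVec : ℕ → Set
SignVec n = Vec Sign n

negS : Sign → Sign
negS 0s = 0s
negS +s = -s
negS -s = +s

compS : Sign → Sign → Sign
compS 0s b = b
compS a b = a

isZeroS : Sign → Bool
isZeroS 0s = true
isZeroS _ = false

_≤S_ : Sign → Sign → Set
0s ≤S b = ⊤
a ≤S b = a ≡ b

module _ {n : ℕ} where

  negV : SignVec n → SignVec n
  negV = map negS

  _∘V_ : SignVec n → SignVec n → SignVec n
  X ∘V Y = zipWith compS X Y

  zeroSV : SignVec n
  zeroSV = replicate n 0s

  Separates : SignVec n → SignVec n → Fin n → Set
  Separates X Y i = lookup X i ≢ 0s × lookup X i ≡ negS (lookup Y i)

  zeroSet : SignVec n → Subset n
  zeroSet = map isZeroS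

  _≤V_ : SignVec n → SignVec n → Set
  X ≤V Y = ∀ i → lookup X i ≤S lookup Y i

  restrictZero : SignVec n → Subset n → SignVec n
  restrictZero T F = zipWith (λ s b → if b then 0s else s) T F

record OrientedMatroid (n : ℕ) : Set where
  field
    cov : SignVec n → Bool

  IsCov : SignVec n → Set
  IsCov X = cov X ≡ true

  field
    cov-zero : IsCov zeroSV
    cov-neg : ∀ X → IsCov X → IsCov (negV X)
    cov-comp : ∀ X Y → IsCov X → IsCov Y → IsCov (X ∘V Y)
    cov-elim : ∀ X Y → IsCov X → IsCov Y → ∀ i → Separates X Y i →
      Σ (SignVec n) (λ Z → IsCov Z × lookup Z i ≡ 0s ×
        (∀ j → ¬ Separates X Y j → lookup Z j ≡ lookup (X ∘V Y) j))

open OrientedMatroid public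

-- 𝓜 is an orientation of M: the flats of the underlying matroid of 𝓜,
-- namely the sets E ∖ Supp(X) for covectors X, are exactly the flats of M
IsOrientationOf : {n : ℕ} → OrientedMatroid n → Matroid n → Set
IsOrientationOf {n} 𝓜 M = ∀ F →
  (IsFlat M F → Σ (SignVec n) (λ X → IsCov 𝓜 X × F ≡ zeroSet X))
  × (Σ (SignVec n) (λ X → IsCov 𝓜 X × F ≡ zeroSet X) → IsFlat M F)

SameOM : {n : ℕ} → OrientedMatroid n → OrientedMatroid n → Set
SameOM 𝓜 𝓝 = ∀ X → cov 𝓜 X ≡ cov 𝓝 X

module _ {n : ℕ} (M : Matroid n) (𝓜 : OrientedMatroid n) where

  -- sign vectors on E ∖ L are represented as sign vectors vanishing on L
  ZeroOnLS : SignVec n → Set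
  ZeroOnLS Y = ∀ e → e ∈ₛ loops M → lookup Y e ≡ 0s

  IsCovDel : SignVec n → Set
  IsCovDel Y = ZeroOnLS Y × Σ (SignVec n) (λ X → IsCov 𝓜 X ×
                 (∀ e → lookup (loops M) e ≡ false → lookup Y e ≡ lookup X e))

  IsTopeDel : SignVec n → Set
  IsTopeDel T = IsCovDel T × (∀ Z → IsCovDel Z → T ≤V Z → Z ≡ T)

  signOf : Vec Bool n → SignVec n
  signOf ε = zipWith (λ l b → if l then 0s else (if b then -s else +s)) (loops M) ε

  -- 𝓣(𝓕) for the chain ∅ ⊊ F₁∖L ⊊ … ⊊ F_k∖L ⊊ E∖L of flats of 𝓜∖L
  InTopesOfChain : List (Subset n) → SignVec n → Set
  InTopesOfChain C T = IsTopeDel T ×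
    All (λ F → IsCovDel (restrictZero T (F ∖ loops M)))
              (loops M ∷ C ++ [ fullSet ])

  ℰ : List (Subset n) → Vec Bool n → Set
  ℰ C ε = InTopesOfChain C (signOf ε)

Represents : {n : ℕ} (M : Matroid n) → RealPhaseStructure M → OrientedMatroid n → Set
Represents M P 𝓜 = ∀ C → IsFacet M C → ∀ ε → ZeroOnL M ε →
  (phase P C ε ≡ true → ℰ M 𝓜 C ε) × (ℰ M 𝓜 C ε → phase P C ε ≡ true)

{-# OPTIONS --safe #-}

-- Both structures amount to attaching to every cover F ⋖ G of flats a pair of opposite sign
-- vectors on G ∖ F, subject only to a condition on intervals of rank two.  For a real phase
-- structure, the sign vector of a cover does not depend on the maximal chain through it, because
-- the even covering at a ridge is a single cycle and maximal chains are connected by changing one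
-- flat at a time.  Topes are the sign vectors compatible with some maximal chain, and covectors
-- are the topes of contractions.  Walking around the cycles in rank two, a tope can be changed
-- off a given set S until one of its facets meets S.  This gives restriction of topes to flats,
-- hence composition of covectors; elimination follows by induction on the rank and on the number
-- of signs to be preserved.  In the other direction, elimination shows that the face poset of an
-- oriented matroid has the diamond property, which is the even covering condition, and that every
-- covector lies on a maximal flag of faces, so that it can be read off the phases.

module Submission where

open import Defs
open import Data.Bool using (Bool; true; false; _∧_; _∨_; not; if_then_else_; _xor_)
open import Data.Bool.Properties using (¬-not; ∧-conicalˡ; ∧-conicalʳ; xor-same; ∨-zeroʳ; ∨-identityʳ; xor-comm; ∧-identityʳ) renaming (_≟_ to _≟B_)
open import Data.Bool.ListAction using (all; any)
open import Data.Nat using (ℕ; zero; suc; _≤_; _<_; z≤n; s≤s; _%_)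
open import Data.Nat.Properties using (≤-refl; ≤-trans; m≤n⇒m≤1+n; <-≤-trans)
open import Data.Fin using (Fin; zero; suc)
open import Data.Fin.Properties using (any?; _≟_)
open import Data.Vec using (Vec; []; _∷_; lookup; tabulate; map)
open import Data.Vec.Properties using (lookup-zipWith; lookup-replicate; lookup-map; tabulate∘lookup; lookup∘tabulate; tabulate-cong)
open import Data.List using (List; []; _∷_; _++_; filter; foldr; length; allFin; [_]; _ʳ++_; removeAt; concatMap; upTo)
import Data.List as L
open import Data.List.Membership.Propositional using (lose; find) renaming (_∈_ to _∈ₗ_; _∉_ to _∉ₗ_)
open import Data.List.Membership.Propositional.Properties using (∈-map⁺; ∈-++⁺ˡ; ∈-++⁺ʳ; ∈-filter⁺; ∈-filter⁻; ∈-allFin; ∈-map⁻; ∈-concatMap⁺; ∈-concatMap⁻; ∈-upTo⁺; ∈-++⁻)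
open import Data.List.Relation.Unary.Any using (here; there)
open import Data.Product using (Σ; ∃; _×_; _,_; proj₁; proj₂)
open import Data.Sum using (_⊎_; inj₁; inj₂)
open import Data.Empty using (⊥; ⊥-elim)
open import Function using (_∘_)
open import Relation.Nullary using (¬_; yes; no; Dec; ¬?; _×-dec_; ⌊_⌋)
open import Relation.Binary.PropositionalEquality using (_≡_; _≢_; refl; sym; trans; cong; cong₂; subst; subst₂)
open import Data.List.Properties using (filter-notAll; ++-identityʳ; ∷-injectiveˡ; ∷-injectiveʳ)
open import Data.List.Relation.Unary.AllPairs using ([]; _∷_)
open import Data.List.Relation.Unary.Unique.Propositional using (Unique)
open import Data.List.Relation.Unary.Unique.Propositional.Properties using (++⁺; map⁺; filter⁺; upTo⁺)
open import Data.Unit using (⊤; tt)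
open import Data.Integer using (ℤ; +_)
import Data.Integer.Properties as ℤ
open import Data.Rational using (ℚ; 0ℚ; 1ℚ; _+_; _*_; -_)
import Data.Rational.Properties as ℚ
open import Data.Rational.Unnormalised using (mkℚᵘ; *≡*)
open import Data.List.Relation.Unary.All as All using (All; []; _∷_)

-- The obstacle is elimination. Let `x` and `y` be topes over `A` that differ at `i` and agree on
-- `D`. Passing to a facet of each that meets `i ∷ D` lowers the rank, but a facet through `j` in
-- `D` forgets the sign at `j`, and the facets of `x` and `y` need not coincide. Forgotten signs are
-- put back by composing with an eliminant for a shorter `D`, which must have released an element
-- other than the forgotten ones. When `D` consists of just two forgotten elements no such element
-- is left, and a direct argument in rank two takes over. Cycles occur in two places: at a ridge,
-- before it is known that the sign vector of a cover is independent of the chain, and in the rank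
-- two intervals of a sign system. `Necklace` covers both. It carries no cyclic order, so a walk
-- along it is organised as an induction on the list of coordinates that are ignored: ignoring a
-- further coordinate can only make one edge at a time invisible, and this edge is crossed.

-- Subsets of a finite set and their Boolean tests

infix 4 _∊_ _∉_ _⊑_

-- Record wrappers around membership and inclusion, so that their indices can be inferred.
record _∊_ {n : ℕ} (e : Fin n) (A : Subset n) : Set where
  constructor mem
  field holds : lookup A e ≡ true
open _∊_ public

record _∉_ {n : ℕ} (e : Fin n) (A : Subset n) : Set where
  constructor nonmem
  field fails : lookup A e ≡ false
open _∉_ public

record _⊑_ {n : ℕ} (A B : Subset n) : Set where
  constructor incl
  field at : {e : Fin n} → e ∊ A → e ∊ B
open _⊑_ public

_∖∖_ : {n : ℕ} (G F : Subset n) → Fin n → Set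
(G ∖∖ F) e = e ∊ G × e ∉ F

true⊎false : (b : Bool) → b ≡ true ⊎ b ≡ false
true⊎false true = inj₁ refl
true⊎false false = inj₂ refl

true≢false : {A : Set} {b : Bool} → b ≡ true → b ≡ false → A
true≢false refl ()

clash : {n : ℕ} {X : Set} {e : Fin n} {A : Subset n} → e ∊ A → e ∉ A → X
clash (mem t) (nonmem f) = true≢false t f

search : {n : ℕ} (p : Fin n → Bool) → (∃ λ e → p e ≡ true) ⊎ (∀ e → p e ≡ false)
search p with any? (λ e → p e ≟B true)
... | yes found = inj₁ found
... | no none = inj₂ λ e → ¬-not (λ pe → none (e , pe))

∧-true : {a b : Bool} → a ≡ true → b ≡ true → a ∧ b ≡ true
∧-true refl refl = refl

not-false : {b : Bool} → b ≡ false → not b ≡ true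
not-false refl = refl

not-true : {b : Bool} → not b ≡ true → b ≡ false
not-true {false} _ = refl

module _ {n : ℕ} where

  ∈⊎∉ : (e : Fin n) (A : Subset n) → e ∊ A ⊎ e ∉ A
  ∈⊎∉ e A with true⊎false (lookup A e)
  ... | inj₁ t = inj₁ (mem t)
  ... | inj₂ f = inj₂ (nonmem f)

  lookup-ext : {X : Set} {A B : Vec X n} → (∀ e → lookup A e ≡ lookup B e) → A ≡ B
  lookup-ext {A = A} {B} same =
    trans (sym (tabulate∘lookup A)) (trans (tabulate-cong same) (tabulate∘lookup B))

  ⊑-refl : {A : Subset n} → A ⊑ A
  ⊑-refl = incl λ e∈ → e∈

  ⊑-trans : {A B C : Subset n} → A ⊑ B → B ⊑ C → A ⊑ C
  ⊑-trans A⊑B B⊑C = incl (at B⊑C ∘ at A⊑B)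

  ∉-⊑ : {A B : Subset n} {e : Fin n} → A ⊑ B → e ∉ B → e ∉ A
  ∉-⊑ {A} {e = e} A⊑B e∉B with ∈⊎∉ e A
  ... | inj₁ e∈A = clash (at A⊑B e∈A) e∉B
  ... | inj₂ e∉A = e∉A

  ⊑-antisym : {A B : Subset n} → A ⊑ B → B ⊑ A → A ≡ B
  ⊑-antisym {A} {B} A⊑B B⊑A = lookup-ext same
    where
    same : ∀ e → lookup A e ≡ lookup B e
    same e with ∈⊎∉ e A
    ... | inj₁ e∈A = trans (holds e∈A) (sym (holds (at A⊑B e∈A)))
    ... | inj₂ e∉A = trans (fails e∉A) (sym (fails (∉-⊑ B⊑A e∉A)))

  ∈-full : {e : Fin n} → e ∊ fullSet
  ∈-full {e} = mem (lookup-replicate e true)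

  ⊑-full : {A : Subset n} → A ⊑ fullSet
  ⊑-full = incl λ _ → ∈-full

  ∈-∩⁺ : {A B : Subset n} {e : Fin n} → e ∊ A → e ∊ B → e ∊ (A ∩ B)
  ∈-∩⁺ {A} {B} {e} (mem e∈A) (mem e∈B) = mem (trans (lookup-zipWith _∧_ e A B) (∧-true e∈A e∈B))

  ∩-⊑ˡ : {A B : Subset n} → (A ∩ B) ⊑ A
  ∩-⊑ˡ {A} {B} = incl λ {e} (mem e∈) → mem (∧-conicalˡ _ (lookup B e) (trans (sym (lookup-zipWith _∧_ e A B)) e∈))

  ∩-⊑ʳ : {A B : Subset n} → (A ∩ B) ⊑ B
  ∩-⊑ʳ {A} {B} = incl λ {e} (mem e∈) → mem (∧-conicalʳ (lookup A e) _ (trans (sym (lookup-zipWith _∧_ e A B)) e∈))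

  lookup-∖ : (A B : Subset n) (e : Fin n) → lookup (A ∖ B) e ≡ lookup A e ∧ not (lookup B e)
  lookup-∖ A B e = lookup-zipWith (λ a b → a ∧ not b) e A B

  ∈-∖⁺ : {A B : Subset n} {e : Fin n} → (A ∖∖ B) e → e ∊ (A ∖ B)
  ∈-∖⁺ {A} {B} {e} (mem e∈A , nonmem e∉B) = mem (trans (lookup-∖ A B e) (∧-true e∈A (not-false e∉B)))

  ∈-∖⁻ : {A B : Subset n} {e : Fin n} → e ∊ (A ∖ B) → (A ∖∖ B) e
  ∈-∖⁻ {A} {B} {e} (mem e∈) = mem (∧-conicalˡ _ _ e∈′) , nonmem (not-true (∧-conicalʳ (lookup A e) _ e∈′))
    where e∈′ = trans (sym (lookup-∖ A B e)) e∈

  ∉-∖⁺ : {A B : Subset n} {e : Fin n} → e ∉ A ⊎ e ∊ B → e ∉ (A ∖ B)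
  ∉-∖⁺ {A} {B} {e} out with ∈⊎∉ e (A ∖ B) | out
  ... | inj₂ e∉ | _ = e∉
  ... | inj₁ e∈ | inj₁ e∉A = clash (proj₁ (∈-∖⁻ e∈)) e∉A
  ... | inj₁ e∈ | inj₂ e∈B = clash e∈B (proj₂ (∈-∖⁻ e∈))

  ∉-∖⁻ : {A B : Subset n} {e : Fin n} → e ∉ (A ∖ B) → e ∊ B ⊎ e ∉ A
  ∉-∖⁻ {A} {B} {e} e∉ with ∈⊎∉ e A | ∈⊎∉ e B
  ... | _ | inj₁ e∈B = inj₁ e∈B
  ... | inj₂ e∉A | _ = inj₂ e∉A
  ... | inj₁ e∈A | inj₂ e∉B = clash (∈-∖⁺ (e∈A , e∉B)) e∉

  ∁-in : {S : Subset n} {e : Fin n} → e ∉ S → e ∊ ∁ S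
  ∁-in {S} {e} (nonmem e∉S) = mem (trans (lookup-map e not S) (cong not e∉S))

  ∁-out : {S : Subset n} {e : Fin n} → e ∊ S → e ∉ ∁ S
  ∁-out {S} {e} (mem e∈S) = nonmem (trans (lookup-map e not S) (cong not e∈S))

  _⊑?_ : (A B : Subset n) → A ⊑ B ⊎ ∃ (A ∖∖ B)
  A ⊑? B with search (lookup (A ∖ B))
  ... | inj₁ (e , e∈) = inj₂ (e , ∈-∖⁻ (mem e∈))
  ... | inj₂ none = inj₁ (incl A⊑B)
    where
    A⊑B : {e : Fin n} → e ∊ A → e ∊ B
    A⊑B {e} e∈A with ∉-∖⁻ {A} {B} (nonmem (none e))
    ... | inj₁ e∈B = e∈B
    ... | inj₂ e∉A = clash e∈A e∉A

  ≡⊎≢ : (A B : Subset n) → A ≡ B ⊎ A ≢ B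
  ≡⊎≢ A B with A ⊑? B | B ⊑? A
  ... | inj₁ A⊑B | inj₁ B⊑A = inj₁ (⊑-antisym A⊑B B⊑A)
  ... | inj₂ (e , e∈A , e∉B) | _ = inj₂ λ where refl → clash e∈A e∉B
  ... | _ | inj₂ (e , e∈B , e∉A) = inj₂ λ where refl → clash e∈B e∉A

  ∈∉⇒≢ : {A B : Subset n} {e : Fin n} → e ∊ A → e ∉ B → A ≢ B
  ∈∉⇒≢ e∈A e∉B refl = clash e∈A e∉B

⊆⇒⊑ : {n : ℕ} {A B : Subset n} → A ⊆ B → A ⊑ B
⊆⇒⊑ A⊆B = incl λ {e} (mem e∈) → mem (A⊆B e e∈)

⊑⇒⊆ : {n : ℕ} {A B : Subset n} → A ⊑ B → A ⊆ B
⊑⇒⊆ (incl A⊑B) e e∈ = holds (A⊑B (mem e∈))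

module _ {n : ℕ} {a b : Bool} {A B : Subset n} where

  ⊑-tail : (a ∷ A) ⊑ (b ∷ B) → A ⊑ B
  ⊑-tail (incl A⊑B) = incl λ {e} (mem e∈) → mem (holds (A⊑B {suc e} (mem e∈)))

⊑-head : {n : ℕ} {b : Bool} {A B : Subset n} → (true ∷ A) ⊑ (b ∷ B) → b ≡ true
⊑-head (incl A⊑B) = holds (A⊑B {zero} (mem refl))

⊆ᵇ⇒⊑ : {n : ℕ} (A B : Subset n) → (A ⊆ᵇ B) ≡ true → A ⊑ B
⊆ᵇ⇒⊑ A B A⊆B = ⊆⇒⊑ (go A B A⊆B)
  where
  go : {n : ℕ} (A B : Subset n) → (A ⊆ᵇ B) ≡ true → A ⊆ B
  go (true ∷ A) (true ∷ B) A⊆B zero _ = refl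
  go (true ∷ A) (true ∷ B) A⊆B (suc e) = go A B A⊆B e
  go (false ∷ A) (_ ∷ B) A⊆B (suc e) = go A B A⊆B e

⊑⇒⊆ᵇ : {n : ℕ} (A B : Subset n) → A ⊑ B → (A ⊆ᵇ B) ≡ true
⊑⇒⊆ᵇ [] [] _ = refl
⊑⇒⊆ᵇ (true ∷ A) (b ∷ B) A⊑B rewrite ⊑-head A⊑B = ⊑⇒⊆ᵇ A B (⊑-tail A⊑B)
⊑⇒⊆ᵇ (false ∷ A) (b ∷ B) A⊑B = ⊑⇒⊆ᵇ A B (⊑-tail A⊑B)

-- Counting the absent elements gives a measure that drops as flats grow, the direction in which
-- `flat-induction` recurses.
coSize : {n : ℕ} → Subset n → ℕ
coSize [] = zero
coSize (true ∷ A) = coSize A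
coSize (false ∷ A) = suc (coSize A)

coSize-mono : {n : ℕ} (A B : Subset n) → A ⊑ B → coSize B ≤ coSize A
coSize-mono [] [] _ = z≤n
coSize-mono (true ∷ A) (b ∷ B) A⊑B rewrite ⊑-head A⊑B = coSize-mono A B (⊑-tail A⊑B)
coSize-mono (false ∷ A) (true ∷ B) A⊑B = m≤n⇒m≤1+n (coSize-mono A B (⊑-tail A⊑B))
coSize-mono (false ∷ A) (false ∷ B) A⊑B = s≤s (coSize-mono A B (⊑-tail A⊑B))

coSize-strict : {n : ℕ} (A B : Subset n) → A ⊑ B → ∃ (B ∖∖ A) → coSize B < coSize A
coSize-strict (false ∷ A) (true ∷ B) A⊑B (zero , _) = s≤s (coSize-mono A B (⊑-tail A⊑B))
coSize-strict (false ∷ A) (false ∷ B) A⊑B (zero , mem () , _)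
coSize-strict (true ∷ A) (b ∷ B) A⊑B (zero , _ , nonmem ())
coSize-strict (true ∷ A) (b ∷ B) A⊑B (suc e , mem e∈ , nonmem e∉) rewrite ⊑-head A⊑B =
  coSize-strict A B (⊑-tail A⊑B) (e , mem e∈ , nonmem e∉)
coSize-strict (false ∷ A) (true ∷ B) A⊑B (suc e , mem e∈ , nonmem e∉) =
  m≤n⇒m≤1+n (coSize-strict A B (⊑-tail A⊑B) (e , mem e∈ , nonmem e∉))
coSize-strict (false ∷ A) (false ∷ B) A⊑B (suc e , mem e∈ , nonmem e∉) =
  s≤s (coSize-strict A B (⊑-tail A⊑B) (e , mem e∈ , nonmem e∉))

∈-allSubsets : {n : ℕ} (A : Subset n) → A ∈ₗ allSubsets n
∈-allSubsets [] = here refl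
∈-allSubsets (true ∷ A) = ∈-++⁺ˡ (∈-map⁺ (true ∷_) (∈-allSubsets A))
∈-allSubsets (false ∷ A) = ∈-++⁺ʳ _ (∈-map⁺ (false ∷_) (∈-allSubsets A))

module _ {X : Set} (p : X → Bool) where

  all⇒∀ : {xs : List X} → all p xs ≡ true → ∀ {x} → x ∈ₗ xs → p x ≡ true
  all⇒∀ {y ∷ xs} ok (here refl) = ∧-conicalˡ _ _ ok
  all⇒∀ {y ∷ xs} ok (there x∈) = all⇒∀ {xs} (∧-conicalʳ (p y) _ ok) x∈

  ∀⇒all : {xs : List X} → (∀ {x} → x ∈ₗ xs → p x ≡ true) → all p xs ≡ true
  ∀⇒all {[]} _ = refl
  ∀⇒all {y ∷ xs} ok = ∧-true (ok (here refl)) (∀⇒all {xs} (ok ∘ there))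

  any⇒∃ : {xs : List X} → any p xs ≡ true → ∃ λ x → x ∈ₗ xs × p x ≡ true
  any⇒∃ {y ∷ xs} some with true⊎false (p y)
  ... | inj₁ py = y , here refl , py
  ... | inj₂ ¬py rewrite ¬py with any⇒∃ {xs} some
  ...   | x , x∈ , px = x , there x∈ , px

  ∃⇒any : {xs : List X} {x : X} → x ∈ₗ xs → p x ≡ true → any p xs ≡ true
  ∃⇒any {y ∷ xs} (here refl) px rewrite px = refl
  ∃⇒any {y ∷ xs} (there x∈) px with p y
  ... | true = refl
  ... | false = ∃⇒any x∈ px

-- The lattice of flats: joins with elements, covers, chains

module Flats {n : ℕ} (M : Matroid n) where

  meet : List (Subset n) → Subset n
  meet = foldr _∩_ fullSet

  meet-⊑ : {Fs : List (Subset n)} {F : Subset n} → F ∈ₗ Fs → meet Fs ⊑ F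
  meet-⊑ (here refl) = ∩-⊑ˡ
  meet-⊑ (there F∈) = ⊑-trans ∩-⊑ʳ (meet-⊑ F∈)

  meet-⊒ : {e : Fin n} (Fs : List (Subset n)) → (∀ {F} → F ∈ₗ Fs → e ∊ F) → e ∊ meet Fs
  meet-⊒ [] _ = ∈-full
  meet-⊒ (F ∷ Fs) e∈ = ∈-∩⁺ (e∈ (here refl)) (meet-⊒ Fs (e∈ ∘ there))

  meet-flat : (Fs : List (Subset n)) → (∀ {F} → F ∈ₗ Fs → IsFlat M F) → IsFlat M (meet Fs)
  meet-flat [] _ = flat-E M
  meet-flat (F ∷ Fs) fl = flat-∩ M F (meet Fs) (fl (here refl)) (meet-flat Fs (fl ∘ there))

  module Closure (p : Subset n → Bool) where

    flatsWith : List (Subset n)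
    flatsWith = filter (λ F → (isFlat M F ∧ p F) ≟B true) (allSubsets n)

    closure : Subset n
    closure = meet flatsWith

    ∈-flatsWith : {F : Subset n} → F ∈ₗ flatsWith → IsFlat M F × p F ≡ true
    ∈-flatsWith {F} F∈ = ∧-conicalˡ _ (p F) both , ∧-conicalʳ (isFlat M F) _ both
      where both = proj₂ (∈-filter⁻ (λ F → (isFlat M F ∧ p F) ≟B true) {xs = allSubsets n} F∈)

    closure-flat : IsFlat M closure
    closure-flat = meet-flat flatsWith (proj₁ ∘ ∈-flatsWith)

    closure-min : {K : Subset n} → IsFlat M K → p K ≡ true → closure ⊑ K
    closure-min {K} K-flat pK =
      meet-⊑ (∈-filter⁺ (λ F → (isFlat M F ∧ p F) ≟B true) (∈-allSubsets K) (∧-true K-flat pK))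

    closure-∈ : {e : Fin n} → (∀ {F} → IsFlat M F → p F ≡ true → e ∊ F) → e ∊ closure
    closure-∈ e∈ = meet-⊒ flatsWith λ F∈ → e∈ (proj₁ (∈-flatsWith F∈)) (proj₂ (∈-flatsWith F∈))

  infixl 6 _⊔_
  opaque
    -- The closure of `A` together with `e`. By `⊔-⋖` and `⋖-⊔` the covers of a flat `A` are exactly
    -- the joins `A ⊔ e` with `e` off `A`.
    _⊔_ : Subset n → Fin n → Subset n
    A ⊔ e = Closure.closure (λ F → (A ⊆ᵇ F) ∧ lookup F e)

    ⊔-flat : {A : Subset n} {e : Fin n} → IsFlat M (A ⊔ e)
    ⊔-flat {A} {e} = Closure.closure-flat (λ F → (A ⊆ᵇ F) ∧ lookup F e)

    ⊔-min : {A K : Subset n} {e : Fin n} → IsFlat M K → A ⊑ K → e ∊ K → (A ⊔ e) ⊑ K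
    ⊔-min {A} {e = e} K-flat A⊑K (mem e∈K) =
      Closure.closure-min (λ F → (A ⊆ᵇ F) ∧ lookup F e) K-flat (∧-true (⊑⇒⊆ᵇ _ _ A⊑K) e∈K)

    ⊔-⊒ : {A : Subset n} {e : Fin n} → A ⊑ (A ⊔ e)
    ⊔-⊒ {A} {e} = incl λ a∈A → Closure.closure-∈ (λ F → (A ⊆ᵇ F) ∧ lookup F e)
      λ {F} _ both → at (⊆ᵇ⇒⊑ A F (∧-conicalˡ _ _ both)) a∈A

    ⊔-∈ : {A : Subset n} {e : Fin n} → e ∊ (A ⊔ e)
    ⊔-∈ {A} {e} = Closure.closure-∈ (λ F → (A ⊆ᵇ F) ∧ lookup F e)
      λ {F} _ both → mem (∧-conicalʳ (A ⊆ᵇ F) _ both)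

  infix 4 _⋖_
  -- Compared with `Covers`, strictness is stored as an element, and `⋖-between` takes an element of
  -- `H` off `A`; this replaces the disjunction of equalities by membership facts, which are what
  -- the arguments have at hand.
  record _⋖_ (A G : Subset n) : Set where
    field
      ⋖-flatˡ : IsFlat M A
      ⋖-flat : IsFlat M G
      ⋖-⊑ : A ⊑ G
      ⋖-witness : ∃ (G ∖∖ A)
      ⋖-between : {H : Subset n} {e : Fin n} → IsFlat M H → A ⊑ H → H ⊑ G → (H ∖∖ A) e → H ≡ G
  open _⋖_ public

  covers⇒⋖ : {A G : Subset n} → IsFlat M A → Covers M A G → A ⋖ G
  covers⇒⋖ {A} {G} A-flat (G-flat , (A⊆G , A≢G) , none) = record
    { ⋖-flatˡ = A-flat
    ; ⋖-flat = G-flat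
    ; ⋖-⊑ = ⊆⇒⊑ A⊆G
    ; ⋖-witness = witness
    ; ⋖-between = between
    }
    where
    witness : ∃ (G ∖∖ A)
    witness with G ⊑? A
    ... | inj₁ G⊑A = ⊥-elim (A≢G (⊑-antisym (⊆⇒⊑ A⊆G) G⊑A))
    ... | inj₂ w = w
    between : {H : Subset n} {e : Fin n} → IsFlat M H → A ⊑ H → H ⊑ G → (H ∖∖ A) e → H ≡ G
    between {H} H-flat A⊑H H⊑G (e∈H , e∉A) with none H H-flat (⊑⇒⊆ A⊑H) (⊑⇒⊆ H⊑G)
    ... | inj₁ refl = clash e∈H e∉A
    ... | inj₂ H≡G = H≡G

  ⋖-min : {A G K : Subset n} {e : Fin n} → A ⋖ G → (G ∖∖ A) e → IsFlat M K → A ⊑ K → e ∊ K → G ⊑ K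
  ⋖-min {A} {G} {K} {e} A⋖G (e∈G , e∉A) K-flat A⊑K e∈K =
    subst (_⊑ K) (⋖-between A⋖G ⊔-flat ⊔-⊒ (⊔-min (⋖-flat A⋖G) (⋖-⊑ A⋖G) e∈G) (⊔-∈ , e∉A)) (⊔-min K-flat A⊑K e∈K)

  ⋖-unique : {A G K : Subset n} {e : Fin n} → A ⋖ G → A ⋖ K → (G ∖∖ A) e → e ∊ K → G ≡ K
  ⋖-unique A⋖G A⋖K (e∈G , e∉A) e∈K =
    ⊑-antisym (⋖-min A⋖G (e∈G , e∉A) (⋖-flat A⋖K) (⋖-⊑ A⋖K) e∈K) (⋖-min A⋖K (e∈K , e∉A) (⋖-flat A⋖G) (⋖-⊑ A⋖G) e∈G)

  ⋖-disjoint : {A G K : Subset n} {e : Fin n} → A ⋖ G → A ⋖ K → G ≢ K → (G ∖∖ A) e → e ∉ K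
  ⋖-disjoint {K = K} {e} A⋖G A⋖K G≢K e∈G with ∈⊎∉ e K
  ... | inj₁ e∈K = ⊥-elim (G≢K (⋖-unique A⋖G A⋖K e∈G e∈K))
  ... | inj₂ e∉K = e∉K

  ⊔-⋖ : {A : Subset n} {e : Fin n} → IsFlat M A → e ∉ A → A ⋖ (A ⊔ e)
  ⊔-⋖ {A} {e} A-flat e∉A with proj₁ (flat-cover M A A-flat e (fails e∉A))
  ... | G , A-covers-G , e∈G = subst (A ⋖_) (sym ⊔≡G) A⋖G
    where
    A⋖G = covers⇒⋖ A-flat A-covers-G
    ⊔≡G = ⋖-between A⋖G ⊔-flat ⊔-⊒ (⊔-min (⋖-flat A⋖G) (⋖-⊑ A⋖G) (mem e∈G)) (⊔-∈ , e∉A)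

  ⋖-⊔ : {A G : Subset n} {e : Fin n} → A ⋖ G → (G ∖∖ A) e → G ≡ A ⊔ e
  ⋖-⊔ A⋖G e∈ = ⋖-unique A⋖G (⊔-⋖ (⋖-flatˡ A⋖G) (proj₂ e∈)) e∈ ⊔-∈

  ⊔-swap : {A : Subset n} {i j : Fin n} → (A ⊔ i ⊔ j) ≡ (A ⊔ j ⊔ i)
  ⊔-swap = ⊑-antisym half half
    where
    half : {A : Subset n} {i j : Fin n} → (A ⊔ i ⊔ j) ⊑ (A ⊔ j ⊔ i)
    half = ⊔-min ⊔-flat (⊔-min ⊔-flat (⊑-trans ⊔-⊒ ⊔-⊒) ⊔-∈) (at ⊔-⊒ ⊔-∈)

  -- The exchange property: intervals of rank two are graded.
  ⋖-diamond : {A G G₁ H : Subset n} →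
    A ⋖ G → G ⋖ H → A ⋖ G₁ → G₁ ⊑ H → G₁ ≢ G → G₁ ⋖ H
  ⋖-diamond {A} {G} {G₁} {H} A⋖G G⋖H A⋖G₁ G₁⊑H G₁≢G
    with ⋖-witness A⋖G₁ | ⋖-witness A⋖G
  ... | e , e∈ | g , g∈ = subst (G₁ ⋖_) K≡H G₁⋖K
    where
    G₁⋖K : G₁ ⋖ G₁ ⊔ g
    G₁⋖K = ⊔-⋖ (⋖-flat A⋖G₁) (⋖-disjoint A⋖G A⋖G₁ (G₁≢G ∘ sym) g∈)
    K≡H : G₁ ⊔ g ≡ H
    K≡H = ⋖-between G⋖H ⊔-flat
      (⋖-min A⋖G g∈ ⊔-flat (⊑-trans (⋖-⊑ A⋖G₁) ⊔-⊒) ⊔-∈)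
      (⊔-min (⋖-flat G⋖H) G₁⊑H (at (⋖-⊑ G⋖H) (proj₁ g∈)))
      (at ⊔-⊒ (proj₁ e∈) , ⋖-disjoint A⋖G₁ A⋖G G₁≢G e∈)

  loops≡closure : loops M ≡ Closure.closure (λ _ → true)
  loops≡closure = ⊑-antisym into from
    where
    in-every : ∀ {e F} → e ∊ loops M → IsFlat M F → e ∊ F
    in-every {e} {F} (mem e∈) F-flat = mem (subst (λ b → not b ∨ lookup F e ≡ true) F-flat
      (all⇒∀ (λ S → not (isFlat M S) ∨ lookup S e) {allSubsets n} (trans (sym (lookup∘tabulate _ e)) e∈) (∈-allSubsets F)))
    into : loops M ⊑ Closure.closure (λ _ → true)
    into = incl λ e∈ → Closure.closure-∈ (λ _ → true) λ F-flat _ → in-every e∈ F-flat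
    from : Closure.closure (λ _ → true) ⊑ loops M
    from = incl λ {e} e∈ → mem (trans (lookup∘tabulate _ e)
        (∀⇒all (λ S → not (isFlat M S) ∨ lookup S e) {allSubsets n} λ {S} _ → step e e∈ S))
      where
      step : ∀ e → e ∊ Closure.closure (λ _ → true) → ∀ S → not (isFlat M S) ∨ lookup S e ≡ true
      step e e∈ S with true⊎false (isFlat M S)
      ... | inj₁ S-flat rewrite S-flat = holds (at (Closure.closure-min (λ _ → true) S-flat refl) e∈)
      ... | inj₂ S-not rewrite S-not = refl

  loops-flat : IsFlat M (loops M)
  loops-flat = subst (IsFlat M) (sym loops≡closure) (Closure.closure-flat (λ _ → true))

  loops-min : {F : Subset n} → IsFlat M F → loops M ⊑ F
  loops-min {F} F-flat = subst (_⊑ F) (sym loops≡closure) (Closure.closure-min (λ _ → true) F-flat refl)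

  data Path (A : Subset n) : List (Subset n) → Subset n → Set where
    [] : Path A [] A
    _∷_ : {G B : Subset n} {Gs : List (Subset n)} → A ⋖ G → Path G Gs B → Path A (G ∷ Gs) B

  Path-⊑ : {A B : Subset n} {Gs : List (Subset n)} → Path A Gs B → A ⊑ B
  Path-⊑ [] = ⊑-refl
  Path-⊑ (A⋖G ∷ p) = ⊑-trans (⋖-⊑ A⋖G) (Path-⊑ p)

  Path-∈ : {A B F : Subset n} {Gs : List (Subset n)} → Path A Gs B → F ∈ₗ Gs →
    IsFlat M F × A ⊑ F × ∃ (F ∖∖ A)
  Path-∈ (A⋖G ∷ p) (here refl) = ⋖-flat A⋖G , ⋖-⊑ A⋖G , ⋖-witness A⋖G
  Path-∈ (A⋖G ∷ p) (there F∈) with Path-∈ p F∈ | ⋖-witness A⋖G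
  ... | F-flat , G⊑F , _ | e , e∈G , e∉A = F-flat , ⊑-trans (⋖-⊑ A⋖G) G⊑F , e , at G⊑F e∈G , e∉A

  Path-++ : {A B C : Subset n} {Gs Hs : List (Subset n)} → Path A Gs B → Path B Hs C → Path A (Gs ++ Hs) C
  Path-++ [] q = q
  Path-++ (A⋖G ∷ p) q = A⋖G ∷ Path-++ p q

  flat-induction : {P : Subset n → Set} →
    (∀ A → (∀ G → A ⊑ G → ∃ (G ∖∖ A) → P G) → P A) → ∀ A → P A
  flat-induction {P} step A = go (suc (coSize A)) A ≤-refl
    where
    go : ∀ m A → coSize A < m → P A
    go (suc m) A (s≤s A≤m) = step A λ G A⊑G w → go m G (<-≤-trans (coSize-strict A G A⊑G w) A≤m)

  Path-exists : {A B : Subset n} → IsFlat M A → IsFlat M B → A ⊑ B → ∃ λ Gs → Path A Gs B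
  Path-exists {A} {B} A-flat B-flat A⊑B = flat-induction {P} step A A-flat A⊑B
    where
    P : Subset n → Set
    P A = IsFlat M A → A ⊑ B → ∃ λ Gs → Path A Gs B
    step : ∀ A → (∀ G → A ⊑ G → ∃ (G ∖∖ A) → P G) → P A
    step A rec A-flat A⊑B with B ⊑? A
    ... | inj₁ B⊑A = [] , subst (Path A []) (⊑-antisym A⊑B B⊑A) []
    ... | inj₂ (e , e∈B , e∉A) with rec (A ⊔ e) ⊔-⊒ (e , ⊔-∈ , e∉A) ⊔-flat (⊔-min B-flat A⊑B e∈B)
    ...   | Gs , p = _ , ⊔-⋖ A-flat e∉A ∷ p

-- Sign functions and finite lists of coordinates

Signs : ℕ → Set
Signs n = Fin n → Bool

not-≢ : {a b : Bool} → a ≡ not b → a ≢ b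
not-≢ {true} {true} ()
not-≢ {false} {false} ()

module _ {n : ℕ} where

  open import Data.List.Membership.DecPropositional (_≟_ {n}) using () renaming (_∈?_ to _∈ₗ?_)

  opaque
    -- This is composition of covectors: `z` gives the signs off the zero set `K`, and `w` fills in
    -- the zeros.
    splice : Subset n → Signs n → Signs n → Signs n
    splice K w z e = if lookup K e then w e else z e

    splice-in : {K : Subset n} {w z : Signs n} {e : Fin n} → e ∊ K → splice K w z e ≡ w e
    splice-in {w = w} {z} {e} (mem e∈) = cong (λ b → if b then w e else z e) e∈

    splice-out : {K : Subset n} {w z : Signs n} {e : Fin n} → e ∉ K → splice K w z e ≡ z e
    splice-out {w = w} {z} {e} (nonmem e∉) = cong (λ b → if b then w e else z e) e∉

  free : (A C : Subset n) (S : Signs n) → List (Fin n)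
  free A C S = filter (λ e → (lookup (C ∖ A) e ≟B true) ×-dec (S e ≟B false)) (allFin n)

  ∈-free⁺ : {A C : Subset n} {S : Signs n} {e : Fin n} → (C ∖∖ A) e → S e ≡ false → e ∈ₗ free A C S
  ∈-free⁺ {A} {C} {S} {e} e∈ ¬Se =
    ∈-filter⁺ (λ e → (lookup (C ∖ A) e ≟B true) ×-dec (S e ≟B false)) (∈-allFin e) (holds (∈-∖⁺ e∈) , ¬Se)

  ∈-free⁻ : {A C : Subset n} {S : Signs n} {e : Fin n} → e ∈ₗ free A C S → (C ∖∖ A) e × S e ≡ false
  ∈-free⁻ {A} {C} {S} e∈
    with ∈-filter⁻ (λ e → (lookup (C ∖ A) e ≟B true) ×-dec (S e ≟B false)) {xs = allFin n} e∈
  ... | _ , e∈C∖A , ¬Se = ∈-∖⁻ (mem e∈C∖A) , ¬Se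

  decide : (xs : List (Fin n)) (e : Fin n) → e ∈ₗ xs ⊎ e ∉ₗ xs
  decide xs e with e ∈ₗ? xs
  ... | yes e∈ = inj₁ e∈
  ... | no e∉ = inj₂ e∉

  among : List (Fin n) → Signs n
  among xs e = ⌊ e ∈ₗ? xs ⌋

  among⁺ : {xs : List (Fin n)} {e : Fin n} → e ∈ₗ xs → among xs e ≡ true
  among⁺ {xs} {e} e∈ with e ∈ₗ? xs
  ... | yes _ = refl
  ... | no e∉ = ⊥-elim (e∉ e∈)

  among⁻ : {xs : List (Fin n)} {e : Fin n} → among xs e ≡ true → e ∈ₗ xs
  among⁻ {xs} {e} e∈ with e ∈ₗ? xs
  ... | yes e∈ = e∈

  minus : Fin n → List (Fin n) → List (Fin n)
  minus j = filter (λ d → ¬? (d ≟ j))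

  ∈-minus⁺ : {j d : Fin n} {D : List (Fin n)} → d ∈ₗ D → d ≢ j → d ∈ₗ minus j D
  ∈-minus⁺ {j} = ∈-filter⁺ (λ d → ¬? (d ≟ j))

  ∈-minus⁻ : {j d : Fin n} {D : List (Fin n)} → d ∈ₗ minus j D → d ∈ₗ D × d ≢ j
  ∈-minus⁻ {j} {D = D} = ∈-filter⁻ (λ d → ¬? (d ≟ j)) {xs = D}

  length-minus : {j : Fin n} {D : List (Fin n)} → j ∈ₗ D → length (minus j D) < length D
  length-minus {j} {D} j∈D = filter-notAll (λ d → ¬? (d ≟ j)) D (lose j∈D (λ j≢j → j≢j refl))

-- Walking around a cycle of covers

module Systems {n : ℕ} (M : Matroid n) where

  open Flats M

  -- A closed mod 2 chain of covers of A below C: an even set of "edges" G leaves every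
  -- "vertex" x, and the vertices of one edge agree up to sign on G ∖ A and on C ∖ G.
  record Necklace (A C : Subset n) (E : Subset n → Signs n → Set) : Set where
    field
      edge-⋖ : {G : Subset n} {x : Signs n} → E G x → A ⋖ G
      edge-⊑ : {G : Subset n} {x : Signs n} → E G x → G ⊑ C
      edge-even : {G : Subset n} {x : Signs n} → E G x → ∃ λ G′ → G′ ≢ G × E G′ x
      edge-flip : {G : Subset n} {x : Signs n} → E G x → E G (splice (G ∖ A) (not ∘ x) x)
      edge-rigid : {G : Subset n} {x y : Signs n} {a b : Fin n} → E G x → E G y → (C ∖∖ A) a → (C ∖∖ A) b →
        lookup G a ≡ lookup G b → x a ≡ y a → x b ≡ y b

  -- The outcome of a walk that starts at the edge `G`: coordinates in `fixed` keep their signs, and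
  -- `c` certifies that the new edge is visible, in the sense that crossing it would change a fixed
  -- coordinate.
  record Exchange (A C : Subset n) (E : Subset n → Signs n → Set) (G : Subset n) (x : Signs n)
      (fixed : Fin n → Set) : Set where
    field
      G′ : Subset n
      x′ : Signs n
      c : Fin n
      G′≢G : G′ ≢ G
      edge : E G′ x′
      c∈G′ : (G′ ∖∖ A) c
      c-fixed : fixed c
      agree : {e : Fin n} → fixed e → x′ e ≡ x e

  module _ {A C : Subset n} {E : Subset n → Signs n → Set} (necklace : Necklace A C E) where
    open Necklace necklace

    -- Forgetting one more coordinate f: if the edge found so far is only visible through f,
    -- cross it and search again; rigidity prevents a return to the initial edge.
    exchange : (fs : List (Fin n)) {G : Subset n} {x : Signs n} {a b : Fin n} →
      E G x → (G ∖∖ A) a → a ∉ₗ fs → (C ∖∖ G) b → b ∉ₗ fs → Exchange A C E G x (_∉ₗ fs)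
    exchange [] {G} {x} EGx _ _ _ _ with edge-even EGx
    ... | G′ , G′≢G , EG′x with ⋖-witness (edge-⋖ EG′x)
    ...   | c , c∈ = record
      { G′ = G′ ; x′ = x ; c = c ; G′≢G = G′≢G ; edge = EG′x ; c∈G′ = c∈
      ; c-fixed = λ () ; agree = λ _ → refl }
    exchange (f ∷ fs) {G} {x} {a} {b} EGx a∈G a∉fs b∈ b∉fs
      with exchange fs EGx a∈G (a∉fs ∘ there) b∈ (b∉fs ∘ there)
    ... | record { G′ = G₁ ; x′ = x₁ ; c = c₁ ; G′≢G = G₁≢G ; edge = E₁ ; c∈G′ = c₁∈ ; c-fixed = c₁∉ ; agree = agree₁ }
      with any? (λ c → (lookup (G₁ ∖ A) c ≟B true) ×-dec ¬? (c ∈ₗ? (f ∷ fs)))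
      where open import Data.List.Membership.DecPropositional (_≟_ {n}) using () renaming (_∈?_ to _∈ₗ?_)
    ...   | yes (c , c∈ , c∉) = record
      { G′ = G₁ ; x′ = x₁ ; c = c ; G′≢G = G₁≢G ; edge = E₁ ; c∈G′ = ∈-∖⁻ (mem c∈)
      ; c-fixed = c∉ ; agree = λ e∉ → agree₁ (e∉ ∘ there) }
    -- In the second search `a` takes over the role of `b`: it lies off `G₁`, because distinct
    -- covers of `A` are disjoint over `A`.
    ...   | no none = conclude (exchange fs (edge-flip E₁) c₁∈ c₁∉
                        (at (edge-⊑ EGx) (proj₁ a∈G) , ⋖-disjoint (edge-⋖ EGx) (edge-⋖ E₁) (G₁≢G ∘ sym) a∈G)
                        (a∉fs ∘ there))
      where
      only-f : {e : Fin n} → (G₁ ∖∖ A) e → e ∈ₗ (f ∷ fs)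
      only-f {e} e∈ with decide (f ∷ fs) e
      ... | inj₁ e∈fs = e∈fs
      ... | inj₂ e∉fs = ⊥-elim (none (e , holds (∈-∖⁺ e∈) , e∉fs))
      c₁≡f : c₁ ≡ f
      c₁≡f with only-f c₁∈
      ... | here c₁≡f = c₁≡f
      ... | there c₁∈fs = ⊥-elim (c₁∉ c₁∈fs)
      x₁′ : Signs n
      x₁′ = splice (G₁ ∖ A) (not ∘ x₁) x₁
      x₁′≡x : {e : Fin n} → e ∉ₗ (f ∷ fs) → x₁′ e ≡ x e
      x₁′≡x {e} e∉ with ∈⊎∉ e (G₁ ∖ A)
      ... | inj₁ e∈ = ⊥-elim (e∉ (only-f (∈-∖⁻ e∈)))
      ... | inj₂ e∉′ = trans (splice-out e∉′) (agree₁ (e∉ ∘ there))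
      conclude : Exchange A C E G₁ x₁′ (_∉ₗ fs) → Exchange A C E G x (_∉ₗ (f ∷ fs))
      conclude record { G′ = G₂ ; x′ = x₂ ; c = c₂ ; G′≢G = G₂≢G₁ ; edge = E₂ ; c∈G′ = c₂∈ ; c-fixed = c₂∉ ; agree = agree₂ } =
        record
          { G′ = G₂ ; x′ = x₂ ; c = c₂ ; G′≢G = G₂≢G ; edge = E₂ ; c∈G′ = c₂∈
          ; c-fixed = λ { (here c₂≡f) → clash (subst (_∊ G₁) (trans c₁≡f (sym c₂≡f)) (proj₁ c₁∈)) c₂∉G₁
                        ; (there c₂∈fs) → c₂∉ c₂∈fs }
          ; agree = x₂≡x }
        where
        c₂∉G₁ : c₂ ∉ G₁
        c₂∉G₁ = ⋖-disjoint (edge-⋖ E₂) (edge-⋖ E₁) G₂≢G₁ c₂∈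
        x₂≡x : {e : Fin n} → e ∉ₗ (f ∷ fs) → x₂ e ≡ x e
        x₂≡x e∉ = trans (agree₂ (e∉ ∘ there)) (x₁′≡x e∉)
        x₂c₁≢xc₁ : x₂ c₁ ≢ x c₁
        x₂c₁≢xc₁ = not-≢ (trans (agree₂ c₁∉) (trans (splice-in (∈-∖⁺ c₁∈)) (cong not (agree₁ c₁∉))))
        c₁∉G : c₁ ∉ G
        c₁∉G = ⋖-disjoint (edge-⋖ E₁) (edge-⋖ EGx) G₁≢G c₁∈
        -- `b` and `c₁` both lie off `G`. On a return to `G`, agreement of `x₂` and `x` at `b` would
        -- spread to `c₁`, where crossing `G₁` has changed the sign.
        G₂≢G : G₂ ≢ G
        G₂≢G refl = x₂c₁≢xc₁ (edge-rigid E₂ EGx (proj₁ b∈ , ∉-⊑ (⋖-⊑ (edge-⋖ EGx)) (proj₂ b∈))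
          (at (edge-⊑ E₁) (proj₁ c₁∈) , proj₂ c₁∈)
          (trans (fails (proj₂ b∈)) (sym (fails c₁∉G))) (x₂≡x b∉fs))

    -- Only the coordinates of `C ∖ A` outside `S` are ignored. Signs on `A` and off `C` therefore
    -- survive the walk, while the new edge, which lies in `C ∖ A`, can be visible only through `S`.
    exchange-on : (S : Signs n) {G : Subset n} {x : Signs n} {a b : Fin n} →
      E G x → (G ∖∖ A) a → S a ≡ true → (C ∖∖ G) b → S b ≡ true →
      Exchange A C E G x (λ e → S e ≡ true ⊎ e ∊ A ⊎ e ∉ C)
    exchange-on S {G} {x} EGx a∈ Sa b∈ Sb = record
      { G′ = G′ ; x′ = x′ ; c = c ; G′≢G = G′≢G ; edge = edge ; c∈G′ = c∈G′
      ; c-fixed = c-fixed′ ; agree = λ fixed → agree (fixed⇒∉ fixed) }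
      where
      fixed⇒∉ : {e : Fin n} → S e ≡ true ⊎ e ∊ A ⊎ e ∉ C → e ∉ₗ free A C S
      fixed⇒∉ fixed e∈ with ∈-free⁻ e∈ | fixed
      ... | _ , ¬Se | inj₁ Se = true≢false Se ¬Se
      ... | (_ , e∉A) , _ | inj₂ (inj₁ e∈A) = clash e∈A e∉A
      ... | (e∈C , _) , _ | inj₂ (inj₂ e∉C) = clash e∈C e∉C
      open Exchange (exchange (free A C S) EGx a∈ (fixed⇒∉ (inj₁ Sa)) b∈ (fixed⇒∉ (inj₁ Sb)))
      c-fixed′ : S c ≡ true ⊎ c ∊ A ⊎ c ∉ C
      c-fixed′ with true⊎false (S c)
      ... | inj₁ Sc = inj₁ Sc
      ... | inj₂ ¬Sc = ⊥-elim (c-fixed (∈-free⁺ (at (edge-⊑ edge) (proj₁ c∈G′) , proj₂ c∈G′) ¬Sc))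

  -- R F G x says that x is, on G ∖ F, one of the two opposite sign vectors attached to the cover F ⋖ G.
  record SignSystem : Set₁ where
    field
      R : Subset n → Subset n → Signs n → Set
      R-ext : {F G : Subset n} {x y : Signs n} → R F G x → (∀ {e} → (G ∖∖ F) e → y e ≡ x e) → R F G y
      R-not : {F G : Subset n} {x : Signs n} → F ⋖ G → R F G x → R F G (not ∘ x)
      R-rigid : {F G : Subset n} {x y : Signs n} {a b : Fin n} → F ⋖ G → R F G x → R F G y →
        (G ∖∖ F) a → (G ∖∖ F) b → x a ≡ y a → x b ≡ y b
      R-exists : {F G : Subset n} → F ⋖ G → ∃ (R F G)
      R-even : {A G H : Subset n} {x : Signs n} → A ⋖ G → G ⋖ H → R A G x → R G H x →
        ∃ λ G′ → G′ ≢ G × A ⋖ G′ × G′ ⋖ H × R A G′ x × R G′ H x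

  -- Topes of a sign system: restriction and composition

  module Topes (system : SignSystem) where
    open SignSystem system

    -- T x A B says that x is a tope of the minor M|B / A.
    data T (x : Signs n) : Subset n → Subset n → Set where
      done : {A : Subset n} → T x A A
      step : {A G B : Subset n} → A ⋖ G → R A G x → T x G B → T x A B

    T-⊑ : {A B : Subset n} {x : Signs n} → T x A B → A ⊑ B
    T-⊑ done = ⊑-refl
    T-⊑ (step A⋖G _ t) = ⊑-trans (⋖-⊑ A⋖G) (T-⊑ t)

    T-ext : {A B : Subset n} {x y : Signs n} → T x A B → (∀ {e} → (B ∖∖ A) e → y e ≡ x e) → T y A B
    T-ext done _ = done
    T-ext (step A⋖G r t) same =
      step A⋖G (R-ext r λ (e∈G , e∉A) → same (at (T-⊑ t) e∈G , e∉A))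
        (T-ext t λ (e∈B , e∉G) → same (e∈B , ∉-⊑ (⋖-⊑ A⋖G) e∉G))

    T-not : {A B : Subset n} {x : Signs n} → T x A B → T (not ∘ x) A B
    T-not done = done
    T-not (step A⋖G r t) = step A⋖G (R-not A⋖G r) (T-not t)

    T-++ : {A K B : Subset n} {x : Signs n} → T x A K → T x K B → T x A B
    T-++ done t = t
    T-++ (step A⋖G r s) t = step A⋖G r (T-++ s t)

    T-splice : {A K B : Subset n} {w z : Signs n} → T w A K → T z K B → T (splice K w z) A B
    T-splice s t = T-++ (T-ext s λ (e∈K , _) → splice-in e∈K) (T-ext t λ (_ , e∉K) → splice-out e∉K)

    T-exists : {A B : Subset n} → IsFlat M A → IsFlat M B → A ⊑ B → ∃ λ x → T x A B
    T-exists A-flat B-flat A⊑B = along (proj₂ (Path-exists A-flat B-flat A⊑B))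
      where
      along : {A B : Subset n} {Gs : List (Subset n)} → Path A Gs B → ∃ λ x → T x A B
      along [] = (λ _ → true) , done
      along (A⋖G ∷ p) with R-exists A⋖G | along p
      ... | w , r | z , t = _ , T-splice (step A⋖G r done) t

    Square : Subset n → Subset n → Subset n → Signs n → Set
    Square A C G x = A ⋖ G × G ⋖ C × R A G x × R G C x

    square : {A C : Subset n} → Necklace A C (Square A C)
    square {A} {C} = record
      { edge-⋖ = proj₁
      ; edge-⊑ = λ (_ , G⋖C , _) → ⋖-⊑ G⋖C
      ; edge-even = λ (A⋖G , G⋖C , r , s) → R-even A⋖G G⋖C r s
      ; edge-flip = λ (A⋖G , G⋖C , r , s) → A⋖G , G⋖C ,
          R-ext (R-not A⋖G r) (λ e∈ → splice-in (∈-∖⁺ e∈)) ,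
          R-ext s (λ (_ , e∉G) → splice-out (∉-∖⁺ (inj₁ e∉G)))
      ; edge-rigid = rigid
      }
      where
      rigid : {G : Subset n} {x y : Signs n} {a b : Fin n} → Square A C G x → Square A C G y →
        (C ∖∖ A) a → (C ∖∖ A) b → lookup G a ≡ lookup G b → x a ≡ y a → x b ≡ y b
      rigid {G} {a = a} (A⋖G , G⋖C , r , s) (_ , _ , r′ , s′) (a∈C , a∉A) (b∈C , b∉A) same with ∈⊎∉ a G
      ... | inj₁ a∈G = R-rigid A⋖G r r′ (a∈G , a∉A) (mem (trans (sym same) (holds a∈G)) , b∉A)
      ... | inj₂ a∉G = R-rigid G⋖C s s′ (a∈C , a∉G) (b∈C , nonmem (trans (sym same) (fails a∉G)))

    record FacetMeeting (S : Signs n) (x : Signs n) (A B : Subset n) : Set where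
      field
        y : Signs n
        G : Subset n
        a : Fin n
        A⋖G : A ⋖ G
        R-y : R A G y
        T-y : T y G B
        a∈G : (G ∖∖ A) a
        Sa : S a ≡ true
        agree : {e : Fin n} → S e ≡ true → y e ≡ x e

    -- By induction a tope of [G, B] meets S in the next rank; in that interval of rank two
    -- one then walks around, starting from G, until S is met.
    meet-facet : {x : Signs n} {A B : Subset n} {s : Fin n} → T x A B → (S : Signs n) → (B ∖∖ A) s → S s ≡ true →
      FacetMeeting S x A B
    meet-facet done S (s∈A , s∉A) _ = clash s∈A s∉A
    meet-facet {x} {A} {B} {s} (step {G = G} A⋖G r t) S s∈ Ss with any? (λ a → (lookup (G ∖ A) a ≟B true) ×-dec (S a ≟B true))
    ... | yes (a , a∈ , Sa) = record
      { y = x ; G = G ; a = a ; A⋖G = A⋖G ; R-y = r ; T-y = t ; a∈G = ∈-∖⁻ (mem a∈) ; Sa = Sa ; agree = λ _ → refl }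
    ... | no none = conclude (meet-facet t S (proj₁ s∈ , missed Ss (proj₂ s∈)) Ss)
      where
      missed : {e : Fin n} → S e ≡ true → e ∉ A → e ∉ G
      missed {e} Se e∉A with ∈⊎∉ e G
      ... | inj₁ e∈G = ⊥-elim (none (e , holds (∈-∖⁺ (e∈G , e∉A)) , Se))
      ... | inj₂ e∉G = e∉G
      conclude : FacetMeeting S x G B → FacetMeeting S x A B
      conclude record { y = y₁ ; G = C ; a = a ; A⋖G = G⋖C ; R-y = r₁ ; T-y = t₁ ; a∈G = a∈ ; Sa = Sa ; agree = agree₁ } =
        record { y = x′ ; G = G′ ; a = c ; A⋖G = proj₁ edge ; R-y = proj₁ (proj₂ (proj₂ edge))
               ; T-y = step (proj₁ (proj₂ edge)) (proj₂ (proj₂ (proj₂ edge)))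
                         (T-ext t₁ λ (_ , e∉C) → trans (agree (inj₂ (inj₂ e∉C))) (splice-out (∉-⊑ (⋖-⊑ G⋖C) e∉C)))
               ; a∈G = c∈G′ ; Sa = Sc
               ; agree = λ Se → trans (agree (inj₁ (∨-true Se))) (y₂≡x Se) }
        where
        -- The facet `G` misses `S` off `A`; adding it to the protected coordinates makes it
        -- visible, so that a walk can start there. The edge reached is disjoint from `G` over `A`,
        -- so its protected coordinate belongs to `S`.
        S′ : Signs n
        S′ e = S e ∨ lookup G e
        ∨-true : {a b : Bool} → a ≡ true → a ∨ b ≡ true
        ∨-true refl = refl
        y₂ : Signs n
        y₂ = splice G x y₁
        y₂≡x : {e : Fin n} → S e ≡ true → y₂ e ≡ x e
        y₂≡x {e} Se with ∈⊎∉ e G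
        ... | inj₁ e∈G = splice-in e∈G
        ... | inj₂ e∉G = trans (splice-out e∉G) (agree₁ Se)
        g = ⋖-witness A⋖G
        open Exchange (exchange-on square S′ {x = y₂}
          (A⋖G , G⋖C , R-ext r (λ (e∈G , _) → splice-in e∈G) , R-ext r₁ (λ (_ , e∉G) → splice-out e∉G))
          (proj₂ g) (trans (cong (S (proj₁ g) ∨_) (holds (proj₁ (proj₂ g)))) (∨-zeroʳ _))
          a∈ (∨-true Sa))
        Sc : S c ≡ true
        Sc with c-fixed
        ... | inj₂ (inj₁ c∈A) = clash c∈A (proj₂ c∈G′)
        ... | inj₂ (inj₂ c∉C) = clash (at (⋖-⊑ (proj₁ (proj₂ edge))) (proj₁ c∈G′)) c∉C
        ... | inj₁ S′c = trans (sym (trans (cong (S c ∨_) (fails (⋖-disjoint (proj₁ edge) A⋖G G′≢G c∈G′))) (∨-identityʳ _))) S′c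

    -- With `S` equal to `H`, `meet-facet` returns a cover of `A` that contains an element of `H`
    -- off `A`; this element generates the cover, which hence lies below `H`. Signs on `H` have not
    -- changed, and the rest follows by induction from that cover.
    T-restrict : {x : Signs n} {A H B : Subset n} → IsFlat M H → A ⊑ H → H ⊑ B → T x A B → T x A H
    T-restrict {H = H} {B} H-flat A⊑H H⊑B t = flat-induction {P} restrict _ A⊑H t
      where
      P : Subset n → Set
      P A = {x : Signs n} → A ⊑ H → T x A B → T x A H
      restrict : ∀ A → (∀ G → A ⊑ G → ∃ (G ∖∖ A) → P G) → P A
      restrict A rec A⊑H t with H ⊑? A
      ... | inj₁ H⊑A = subst (T _ A) (⊑-antisym A⊑H H⊑A) done
      ... | inj₂ (s , s∈) = T-ext (step A⋖G R-y (rec G (⋖-⊑ A⋖G) (⋖-witness A⋖G) G⊑H T-y)) λ (e∈H , _) → sym (agree (holds e∈H))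
        where
        open FacetMeeting (meet-facet t (lookup H) (at H⊑B (proj₁ s∈) , proj₂ s∈) (holds (proj₁ s∈)))
        G⊑H : G ⊑ H
        G⊑H = ⋖-min A⋖G a∈G H-flat A⊑H (mem Sa)

    T-compose : {w z : Signs n} {A K B : Subset n} → IsFlat M K → A ⊑ K → T w A B → T z K B → T (splice K w z) A B
    T-compose K-flat A⊑K s t = T-splice (T-restrict K-flat A⊑K (T-⊑ t) s) t

    -- Restriction to an interval of length one: compatibility with a single maximal chain implies
    -- compatibility with every cover of `A` below `B`.
    T-R : {x : Signs n} {A G B : Subset n} → A ⋖ G → G ⊑ B → T x A B → R A G x
    T-R {x} {A} {G} A⋖G G⊑B t = first (T-restrict (⋖-flat A⋖G) (⋖-⊑ A⋖G) G⊑B t)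
      where
      first : T x A G → R A G x
      first done = clash (proj₁ (proj₂ (⋖-witness A⋖G))) (proj₂ (proj₂ (⋖-witness A⋖G)))
      first (step A⋖G′ r t) =
        subst (λ H → R A H x) (⋖-between A⋖G (⋖-flat A⋖G′) (⋖-⊑ A⋖G′) (T-⊑ t) (proj₂ (⋖-witness A⋖G′))) r

    T-rigid : {x y : Signs n} {A G B : Subset n} {a b : Fin n} → A ⋖ G → G ⊑ B → T x A B → T y A B →
      (G ∖∖ A) a → (G ∖∖ A) b → x a ≡ y a → x b ≡ y b
    T-rigid A⋖G G⊑B s t = R-rigid A⋖G (T-R A⋖G G⊑B s) (T-R A⋖G G⊑B t)

    T-extend : {A B : Subset n} {z : Signs n} → IsFlat M A → IsFlat M B → T z A B →
      ∃ λ w → T w A fullSet × (∀ {e} → e ∊ B → w e ≡ z e)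
    T-extend A-flat B-flat t with T-exists B-flat (flat-E M) ⊑-full
    ... | v , s = _ , T-splice t s , splice-in

    choose-sign : {P : Signs n → Set} → (∀ {x} → P x → P (not ∘ x)) → (∃ λ x → P x) → (i : Fin n) (b : Bool) →
      ∃ λ x → P x × x i ≡ b
    choose-sign P-not (x , Px) i b with x i ≟B b
    ... | yes xi≡b = x , Px , xi≡b
    ... | no xi≢b = not ∘ x , P-not Px , sym (¬-not (xi≢b ∘ sym))

    T-fill : {A B : Subset n} {i : Fin n} {z : Signs n} → IsFlat M A → i ∉ A → T z (A ⊔ i) B → (b : Bool) →
      ∃ λ w → T w A B × w i ≡ b × (∀ {e} → e ∉ (A ⊔ i) → w e ≡ z e)
    T-fill {A} {i = i} A-flat i∉A t b with choose-sign {R A (A ⊔ i)} (R-not (⊔-⋖ A-flat i∉A)) (R-exists (⊔-⋖ A-flat i∉A)) i b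
    ... | u , r , ui≡b = _ , T-splice (step (⊔-⋖ A-flat i∉A) r done) t , trans (splice-in ⊔-∈) ui≡b , splice-out

    -- Elimination for topes

    -- The zero set is `A ⊔ i` exactly, not merely some flat containing `i`. Eliminants for
    -- different lists `D` then live over the same flat, so that they can be compared, composed and
    -- fed into further eliminations.
    record Eliminant (x : Signs n) (A : Subset n) (i : Fin n) (D : List (Fin n)) : Set where
      field
        z : Signs n
        tope : T z (A ⊔ i) fullSet
        off : {d : Fin n} → d ∈ₗ D → d ∉ (A ⊔ i)
        agree : {d : Fin n} → d ∈ₗ D → z d ≡ x d

    -- `D` is any list of coordinates of agreement, not the list of all of them: the induction
    -- shortens it, and `slide` eliminates another coordinate while keeping the sign at `i`.
    record Separated (x y : Signs n) (A : Subset n) (i : Fin n) (D : List (Fin n)) : Set where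
      field
        A-flat : IsFlat M A
        x-tope : T x A fullSet
        y-tope : T y A fullSet
        i∉A : i ∉ A
        xi≢yi : x i ≢ y i
        D∉A : {d : Fin n} → d ∈ₗ D → d ∉ A
        x≡y : {d : Fin n} → d ∈ₗ D → x d ≡ y d

    ⊔-absorb : {A : Subset n} {i j : Fin n} → IsFlat M A → i ∉ A → j ∉ A → j ∉ (A ⊔ i) → i ∉ (A ⊔ j)
    ⊔-absorb {A} {i} {j} A-flat i∉A j∉A j∉I with ∈⊎∉ i (A ⊔ j)
    ... | inj₂ i∉J = i∉J
    ... | inj₁ i∈J = clash (subst (j ∊_) (⋖-⊔ (⊔-⋖ A-flat j∉A) (i∈J , i∉A)) ⊔-∈) j∉I

    module Elimination {x y : Signs n} {A : Subset n} {i : Fin n} {D : List (Fin n)} (sep : Separated x y A i D) where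
      open Separated sep

      I : Subset n
      I = A ⊔ i

      A⋖I : A ⋖ I
      A⋖I = ⊔-⋖ A-flat i∉A

      -- By rigidity, agreement anywhere on `I ∖ A` would spread to `i`.
      D∉I : {d : Fin n} → d ∈ₗ D → d ∉ I
      D∉I {d} d∈D with ∈⊎∉ d I
      ... | inj₂ d∉I = d∉I
      ... | inj₁ d∈I = ⊥-elim (xi≢yi (T-rigid A⋖I ⊑-full x-tope y-tope (d∈I , D∉A d∈D) (⊔-∈ , i∉A) (x≡y d∈D)))

      i∉A⊔ : {d : Fin n} → d ∈ₗ D → i ∉ (A ⊔ d)
      i∉A⊔ d∈D = ⊔-absorb A-flat i∉A (D∉A d∈D) (D∉I d∈D)

      module _ {j k : Fin n} (j∈D : j ∈ₗ D) (k∈D : k ∈ₗ D) (k∉J : k ∉ (A ⊔ j))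
               (only : {d : Fin n} → d ∈ₗ D → d ≡ j ⊎ d ≡ k) where

        -- If `k` lies off `I ⊔ j`, the signs at `j` and `k` can be prescribed independently.
        -- Otherwise `I ⊔ j` has rank two over `A`, and `i`, `j`, `k` lie in three distinct covers
        -- `I`, `J`, `K` of `A`. Seen through these three coordinates, each of `x` and `y` borders
        -- on `I` or on `J`, since a walk from `K` ends at one of the other two. Bordering on `I`
        -- yields an eliminant. If both border on `J`, rigidity of `J ⋖ C` carries the agreement at
        -- `k` over to `i`, which is absurd.
        two-element : Eliminant x A i D
        two-element with ∈⊎∉ k (I ⊔ j)
        ... | inj₂ k∉I⊔j = record { z = proj₁ t₂ ; tope = proj₁ (proj₂ t₂) ; off = D∉I ; agree = agree }
          where
          t₁ = T-fill ⊔-flat k∉I⊔j (proj₂ (T-exists (⊔-flat {I ⊔ j} {k}) (flat-E M) ⊑-full)) (x k)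
          t₂ = T-fill ⊔-flat (D∉I j∈D) (proj₁ (proj₂ t₁)) (x j)
          agree : {d : Fin n} → d ∈ₗ D → proj₁ t₂ d ≡ x d
          agree d∈D with only d∈D
          ... | inj₁ refl = proj₁ (proj₂ (proj₂ t₂))
          ... | inj₂ refl = trans (proj₂ (proj₂ (proj₂ t₂)) k∉I⊔j) (proj₁ (proj₂ (proj₂ t₁)))
        ... | inj₁ k∈C = combine (link x-tope) (link y-tope)
          where
          C = I ⊔ j
          J = A ⊔ j
          K = A ⊔ k
          I⋖C : I ⋖ C
          I⋖C = ⊔-⋖ ⊔-flat (D∉I j∈D)
          J⋖C : J ⋖ C
          J⋖C = subst (J ⋖_) ⊔-swap (⊔-⋖ ⊔-flat (i∉A⊔ j∈D))
          A⊑C : A ⊑ C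
          A⊑C = ⊑-trans ⊔-⊒ ⊔-⊒
          i∈C : i ∊ C
          i∈C = at ⊔-⊒ ⊔-∈
          S = among (i ∷ j ∷ k ∷ [])
          Link : Signs n → Subset n → Set
          Link u G = ∃ λ z → R G C z × (∀ {d} → d ∈ₗ (i ∷ j ∷ k ∷ []) → z d ≡ u d)
          link : {u : Signs n} → T u A fullSet → Link u I ⊎ Link u J
          link {u} t = found (meet-facet (T-restrict ⊔-flat A⊑C ⊑-full t) S (i∈C , i∉A) (among⁺ (here refl)))
            where
            around : {u₁ : Signs n} → A ⋖ K → K ⋖ C → (∀ {d} → d ∈ₗ (i ∷ j ∷ k ∷ []) → u₁ d ≡ u d) →
              Exchange A C (Square A C) K u₁ (λ e → S e ≡ true ⊎ e ∊ A ⊎ e ∉ C) → Link u I ⊎ Link u J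
            around {u₁} A⋖K K⋖C u₁≡u record { G′ = G ; x′ = u₂ ; c = c ; G′≢G = G≢K ; edge = (A⋖G , G⋖C , _ , r₂) ; c∈G′ = c∈G ; c-fixed = c-fixed ; agree = agree } =
              split (among⁻ (visible c-fixed))
              where
              visible : S c ≡ true ⊎ c ∊ A ⊎ c ∉ C → S c ≡ true
              visible (inj₁ Sc) = Sc
              visible (inj₂ (inj₁ c∈A)) = clash c∈A (proj₂ c∈G)
              visible (inj₂ (inj₂ c∉C)) = clash (at (⋖-⊑ G⋖C) (proj₁ c∈G)) c∉C
              u₂≡u : {d : Fin n} → d ∈ₗ (i ∷ j ∷ k ∷ []) → u₂ d ≡ u d
              u₂≡u d∈ = trans (agree (inj₁ (among⁺ d∈))) (u₁≡u d∈)
              split : c ∈ₗ (i ∷ j ∷ k ∷ []) → Link u I ⊎ Link u J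
              split (here refl) = inj₁ (u₂ , subst (λ G → R G C u₂) (⋖-⊔ A⋖G c∈G) r₂ , u₂≡u)
              split (there (here refl)) = inj₂ (u₂ , subst (λ G → R G C u₂) (⋖-⊔ A⋖G c∈G) r₂ , u₂≡u)
              split (there (there (here refl))) = ⊥-elim (G≢K (⋖-unique A⋖G A⋖K c∈G ⊔-∈))
            found : FacetMeeting S u A C → Link u I ⊎ Link u J
            found record { y = u₁ ; G = G ; a = a ; A⋖G = A⋖G ; R-y = r₁ ; T-y = t₁ ; a∈G = a∈G ; Sa = Sa ; agree = agree } = split (among⁻ Sa)
              where
              u₁≡u : {d : Fin n} → d ∈ₗ (i ∷ j ∷ k ∷ []) → u₁ d ≡ u d
              u₁≡u d∈ = agree (among⁺ d∈)
              split : a ∈ₗ (i ∷ j ∷ k ∷ []) → Link u I ⊎ Link u J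
              split (here refl) with ⋖-⊔ A⋖G a∈G
              ... | refl = inj₁ (u₁ , T-R I⋖C ⊑-refl t₁ , u₁≡u)
              split (there (here refl)) with ⋖-⊔ A⋖G a∈G
              ... | refl = inj₂ (u₁ , T-R J⋖C ⊑-refl t₁ , u₁≡u)
              split (there (there (here refl))) with ⋖-⊔ A⋖G a∈G
              ... | refl = around A⋖G K⋖C u₁≡u (exchange-on square S (A⋖G , K⋖C , r₁ , T-R K⋖C ⊑-refl t₁) a∈G Sa
                             (i∈C , i∉A⊔ k∈D) (among⁺ (here refl)))
                where
                K⋖C : K ⋖ C
                K⋖C = ⋖-diamond A⋖I I⋖C A⋖G (T-⊑ t₁) (∈∉⇒≢ ⊔-∈ (D∉I k∈D))
          finish : {u : Signs n} → (∀ {d} → d ∈ₗ D → u d ≡ x d) → Link u I → Eliminant x A i D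
          finish u≡x (z , r , z≡u) with T-extend ⊔-flat ⊔-flat (step I⋖C r done)
          ... | w , t , w≡z = record
            { z = w ; tope = t ; off = D∉I
            ; agree = λ d∈D → trans (w≡z (D⊑C d∈D)) (trans (z≡u (D⊑S d∈D)) (u≡x d∈D)) }
            where
            D⊑C : {d : Fin n} → d ∈ₗ D → d ∊ C
            D⊑C d∈D with only d∈D
            ... | inj₁ refl = ⊔-∈
            ... | inj₂ refl = k∈C
            D⊑S : {d : Fin n} → d ∈ₗ D → d ∈ₗ (i ∷ j ∷ k ∷ [])
            D⊑S d∈D with only d∈D
            ... | inj₁ refl = there (here refl)
            ... | inj₂ refl = there (there (here refl))
          combine : Link x I ⊎ Link x J → Link y I ⊎ Link y J → Eliminant x A i D
          combine (inj₁ l) _ = finish (λ _ → refl) l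
          combine _ (inj₁ l) = finish (λ d∈D → sym (x≡y d∈D)) l
          combine (inj₂ (z , r , z≡x)) (inj₂ (z′ , r′ , z′≡y)) = ⊥-elim (xi≢yi
            (trans (sym (z≡x (here refl))) (trans
              (R-rigid J⋖C r r′ (k∈C , k∉J) (i∈C , i∉A⊔ j∈D)
                (trans (z≡x (there (there (here refl)))) (trans (x≡y k∈D) (sym (z′≡y (there (there (here refl))))))))
              (z′≡y (here refl)))))

      module Step
        (deeper : {x y : Signs n} {A′ : Subset n} {i : Fin n} {D : List (Fin n)} →
           A ⊑ A′ → ∃ (A′ ∖∖ A) → Separated x y A′ i D → Eliminant x A′ i D)
        (dropped : {j : Fin n} → j ∈ₗ D → Eliminant x A i (minus j D)) where

        -- Elimination over `J` loses the signs on `D` inside `J`. A tope `w` over `I` fills them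
        -- in: its sign is adjusted at `j` only, and rigidity of `A ⋖ J`, applied to an extension of
        -- `w` to a tope over `A`, makes it agree with `x` on the rest of `D` inside `J`.
        common-facet : {x* y* : Signs n} {j : Fin n} → j ∈ₗ D → T x* (A ⊔ j) fullSet → T y* (A ⊔ j) fullSet →
          x* i ≡ x i → y* i ≡ y i → (∀ {d} → d ∈ₗ D → x* d ≡ x d) → (∀ {d} → d ∈ₗ D → y* d ≡ y d) → Eliminant x A i D
        common-facet {x*} {y*} {j} j∈D s t x*i y*i x*≡x y*≡y = record
          { z = splice (J ⊔ i) w z
          ; tope = T-compose ⊔-flat I⊑ w-tope tope
          ; off = D∉I
          ; agree = agree′ }
          where
          J = A ⊔ j
          D′ = filter (λ d → lookup J d ≟B false) D
          D′⁻ : {d : Fin n} → d ∈ₗ D′ → d ∈ₗ D × d ∉ J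
          D′⁻ d∈ with ∈-filter⁻ (λ d → lookup J d ≟B false) {xs = D} d∈
          ... | d∈D , d∉J = d∈D , nonmem d∉J
          I⊑ : I ⊑ (J ⊔ i)
          I⊑ = ⊔-min ⊔-flat (⊑-trans ⊔-⊒ ⊔-⊒) ⊔-∈
          eliminant : Eliminant x* J i D′
          eliminant = deeper {x = x*} {y*} {J} {i} {D′} ⊔-⊒ (j , ⊔-∈ , D∉A j∈D) record
            { A-flat = ⊔-flat ; x-tope = s ; y-tope = t ; i∉A = i∉A⊔ j∈D
            ; xi≢yi = λ same → xi≢yi (trans (sym x*i) (trans same y*i))
            ; D∉A = proj₂ ∘ D′⁻
            ; x≡y = λ d∈ → let d∈D = proj₁ (D′⁻ d∈) in trans (x*≡x d∈D) (trans (x≡y d∈D) (sym (y*≡y d∈D))) }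
          open Eliminant eliminant
          signed = choose-sign {λ w → T w I fullSet} T-not (T-exists ⊔-flat (flat-E M) ⊑-full) j (x j)
          w = proj₁ signed
          w-tope = proj₁ (proj₂ signed)
          filled = T-fill A-flat i∉A w-tope true
          w≡x : {d : Fin n} → d ∈ₗ D → d ∊ J → w d ≡ x d
          w≡x d∈D d∈J = trans (sym (proj₂ (proj₂ (proj₂ filled)) (D∉I d∈D)))
            (T-rigid (⊔-⋖ A-flat (D∉A j∈D)) ⊑-full (proj₁ (proj₂ filled)) x-tope (⊔-∈ , D∉A j∈D) (d∈J , D∉A d∈D)
              (trans (proj₂ (proj₂ (proj₂ filled)) (D∉I j∈D)) (proj₂ (proj₂ signed))))
          agree′ : {d : Fin n} → d ∈ₗ D → splice (J ⊔ i) w z d ≡ x d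
          agree′ {d} d∈D with ∈⊎∉ d J
          ... | inj₁ d∈J = trans (splice-in (at ⊔-⊒ d∈J)) (w≡x d∈D d∈J)
          ... | inj₂ d∉J = trans (splice-out (off d∈D′)) (trans (agree d∈D′) (x*≡x d∈D))
            where d∈D′ = ∈-filter⁺ (λ d → lookup J d ≟B false) d∈D (fails d∉J)

        module _ {k′ : Fin n} (k′∈D : k′ ∈ₗ D) where

          private module Z′ = Eliminant (dropped k′∈D)

          Rest : Fin n → Fin n → List (Fin n) → Set
          Rest j k D₂ = (∀ {d} → d ∈ₗ D₂ → d ∈ₗ D × d ≢ j × d ≢ k) ×
                        (∀ {d} → d ∈ₗ D → d ≢ j → d ≢ k → d ∈ₗ D₂)

          -- Composing with the eliminant for D without k′ repairs the signs of j and k.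
          patch : {j k : Fin n} {D₂ : List (Fin n)} {Q : Subset n} {v : Signs n} → k′ ≢ j → k′ ≢ k → Rest j k D₂ →
            IsFlat M Q → I ⊑ Q → T v Q fullSet → (∀ {d} → d ∈ₗ D₂ → d ∉ Q) → (∀ {d} → d ∈ₗ D₂ → v d ≡ x d) →
            (j ∊ Q) → (k ∊ Q ⊎ v k ≡ x k) → Eliminant x A i D
          patch {j} {k} {D₂} {Q} {v} k′≢j k′≢k (_ , rest) Q-flat I⊑Q t D₂∉Q v≡x j∈Q k∈Q⊎ = record
            { z = splice Q Z′.z v ; tope = T-compose Q-flat I⊑Q Z′.tope t ; off = D∉I ; agree = agree′ }
            where
            inside : {d : Fin n} → d ∈ₗ D → d ≢ k′ → d ∊ Q → splice Q Z′.z v d ≡ x d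
            inside d∈D d≢k′ d∈Q = trans (splice-in d∈Q) (Z′.agree (∈-minus⁺ d∈D d≢k′))
            agree′ : {d : Fin n} → d ∈ₗ D → splice Q Z′.z v d ≡ x d
            agree′ {d} d∈D with d ≟ j | d ≟ k
            ... | yes refl | _ = inside d∈D (k′≢j ∘ sym) j∈Q
            ... | no d≢j | no d≢k = trans (splice-out (D₂∉Q (rest d∈D d≢j d≢k))) (v≡x (rest d∈D d≢j d≢k))
            ... | no d≢j | yes refl = at-k (∈⊎∉ d Q) k∈Q⊎
              where
              at-k : d ∊ Q ⊎ d ∉ Q → d ∊ Q ⊎ v d ≡ x d → splice Q Z′.z v d ≡ x d
              at-k (inj₁ d∈Q) _ = inside d∈D (k′≢k ∘ sym) d∈Q
              at-k (inj₂ d∉Q) (inj₁ d∈Q) = clash d∈Q d∉Q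
              at-k (inj₂ d∉Q) (inj₂ vd) = trans (splice-out d∉Q) vd

          -- In [A ⊔ j, ⊤], a tope which agrees with x except at k is obtained from the eliminants
          -- for D without j and D without k; eliminating k against x* yields a tope of [A ⊔ j ⊔ k, ⊤].
          slide : {j k : Fin n} {D₂ : List (Fin n)} {x* : Signs n} → k′ ≢ j → k′ ≢ k → Rest j k D₂ →
            j ∈ₗ D → k ∈ₗ D → k ≢ j → k ∉ (A ⊔ j) → T x* (A ⊔ j) fullSet → (∀ {d} → d ∈ₗ D → x* d ≡ x d) →
            (zj : Eliminant x A i (minus j D)) (zk : Eliminant x A i (minus k D)) → Eliminant.z zj j ≢ x j →
            Eliminant x A i D ⊎ Eliminant x* (A ⊔ j) k (i ∷ D₂)
          slide {j} {k} {D₂} {x*} k′≢j k′≢k rest j∈D k∈D k≢j k∉J s x*≡x zj zk zj≢x =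
            decideV (∈⊎∉ k (I ⊔ j)) (V.z k ≟B x k)
            where
            module Zj = Eliminant zj
            module Zk = Eliminant zk
            J = A ⊔ j
            zj≡x : {d : Fin n} → d ∈ₗ D₂ → Zj.z d ≡ x d
            zj≡x d∈ = let d∈D , d≢j , _ = proj₁ rest d∈ in Zj.agree (∈-minus⁺ d∈D d≢j)
            zk≡x : {d : Fin n} → d ∈ₗ D₂ → Zk.z d ≡ x d
            zk≡x d∈ = let d∈D , _ , d≢k = proj₁ rest d∈ in Zk.agree (∈-minus⁺ d∈D d≢k)
            V = deeper {x = Zj.z} {Zk.z} {I} {j} {D₂} ⊔-⊒ (i , ⊔-∈ , i∉A) record
              { A-flat = ⊔-flat ; x-tope = Zj.tope ; y-tope = Zk.tope ; i∉A = D∉I j∈D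
              ; xi≢yi = λ same → zj≢x (trans same (Zk.agree (∈-minus⁺ j∈D (k≢j ∘ sym))))
              ; D∉A = D∉I ∘ proj₁ ∘ proj₁ rest
              ; x≡y = λ d∈ → trans (zj≡x d∈) (sym (zk≡x d∈)) }
            module V = Eliminant V
            V≡x : {d : Fin n} → d ∈ₗ D₂ → V.z d ≡ x d
            V≡x d∈ = trans (V.agree d∈) (zj≡x d∈)
            decideV : k ∊ (I ⊔ j) ⊎ k ∉ (I ⊔ j) → Dec (V.z k ≡ x k) → Eliminant x A i D ⊎ Eliminant x* J k (i ∷ D₂)
            decideV (inj₁ k∈) _ = inj₁ (patch k′≢j k′≢k rest ⊔-flat ⊔-⊒ V.tope V.off V≡x ⊔-∈ (inj₁ k∈))
            decideV _ (yes Vk) = inj₁ (patch k′≢j k′≢k rest ⊔-flat ⊔-⊒ V.tope V.off V≡x ⊔-∈ (inj₂ Vk))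
            decideV (inj₂ k∉) (no Vk≢xk) = inj₂ (deeper {x = x*} {v} {J} {k} {i ∷ D₂} ⊔-⊒ (j , ⊔-∈ , D∉A j∈D) record
              { A-flat = ⊔-flat ; x-tope = s ; y-tope = proj₁ (proj₂ filled) ; i∉A = k∉J
              ; xi≢yi = λ same → Vk≢xk (trans (sym (trans same (v≡V k∉))) (x*≡x k∈D))
              ; D∉A = λ { (here refl) → i∉A⊔ j∈D ; (there d∈) → ∉-⊑ J⊑I⊔j (V.off d∈) }
              ; x≡y = λ { (here refl) → sym (proj₁ (proj₂ (proj₂ filled)))
                        ; (there d∈) → trans (x*≡x (proj₁ (proj₁ rest d∈))) (sym (trans (v≡V (V.off d∈)) (V≡x d∈))) } })
              where
              filled = T-fill ⊔-flat (i∉A⊔ j∈D) (subst (λ G → T V.z G fullSet) ⊔-swap V.tope) (x* i)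
              v = proj₁ filled
              v≡V : {e : Fin n} → e ∉ (I ⊔ j) → v e ≡ V.z e
              v≡V {e} e∉ = proj₂ (proj₂ (proj₂ filled)) (subst (e ∉_) ⊔-swap e∉)
              J⊑I⊔j : J ⊑ (I ⊔ j)
              J⊑I⊔j = subst (J ⊑_) ⊔-swap ⊔-⊒

          -- An eliminant for `D` without `j` that has the right sign at `j` is one for `D`, and
          -- likewise for `k`. Otherwise the two slides, unless they finish at once, lead to topes
          -- over the common flat `A ⊔ j ⊔ k` which still have the signs of `x` and `y` at `i`, so
          -- `i` can be eliminated there. The result vanishes at `j` and `k`; the eliminant that
          -- released `k′` has both signs right, which is why a third element is required.
          three-elements : {x* y* : Signs n} {j k : Fin n} → k′ ≢ j → k′ ≢ k →
            j ∈ₗ D → k ∈ₗ D → k ≢ j → k ∉ (A ⊔ j) → T x* (A ⊔ j) fullSet → T y* (A ⊔ k) fullSet →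
            x* i ≡ x i → y* i ≡ y i → (∀ {d} → d ∈ₗ D → x* d ≡ x d) → (∀ {d} → d ∈ₗ D → y* d ≡ y d) → Eliminant x A i D
          three-elements {x*} {y*} {j} {k} k′≢j k′≢k j∈D k∈D k≢j k∉J s t x*i y*i x*≡x y*≡y
            with dropped j∈D | dropped k∈D
          ... | zj | zk with Eliminant.z zj j ≟B x j | Eliminant.z zk k ≟B x k
          ...   | yes zj≡x | _ = record { z = z ; tope = tope ; off = D∉I ; agree = agree′ }
            where
            open Eliminant zj
            agree′ : {d : Fin n} → d ∈ₗ D → z d ≡ x d
            agree′ {d} d∈D with d ≟ j
            ... | yes refl = zj≡x
            ... | no d≢j = agree (∈-minus⁺ d∈D d≢j)
          ...   | no _ | yes zk≡x = record { z = z ; tope = tope ; off = D∉I ; agree = agree′ }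
            where
            open Eliminant zk
            agree′ : {d : Fin n} → d ∈ₗ D → z d ≡ x d
            agree′ {d} d∈D with d ≟ k
            ... | yes refl = zk≡x
            ... | no d≢k = agree (∈-minus⁺ d∈D d≢k)
          ...   | no zj≢x | no zk≢x = conclude
            (slide k′≢j k′≢k rest j∈D k∈D k≢j k∉J s x*≡x zj zk zj≢x)
            (slide k′≢k k′≢j rest′ k∈D j∈D (k≢j ∘ sym) j∉K t (λ d∈D → trans (y*≡y d∈D) (sym (x≡y d∈D))) zk zj zk≢x)
            where
            D₂ = minus k (minus j D)
            Q = A ⊔ j ⊔ k
            j∉K : j ∉ (A ⊔ k)
            j∉K = ⊔-absorb A-flat (D∉A j∈D) (D∉A k∈D) k∉J
            rest : Rest j k D₂
            rest = (λ d∈ → let d∈′ , d≢k = ∈-minus⁻ {D = minus j D} d∈ ; d∈D , d≢j = ∈-minus⁻ {D = D} d∈′ in d∈D , d≢j , d≢k) ,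
              λ d∈D d≢j d≢k → ∈-minus⁺ (∈-minus⁺ d∈D d≢j) d≢k
            rest′ : Rest k j D₂
            rest′ = (λ d∈ → let d∈D , d≢j , d≢k = proj₁ rest d∈ in d∈D , d≢k , d≢j) , λ d∈D d≢k d≢j → proj₂ rest d∈D d≢j d≢k
            conclude : Eliminant x A i D ⊎ Eliminant x* (A ⊔ j) k (i ∷ D₂) →
                       Eliminant x A i D ⊎ Eliminant y* (A ⊔ k) j (i ∷ D₂) → Eliminant x A i D
            conclude (inj₁ found) _ = found
            conclude _ (inj₁ found) = found
            conclude (inj₂ W) (inj₂ W′) = patch k′≢j k′≢k rest ⊔-flat
                (⊔-min ⊔-flat (⊑-trans ⊔-⊒ (⊑-trans ⊔-⊒ ⊔-⊒)) ⊔-∈) tope off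
                (λ d∈ → trans (agree d∈) (W≡x d∈)) (at ⊔-⊒ (at ⊔-⊒ ⊔-∈)) (inj₁ (at ⊔-⊒ ⊔-∈))
              where
              module W = Eliminant W
              module W′ = Eliminant W′
              W≡x : {d : Fin n} → d ∈ₗ D₂ → W.z d ≡ x d
              W≡x d∈ = trans (W.agree (there d∈)) (x*≡x (proj₁ (proj₁ rest d∈)))
              W′≡y : {d : Fin n} → d ∈ₗ D₂ → W′.z d ≡ y d
              W′≡y d∈ = trans (W′.agree (there d∈)) (y*≡y (proj₁ (proj₁ rest d∈)))
              eliminant : Eliminant W.z Q i D₂
              eliminant = deeper {x = W.z} {W′.z} {Q} {i} {D₂} (⊑-trans ⊔-⊒ ⊔-⊒) (j , at ⊔-⊒ ⊔-∈ , D∉A j∈D) record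
                { A-flat = ⊔-flat ; x-tope = W.tope ; y-tope = subst (λ G → T W′.z G fullSet) ⊔-swap W′.tope
                ; i∉A = W.off (here refl)
                ; xi≢yi = λ same → xi≢yi (trans (sym (trans (W.agree (here refl)) x*i))
                                     (trans same (trans (W′.agree (here refl)) y*i)))
                ; D∉A = λ d∈ → W.off (there d∈)
                ; x≡y = λ d∈ → trans (W≡x d∈) (trans (x≡y (proj₁ (proj₁ rest d∈))) (sym (W′≡y d∈))) }
              open Eliminant eliminant

        third : (j k : Fin n) (Ds : List (Fin n)) →
          (∃ λ k′ → k′ ∈ₗ Ds × k′ ≢ j × k′ ≢ k) ⊎ (∀ {d} → d ∈ₗ Ds → d ≡ j ⊎ d ≡ k)
        third j k [] = inj₂ λ ()
        third j k (d ∷ Ds) with d ≟ j | d ≟ k | third j k Ds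
        ... | no d≢j | no d≢k | _ = inj₁ (d , here refl , d≢j , d≢k)
        ... | _ | _ | inj₁ (k′ , k′∈ , ≢s) = inj₁ (k′ , there k′∈ , ≢s)
        ... | yes d≡j | _ | inj₂ only = inj₂ λ { (here refl) → inj₁ d≡j ; (there d∈) → only d∈ }
        ... | no _ | yes d≡k | inj₂ only = inj₂ λ { (here refl) → inj₂ d≡k ; (there d∈) → only d∈ }

        -- A facet that is met at `i` is an eliminant as it stands. Otherwise the facets of `x` and
        -- `y` are met at elements `j` and `k` of `D`, and the cases are: one common facet, `D`
        -- within `j` and `k`, or a third element in `D`.
        step-eliminate : Eliminant x A i D
        step-eliminate = found (among⁻ X.Sa) (among⁻ Y.Sa)
          where
          S = among (i ∷ D)
          module X = FacetMeeting (meet-facet x-tope S (∈-full , i∉A) (among⁺ (here refl)))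
          module Y = FacetMeeting (meet-facet y-tope S (∈-full , i∉A) (among⁺ (here refl)))
          found : X.a ∈ₗ (i ∷ D) → Y.a ∈ₗ (i ∷ D) → Eliminant x A i D
          found (here a≡i) _ = record
            { z = X.y
            ; tope = subst (λ G → T X.y G fullSet) (trans (⋖-⊔ X.A⋖G X.a∈G) (cong (A ⊔_) a≡i)) X.T-y
            ; off = D∉I ; agree = λ d∈ → X.agree (among⁺ (there d∈)) }
          found _ (here a≡i) = record
            { z = Y.y
            ; tope = subst (λ G → T Y.y G fullSet) (trans (⋖-⊔ Y.A⋖G Y.a∈G) (cong (A ⊔_) a≡i)) Y.T-y
            ; off = D∉I ; agree = λ d∈ → trans (Y.agree (among⁺ (there d∈))) (sym (x≡y d∈)) }
          found (there j∈D) (there k∈D) = facets-in-D (∈⊎∉ Y.a (A ⊔ X.a)) (third X.a Y.a D)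
            where
            X-tope = subst (λ G → T X.y G fullSet) (⋖-⊔ X.A⋖G X.a∈G) X.T-y
            Y-tope = subst (λ G → T Y.y G fullSet) (⋖-⊔ Y.A⋖G Y.a∈G) Y.T-y
            X-i = X.agree (among⁺ (here refl))
            Y-i = Y.agree (among⁺ (here refl))
            X-D : ∀ {d} → d ∈ₗ D → X.y d ≡ x d
            X-D d∈ = X.agree (among⁺ (there d∈))
            Y-D : ∀ {d} → d ∈ₗ D → Y.y d ≡ y d
            Y-D d∈ = Y.agree (among⁺ (there d∈))
            facets-in-D : Y.a ∊ (A ⊔ X.a) ⊎ Y.a ∉ (A ⊔ X.a) →
              (∃ λ k′ → k′ ∈ₗ D × k′ ≢ X.a × k′ ≢ Y.a) ⊎ (∀ {d} → d ∈ₗ D → d ≡ X.a ⊎ d ≡ Y.a) → Eliminant x A i D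
            facets-in-D (inj₁ k∈J) _ = common-facet j∈D X-tope
              (subst (λ G → T Y.y G fullSet) (⋖-unique Y.A⋖G (⊔-⋖ A-flat (D∉A j∈D)) Y.a∈G k∈J) Y.T-y) X-i Y-i X-D Y-D
            facets-in-D (inj₂ k∉J) (inj₂ only) = two-element j∈D k∈D k∉J only
            facets-in-D (inj₂ k∉J) (inj₁ (k′ , k′∈D , k′≢j , k′≢k)) = three-elements k′∈D k′≢j k′≢k j∈D k∈D
              (λ k≡j → clash (subst (_∊ (A ⊔ X.a)) (sym k≡j) ⊔-∈) k∉J) k∉J X-tope Y-tope X-i Y-i X-D Y-D

    opaque
      eliminate : {x y : Signs n} {A : Subset n} {i : Fin n} {D : List (Fin n)} → Separated x y A i D → Eliminant x A i D
      eliminate {A = A} = flat-induction {P} (λ A rec {D = D} → shrink rec (suc (length D)) ≤-refl) A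
        where
        P : Subset n → Set
        P A = {x y : Signs n} {i : Fin n} {D : List (Fin n)} → Separated x y A i D → Eliminant x A i D
        shrink : {A : Subset n} → (∀ G → A ⊑ G → ∃ (G ∖∖ A) → P G) → (m : ℕ) →
          {x y : Signs n} {i : Fin n} {D : List (Fin n)} → length D < m → Separated x y A i D → Eliminant x A i D
        shrink rec (suc m) {D = D} (s≤s D≤m) sep = Elimination.Step.step-eliminate sep
          (λ A⊑G w → rec _ A⊑G w)
          λ {j} j∈D → shrink rec m (<-≤-trans (length-minus j∈D) D≤m) record
            { A-flat = A-flat ; x-tope = x-tope ; y-tope = y-tope ; i∉A = i∉A ; xi≢yi = xi≢yi
            ; D∉A = λ d∈ → D∉A (proj₁ (∈-minus⁻ {D = D} d∈))
            ; x≡y = λ d∈ → x≡y (proj₁ (∈-minus⁻ {D = D} d∈)) }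
          where open Separated sep

-- Lists: parity of counts and enumeration without repetition

-- A path from the loops to the ground set ends with the ground set, whereas a facet lists proper
-- flats only; `dropLast` passes from one to the other. In rank zero the path is empty and so is the
-- facet.
dropLast : {X : Set} → List X → List X
dropLast [] = []
dropLast (_ ∷ []) = []
dropLast (x ∷ y ∷ zs) = x ∷ dropLast (y ∷ zs)

dropLast-∷ʳ : {X : Set} (xs : List X) (y : X) → dropLast (xs ++ [ y ]) ≡ xs
dropLast-∷ʳ [] y = refl
dropLast-∷ʳ (x ∷ []) y = refl
dropLast-∷ʳ (x ∷ x′ ∷ xs) y = cong (x ∷_) (dropLast-∷ʳ (x′ ∷ xs) y)

dropLast-ʳ++ : {X : Set} (pre : List X) {x : X} {xs : List X} →
  dropLast (pre ʳ++ (x ∷ xs)) ≡ pre ʳ++ dropLast (x ∷ xs)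
dropLast-ʳ++ [] = refl
dropLast-ʳ++ (p ∷ pre) = dropLast-ʳ++ pre

∈-dropLast : {X : Set} {x : X} (xs : List X) → x ∈ₗ dropLast xs → x ∈ₗ xs
∈-dropLast (_ ∷ _ ∷ _) (here refl) = here refl
∈-dropLast (_ ∷ y ∷ zs) (there x∈) = there (∈-dropLast (y ∷ zs) x∈)

∈-ʳ++⁺ʳ : {X : Set} (pre : List X) {x : X} {xs : List X} → x ∈ₗ xs → x ∈ₗ (pre ʳ++ xs)
∈-ʳ++⁺ʳ [] x∈ = x∈
∈-ʳ++⁺ʳ (p ∷ pre) x∈ = ∈-ʳ++⁺ʳ pre (there x∈)

∈-ʳ++⁺ˡ : {X : Set} {pre : List X} {x : X} {xs : List X} → x ∈ₗ pre → x ∈ₗ (pre ʳ++ xs)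
∈-ʳ++⁺ˡ {pre = p ∷ pre} (here refl) = ∈-ʳ++⁺ʳ pre (here refl)
∈-ʳ++⁺ˡ (there x∈) = ∈-ʳ++⁺ˡ x∈

∈-ʳ++⁻ : {X : Set} (pre : List X) {x : X} {xs : List X} → x ∈ₗ (pre ʳ++ xs) → x ∈ₗ pre ⊎ x ∈ₗ xs
∈-ʳ++⁻ [] x∈ = inj₂ x∈
∈-ʳ++⁻ (p ∷ pre) x∈ with ∈-ʳ++⁻ pre x∈
... | inj₁ x∈pre = inj₁ (there x∈pre)
... | inj₂ (here refl) = inj₁ (here refl)
... | inj₂ (there x∈xs) = inj₂ x∈xs

removeAt-ʳ++ : {X : Set} (pre : List X) {Z W : List X} →
  Σ (Fin (length Z)) (λ i → W ≡ removeAt Z i) →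
  Σ (Fin (length (pre ʳ++ Z))) (λ i → pre ʳ++ W ≡ removeAt (pre ʳ++ Z) i)
removeAt-ʳ++ [] found = found
removeAt-ʳ++ (p ∷ pre) (i , W≡) = removeAt-ʳ++ pre (suc i , cong (p ∷_) W≡)

module _ {X : Set} (p : X → Bool) {xs : List X} (unique : Unique xs) where

  private
    chosen : List X
    chosen = filter (λ x → p x ≟B true) xs

  even⇒another : length chosen % 2 ≡ 0 → {x : X} → x ∈ₗ xs → p x ≡ true → ∃ λ y → y ≢ x × y ∈ₗ xs × p y ≡ true
  even⇒another even {x} x∈ px = pick chosen even (filter⁺ (λ x → p x ≟B true) unique)
      (∈-filter⁺ (λ x → p x ≟B true) x∈ px) (∈-filter⁻ (λ x → p x ≟B true) {xs = xs})
    where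
    pick : (ys : List X) → length ys % 2 ≡ 0 → Unique ys → x ∈ₗ ys → (∀ {y} → y ∈ₗ ys → y ∈ₗ xs × p y ≡ true) →
      ∃ λ y → y ≢ x × y ∈ₗ xs × p y ≡ true
    pick (y ∷ []) () _ _ _
    pick (y ∷ z ∷ ys) _ ((y≢z ∷ _) ∷ _) (here refl) in-xs = z , (y≢z ∘ sym) , in-xs (there (here refl))
    pick (y ∷ z ∷ ys) _ (y≢ ∷ _) (there x∈) in-xs = y , All.lookup y≢ x∈ , in-xs (here refl)

  -- A chosen element and its partner are the only chosen ones, so the number of chosen elements is
  -- zero or two.
  paired⇒even : ({x : X} → x ∈ₗ xs → p x ≡ true →
      ∃ λ y → y ≢ x × y ∈ₗ xs × p y ≡ true × ({z : X} → z ∈ₗ xs → p z ≡ true → z ≡ x ⊎ z ≡ y)) →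
    length chosen % 2 ≡ 0
  paired⇒even pairing = go chosen (filter⁺ (λ x → p x ≟B true) unique) (∈-filter⁻ (λ x → p x ≟B true) {xs = xs})
      (∈-filter⁺ (λ x → p x ≟B true))
    where
    go : (ys : List X) → Unique ys → (∀ {y} → y ∈ₗ ys → y ∈ₗ xs × p y ≡ true) → (∀ {y} → y ∈ₗ xs → p y ≡ true → y ∈ₗ ys) →
      length ys % 2 ≡ 0
    go [] _ _ _ = refl
    go (x ∷ ys) u in-xs in-ys with in-xs (here refl)
    go (x ∷ ys) u in-xs in-ys | x∈ , px with pairing x∈ px
    go (x ∷ []) u in-xs in-ys | x∈ , px | y , y≢x , y∈ , py , _ with in-ys y∈ py
    ... | here y≡x = ⊥-elim (y≢x y≡x)
    go (x ∷ z ∷ []) u in-xs in-ys | x∈ , px | _ = refl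
    go (x ∷ z ∷ w ∷ ys) ((x≢z ∷ x≢w ∷ _) ∷ (z≢w ∷ _) ∷ _) in-xs in-ys | x∈ , px | y , _ , _ , _ , only
      with only (proj₁ (in-xs (there (here refl)))) (proj₂ (in-xs (there (here refl))))
         | only (proj₁ (in-xs (there (there (here refl))))) (proj₂ (in-xs (there (there (here refl)))))
    ... | inj₁ z≡x | _ = ⊥-elim (x≢z (sym z≡x))
    ... | _ | inj₁ w≡x = ⊥-elim (x≢w (sym w≡x))
    ... | inj₂ z≡y | inj₂ w≡y = ⊥-elim (z≢w (trans z≡y (sym w≡y)))

Unique-concatMap : {X Y : Set} (f : X → List Y) {xs : List X} → Unique xs → (∀ x → Unique (f x)) →
  (∀ {x x′ y} → y ∈ₗ f x → y ∈ₗ f x′ → x ≡ x′) → Unique (concatMap f xs)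
Unique-concatMap f {[]} _ _ _ = []
Unique-concatMap f {x ∷ xs} (x≢ ∷ u) each disjoint = ++⁺ (each x) (Unique-concatMap f u each disjoint) λ (y∈ , y∈′) →
  let x′ , x′∈ , y∈fx′ = find (∈-concatMap⁻ f {xs = xs} y∈′) in All.lookup x≢ x′∈ (disjoint y∈ y∈fx′)

∷-tail : {n : ℕ} {a b : Bool} {A B : Subset n} → a Data.Vec.∷ A ≡ b ∷ B → A ≡ B
∷-tail refl = refl

Unique-allSubsets : (n : ℕ) → Unique (allSubsets n)
Unique-allSubsets zero = [] ∷ []
Unique-allSubsets (suc n) = ++⁺ (map⁺ ∷-tail (Unique-allSubsets n)) (map⁺ ∷-tail (Unique-allSubsets n)) disjoint
  where
  disjoint : {A : Subset (suc n)} → A ∈ₗ L.map (true ∷_) (allSubsets n) × A ∈ₗ L.map (false ∷_) (allSubsets n) → ⊥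
  disjoint (A∈ , A∈′) with ∈-map⁻ (true ∷_) A∈ | ∈-map⁻ (false ∷_) A∈′
  ... | _ , _ , refl | _ , _ , ()

module _ {X : Set} {xs : List X} where

  ∈-allLists : (ys : List X) → (∀ {y} → y ∈ₗ ys → y ∈ₗ xs) → ys ∈ₗ allListsOfLength (length ys) xs
  ∈-allLists [] _ = here refl
  ∈-allLists (y ∷ ys) in-xs = ∈-concatMap⁺ (λ a → L.map (a ∷_) (allListsOfLength (length ys) xs))
    (lose (in-xs (here refl)) (∈-map⁺ (y ∷_) (∈-allLists ys (in-xs ∘ there))))

  allLists-length : (k : ℕ) {ys : List X} → ys ∈ₗ allListsOfLength k xs → length ys ≡ k
  allLists-length zero (here refl) = refl
  allLists-length (suc k) ys∈
    with find (∈-concatMap⁻ (λ a → L.map (a ∷_) (allListsOfLength k xs)) {xs = xs} ys∈)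
  ... | a , _ , ys∈a with ∈-map⁻ (a ∷_) ys∈a
  ...   | zs , zs∈ , refl = cong suc (allLists-length k zs∈)

  Unique-allLists : Unique xs → (k : ℕ) → Unique (allListsOfLength k xs)
  Unique-allLists _ zero = [] ∷ []
  Unique-allLists u (suc k) = Unique-concatMap (λ a → L.map (a ∷_) (allListsOfLength k xs)) u
      (λ a → map⁺ (λ { refl → refl }) (Unique-allLists u k)) same-head
    where
    same-head : ∀ {a a′ ys} → ys ∈ₗ L.map (a ∷_) (allListsOfLength k xs) → ys ∈ₗ L.map (a′ ∷_) (allListsOfLength k xs) → a ≡ a′
    same-head {a} {a′} ys∈ ys∈′ with ∈-map⁻ (a ∷_) ys∈ | ∈-map⁻ (a′ ∷_) ys∈′
    ... | _ , _ , refl | _ , _ , refl = refl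

module _ {n : ℕ} where

  ⊊ᵇ⇒ : (A B : Subset n) → (A ⊊ᵇ B) ≡ true → A ⊑ B × ∃ (B ∖∖ A)
  ⊊ᵇ⇒ A B A⊊B with B ⊑? A
  ... | inj₂ w = ⊆ᵇ⇒⊑ A B (∧-conicalˡ _ _ A⊊B) , w
  ... | inj₁ B⊑A = true≢false (∧-conicalʳ (A ⊆ᵇ B) _ A⊊B) (cong not (⊑⇒⊆ᵇ B A B⊑A))

  ⇒⊊ᵇ : {A B : Subset n} → A ⊑ B → ∃ (B ∖∖ A) → (A ⊊ᵇ B) ≡ true
  ⇒⊊ᵇ {A} {B} A⊑B (e , e∈B , e∉A) = ∧-true (⊑⇒⊆ᵇ A B A⊑B) not-sub
    where
    not-sub : not (B ⊆ᵇ A) ≡ true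
    not-sub with true⊎false (B ⊆ᵇ A)
    ... | inj₁ B⊆A = clash (at (⊆ᵇ⇒⊑ B A B⊆A) e∈B) e∉A
    ... | inj₂ B⊈A = not-false B⊈A

  =ᵇ⇒≡ : (A B : Subset n) → (A =ᵇ B) ≡ true → A ≡ B
  =ᵇ⇒≡ A B same = ⊑-antisym (⊆ᵇ⇒⊑ A B (∧-conicalˡ _ _ same)) (⊆ᵇ⇒⊑ B A (∧-conicalʳ (A ⊆ᵇ B) _ same))

  =ᵇ-refl : (A : Subset n) → (A =ᵇ A) ≡ true
  =ᵇ-refl A = ∧-true (⊑⇒⊆ᵇ A A ⊑-refl) (⊑⇒⊆ᵇ A A ⊑-refl)

  any=⇒∈ : {A : Subset n} {Cs : List (Subset n)} → any (A =ᵇ_) Cs ≡ true → A ∈ₗ Cs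
  any=⇒∈ {A} {Cs} some with any⇒∃ (A =ᵇ_) {Cs} some
  ... | B , B∈ , same rewrite =ᵇ⇒≡ A B same = B∈

  ∈⇒any= : {A : Subset n} {Cs : List (Subset n)} → A ∈ₗ Cs → any (A =ᵇ_) Cs ≡ true
  ∈⇒any= {A} {Cs} A∈ = ∃⇒any (A =ᵇ_) {Cs} A∈ (=ᵇ-refl A)

coSize≤ : {n : ℕ} (A : Subset n) → coSize A ≤ n
coSize≤ [] = z≤n
coSize≤ (true ∷ A) = m≤n⇒m≤1+n (coSize≤ A)
coSize≤ (false ∷ A) = s≤s (coSize≤ A)

-- Facets as saturated chains, ridges as chains with a gap

module Facets {n : ℕ} (M : Matroid n) where
  open Flats M

  private
    ∅ᶠ E : Subset n
    ∅ᶠ = loops M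
    E = fullSet

  Between : Subset n → Subset n → Subset n → Set
  Between A B F = IsFlat M F × (A ⊑ F × ∃ (F ∖∖ A)) × (F ⊑ B × ∃ (B ∖∖ F))

  properFlat⇒ : {F : Subset n} → properFlatᵇ M F ≡ true → Between ∅ᶠ E F
  properFlat⇒ {F} proper = ∧-conicalˡ _ _ proper ,
    ⊊ᵇ⇒ ∅ᶠ F (∧-conicalˡ _ _ (∧-conicalʳ (isFlat M F) _ proper)) ,
    ⊊ᵇ⇒ F E (∧-conicalʳ (∅ᶠ ⊊ᵇ F) _ (∧-conicalʳ (isFlat M F) _ proper))

  ⇒properFlat : {F : Subset n} → Between ∅ᶠ E F → properFlatᵇ M F ≡ true
  ⇒properFlat (F-flat , (L⊑F , w) , (F⊑E , w′)) = ∧-true F-flat (∧-true (⇒⊊ᵇ L⊑F w) (⇒⊊ᵇ F⊑E w′))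

  comparable⇒ : {F G : Subset n} → comparableᵇ M F G ≡ true → F ⊑ G ⊎ G ⊑ F
  comparable⇒ {F} {G} c with true⊎false (F ⊆ᵇ G)
  ... | inj₁ F⊆G = inj₁ (⊆ᵇ⇒⊑ F G F⊆G)
  ... | inj₂ F⊈G rewrite F⊈G = inj₂ (⊆ᵇ⇒⊑ G F c)

  ⇒comparable : {F G : Subset n} → F ⊑ G ⊎ G ⊑ F → comparableᵇ M F G ≡ true
  ⇒comparable {F} {G} (inj₁ F⊑G) rewrite ⊑⇒⊆ᵇ F G F⊑G = refl
  ⇒comparable {F} {G} (inj₂ G⊑F) rewrite ⊑⇒⊆ᵇ G F G⊑F = ∨-zeroʳ _

  Increasing : Subset n → List (Subset n) → Set
  Increasing A [] = ⊤
  Increasing A (F ∷ C) = A ⊑ F × ∃ (F ∖∖ A) × Increasing F C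

  increasing-⊑ : {A F : Subset n} (C : List (Subset n)) → Increasing A C → F ∈ₗ C → A ⊑ F
  increasing-⊑ (F ∷ C) (A⊑F , _) (here refl) = A⊑F
  increasing-⊑ (G ∷ C) (A⊑G , _ , inc) (there F∈) = ⊑-trans A⊑G (increasing-⊑ C inc F∈)

  Maximal : Subset n → Subset n → List (Subset n) → Set
  Maximal A B C = ∀ {G} → Between A B G → (∀ {F} → F ∈ₗ C → G ⊑ F ⊎ F ⊑ G) → G ∈ₗ C

  -- For `e` in the next flat, the cover `A ⊔ e` lies below everything that remains in the chain.
  -- Maximality puts it into the chain, where it can only be the next flat.
  maximal⇒path : {A : Subset n} (C : List (Subset n)) → IsFlat M A → ∃ (E ∖∖ A) → Increasing A C →
    (∀ {F} → F ∈ₗ C → IsFlat M F × ∃ (E ∖∖ F)) → Maximal A E C → Path A (C ++ [ E ]) E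
  maximal⇒path {A} [] A-flat (e , _ , e∉A) _ _ maximal with E ⊑? (A ⊔ e)
  ... | inj₁ E⊑G = subst (A ⋖_) (⊑-antisym ⊑-full E⊑G) (⊔-⋖ A-flat e∉A) ∷ []
  ... | inj₂ w with maximal (⊔-flat , (⊔-⊒ , e , ⊔-∈ , e∉A) , (⊑-full , w)) (λ ())
  ...   | ()
  maximal⇒path {A} (F ∷ C) A-flat w (A⊑F , (e , e∈F , e∉A) , inc) flats maximal =
    subst (A ⋖_) G≡F (⊔-⋖ A-flat e∉A) ∷ maximal⇒path C F-flat F-proper inc (flats ∘ there) maximal′
    where
    F-flat = proj₁ (flats (here refl))
    F-proper = proj₂ (flats (here refl))
    G⊑F : (A ⊔ e) ⊑ F
    G⊑F = ⊔-min F-flat A⊑F e∈F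
    comparable : ∀ {F′} → F′ ∈ₗ (F ∷ C) → (A ⊔ e) ⊑ F′ ⊎ F′ ⊑ (A ⊔ e)
    comparable (here refl) = inj₁ G⊑F
    comparable (there F′∈) = inj₁ (⊑-trans G⊑F (increasing-⊑ C inc F′∈))
    G≡F : A ⊔ e ≡ F
    G≡F with maximal (⊔-flat , (⊔-⊒ , e , ⊔-∈ , e∉A) ,
                     (⊑-full , proj₁ F-proper , ∈-full , ∉-⊑ G⊑F (proj₂ (proj₂ F-proper)))) comparable
    ... | here G≡F = G≡F
    ... | there G∈C = ⊑-antisym G⊑F (increasing-⊑ C inc G∈C)
    maximal′ : Maximal F E C
    maximal′ {G} (G-flat , (F⊑G , g , g∈G , g∉F) , proper) comp
      with maximal (G-flat , (⊑-trans A⊑F F⊑G , g , g∈G , ∉-⊑ A⊑F g∉F) , proper)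
             (λ { (here refl) → inj₂ F⊑G ; (there F′∈) → comp F′∈ })
    ... | here refl = clash g∈G g∉F
    ... | there G∈C = G∈C

  facet⇒path : {C : List (Subset n)} → IsFacet M C → ∃ λ Gs → Path ∅ᶠ Gs E × C ≡ dropLast Gs
  facet⇒path {C} facet = cases (E ⊑? ∅ᶠ)
    where
    chain : isChainᵇ M C ≡ true
    chain = ∧-conicalˡ _ _ facet
    proper : {F : Subset n} → F ∈ₗ C → Between ∅ᶠ E F
    proper {F} F∈ = properFlat⇒ (all⇒∀ (properFlatᵇ M) {C} (∧-conicalˡ _ _ chain) F∈)
    maximal : Maximal ∅ᶠ E C
    maximal {G} between comp with true⊎false (any (G =ᵇ_) C)
    ... | inj₁ G∈ = any=⇒∈ G∈
    ... | inj₂ G∉ = true≢false (all⇒∀ (λ G → not (properFlatᵇ M G ∧ all (comparableᵇ M G) C) ∨ any (G =ᵇ_) C) {allSubsets n}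
        (∧-conicalʳ (isChainᵇ M C) _ facet) (∈-allSubsets G))
        (cong₂ _∨_ (cong not (∧-true (⇒properFlat between) (∀⇒all (comparableᵇ M G) {C} (⇒comparable ∘ comp)))) G∉)
    increasing : (D : List (Subset n)) → increasingᵇ M D ≡ true → {A : Subset n} →
      (∀ {F} {D′ : List (Subset n)} → D ≡ F ∷ D′ → A ⊑ F × ∃ (F ∖∖ A)) → Increasing A D
    increasing [] _ _ = tt
    increasing (F ∷ []) _ first = proj₁ (first refl) , proj₂ (first refl) , tt
    increasing (F ∷ G ∷ D) inc first = proj₁ (first refl) , proj₂ (first refl) ,
      increasing (G ∷ D) (∧-conicalʳ (F ⊊ᵇ G) _ inc) (λ { refl → ⊊ᵇ⇒ F G (∧-conicalˡ _ _ inc) })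
    cases : E ⊑ ∅ᶠ ⊎ ∃ (E ∖∖ ∅ᶠ) → ∃ λ Gs → Path ∅ᶠ Gs E × C ≡ dropLast Gs
    cases (inj₂ w) = C ++ [ E ] ,
      maximal⇒path C loops-flat w
        (increasing C (∧-conicalʳ (all (properFlatᵇ M) C) _ chain) (λ { refl → proj₁ (proj₂ (proper (here refl))) }))
        (λ F∈ → proj₁ (proper F∈) , proj₂ (proj₂ (proj₂ (proper F∈)))) maximal ,
      sym (dropLast-∷ʳ C E)
    cases (inj₁ E⊑L) = [] , subst (Path ∅ᶠ []) (⊑-antisym ⊑-full E⊑L) [] , empty C proper
      where
      empty : (D : List (Subset n)) → (∀ {F} → F ∈ₗ D → Between ∅ᶠ E F) → D ≡ []
      empty [] _ = refl
      empty (F ∷ D) prop with prop (here refl)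
      ... | _ , (_ , e , e∈F , e∉L) , _ = clash (at E⊑L ∈-full) e∉L

  path-between : {A B F : Subset n} {Gs : List (Subset n)} → Path A Gs B → F ∈ₗ dropLast Gs → Between A B F
  path-between (A⋖G ∷ G⋖H ∷ p) (here refl) with ⋖-witness G⋖H
  ... | e , e∈H , e∉G = ⋖-flat A⋖G , (⋖-⊑ A⋖G , ⋖-witness A⋖G) , (Path-⊑ (G⋖H ∷ p) , e , at (Path-⊑ p) e∈H , e∉G)
  path-between (A⋖G ∷ G⋖H ∷ p) (there F∈) with path-between (G⋖H ∷ p) F∈
  ... | F-flat , (G⊑F , e , e∈F , e∉G) , F⊏B = F-flat , (⊑-trans (⋖-⊑ A⋖G) G⊑F , e , e∈F , ∉-⊑ (⋖-⊑ A⋖G) e∉G) , F⊏B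

  maximal-∷ : {A F B : Subset n} {C : List (Subset n)} → A ⋖ F → Maximal F B C → Maximal A B (F ∷ C)
  maximal-∷ {F = F} A⋖F maximal {G} (G-flat , (A⊑G , e , e∈) , G⊏B) comp with comp (here refl)
  ... | inj₁ G⊑F = here (⋖-between A⋖F G-flat A⊑G G⊑F e∈)
  ... | inj₂ F⊑G with G ⊑? F
  ...   | inj₁ G⊑F = here (⊑-antisym G⊑F F⊑G)
  ...   | inj₂ w = there (maximal (G-flat , (F⊑G , w) , G⊏B) (comp ∘ there))

  path-maximal : {A B : Subset n} {Gs : List (Subset n)} → Path A Gs B → Maximal A B (dropLast Gs)
  path-maximal [] (_ , (_ , e , e∈G , e∉A) , (G⊑A , _)) _ = clash (at G⊑A e∈G) e∉A
  path-maximal (A⋖B ∷ []) (G-flat , (A⊑G , e , e∈) , (G⊑B , g , g∈B , g∉G)) _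
    rewrite ⋖-between A⋖B G-flat A⊑G G⊑B e∈ = clash g∈B g∉G
  path-maximal (A⋖F ∷ F⋖H ∷ p) = maximal-∷ A⋖F (path-maximal (F⋖H ∷ p))

  path⇒facet : {Gs : List (Subset n)} → Path ∅ᶠ Gs E → IsFacet M (dropLast Gs)
  path⇒facet {Gs} p = ∧-true (∧-true proper (increasing p)) (∀⇒all _ {allSubsets n} λ {G} _ → maximal G)
    where
    C = dropLast Gs
    proper : all (properFlatᵇ M) C ≡ true
    proper = ∀⇒all (properFlatᵇ M) {C} (⇒properFlat ∘ path-between p)
    increasing : {A B : Subset n} {Gs : List (Subset n)} → Path A Gs B → increasingᵇ M (dropLast Gs) ≡ true
    increasing [] = refl
    increasing (_ ∷ []) = refl
    increasing (_ ∷ _ ∷ []) = refl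
    increasing (_ ∷ F⋖G ∷ G⋖H ∷ p) = ∧-true (⇒⊊ᵇ (⋖-⊑ F⋖G) (⋖-witness F⋖G)) (increasing (F⋖G ∷ G⋖H ∷ p))
    maximal : ∀ G → not (properFlatᵇ M G ∧ all (comparableᵇ M G) C) ∨ any (G =ᵇ_) C ≡ true
    maximal G with true⊎false (properFlatᵇ M G ∧ all (comparableᵇ M G) C)
    ... | inj₂ ¬both rewrite ¬both = refl
    ... | inj₁ both rewrite ∈⇒any= {A = G} {C} (path-maximal p (properFlat⇒ (∧-conicalˡ _ _ both))
            (λ F∈ → comparable⇒ (all⇒∀ (comparableᵇ M G) {C} (∧-conicalʳ (properFlatᵇ M G) _ both) F∈))) = ∨-zeroʳ _

  -- `facets` searches lists of at most `n` flats; since every step of a path gains an element, this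
  -- search misses no facet.
  path-length : {A B : Subset n} {Gs : List (Subset n)} → Path A Gs B → length (dropLast Gs) ≤ coSize A
  path-length [] = z≤n
  path-length (_ ∷ []) = z≤n
  path-length {A} (A⋖G ∷ G⋖H ∷ p) = ≤-trans (s≤s (path-length (G⋖H ∷ p))) (coSize-strict _ _ (⋖-⊑ A⋖G) (⋖-witness A⋖G))

  ∈-facets : {C : List (Subset n)} → IsFacet M C → C ∈ₗ facets M
  ∈-facets {C} facet with facet⇒path {C} facet
  ... | Gs , p , refl = ∈-filter⁺ (λ C → isMaxChainᵇ M C ≟B true)
      (∈-concatMap⁺ (λ k → allListsOfLength k (allSubsets n))
        (lose (∈-upTo⁺ (s≤s (≤-trans (path-length p) (coSize≤ ∅ᶠ)))) (∈-allLists C (λ _ → ∈-allSubsets _)))) facet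

  facets-IsFacet : {C : List (Subset n)} → C ∈ₗ facets M → IsFacet M C
  facets-IsFacet C∈ = proj₂ (∈-filter⁻ (λ C → isMaxChainᵇ M C ≟B true)
    {xs = concatMap (λ k → allListsOfLength k (allSubsets n)) (upTo (suc n))} C∈)

  Unique-facets : Unique (facets M)
  Unique-facets = filter⁺ (λ C → isMaxChainᵇ M C ≟B true)
    (Unique-concatMap (λ k → allListsOfLength k (allSubsets n)) (upTo⁺ (suc n)) (Unique-allLists (Unique-allSubsets n))
      λ {k} {k′} C∈ C∈′ → trans (sym (allLists-length k C∈)) (allLists-length k′ C∈′))

  -- The chain below A is listed from the top, so that pre ʳ++ Gs is the whole chain.
  data Descent : List (Subset n) → Subset n → Set where
    [] : Descent [] ∅ᶠ
    _∷_ : {pre : List (Subset n)} {A G : Subset n} → A ⋖ G → Descent pre A → Descent (G ∷ pre) G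

  ascend : {pre Gs : List (Subset n)} {A B : Subset n} → Descent pre A → Path A Gs B → Path ∅ᶠ (pre ʳ++ Gs) B
  ascend [] p = p
  ascend (F⋖A ∷ d) p = ascend d (F⋖A ∷ p)

  descent-⊑ : {pre : List (Subset n)} {A F : Subset n} → Descent pre A → F ∈ₗ pre → F ⊑ A
  descent-⊑ (_ ∷ d) (here refl) = ⊑-refl
  descent-⊑ (F⋖A ∷ d) (there F∈) = ⊑-trans (descent-⊑ d F∈) (⋖-⊑ F⋖A)

  -- A ridge together with one facet through it, `G` being the flat left out. `A` may be the set of
  -- loops, and `H` may be the ground set; in the latter case `dropLast` removes `H` from the ridge.
  record Gap : Set where
    field
      {pre post} : List (Subset n)
      {A G H} : Subset n
      below : Descent pre A
      A⋖G : A ⋖ G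
      G⋖H : G ⋖ H
      above : Path H post E

    ridge : List (Subset n)
    ridge = dropLast (pre ʳ++ (H ∷ post))

    filled : Subset n → List (Subset n)
    filled G = pre ʳ++ (G ∷ H ∷ post)

    filled-path : {G′ : Subset n} → A ⋖ G′ → G′ ⋖ H → Path ∅ᶠ (filled G′) E
    filled-path A⋖G′ G′⋖H = ascend below (A⋖G′ ∷ G′⋖H ∷ above)

    ridge-codim : IsCodimOne M ridge
    ridge-codim = dropLast (filled G) , path⇒facet (filled-path A⋖G G⋖H) , removed
      where
      removed : Σ (Fin (length (dropLast (filled G)))) (λ i → ridge ≡ removeAt (dropLast (filled G)) i)
      removed rewrite dropLast-ʳ++ pre {G} {H ∷ post} | dropLast-ʳ++ pre {H} {post} = removeAt-ʳ++ pre (zero , refl)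

  codim⇒gap : {Γ : List (Subset n)} → IsCodimOne M Γ → Σ Gap (λ gap → Γ ≡ Gap.ridge gap)
  codim⇒gap {Γ} (C , facet , i , Γ≡) with facet⇒path {C} facet
  ... | Gs , p , refl with split [] p i
    where
    split : {pre Gs : List (Subset n)} {A : Subset n} → Descent pre A → Path A Gs E → (i : Fin (length (dropLast Gs))) →
      Σ Gap (λ gap → pre ʳ++ removeAt (dropLast Gs) i ≡ Gap.ridge gap)
    split {pre} d (_∷_ {G} A⋖G (_∷_ {H} {Gs = post} G⋖H q)) zero = record { below = d ; A⋖G = A⋖G ; G⋖H = G⋖H ; above = q } , sym (dropLast-ʳ++ pre)
    split d (A⋖G ∷ G⋖H ∷ q) (suc i) = split (A⋖G ∷ d) (G⋖H ∷ q) i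
  ...   | gap , same = gap , trans Γ≡ same

  path-last : {A B F : Subset n} {t : List (Subset n)} → Path A t B → F ∈ₗ t → F ∈ₗ dropLast t ⊎ F ≡ B
  path-last (_ ∷ []) (here refl) = inj₂ refl
  path-last (_ ∷ _ ∷ _) (here refl) = inj₁ (here refl)
  path-last (_ ∷ c ∷ q) (there F∈) with path-last (c ∷ q) F∈
  ... | inj₁ F∈′ = inj₁ (there F∈′)
  ... | inj₂ F≡B = inj₂ F≡B

  path-first : {A B H F : Subset n} {t : List (Subset n)} → Path A (F ∷ t) B → H ∈ₗ (F ∷ t) → A ⋖ H → F ≡ H
  path-first p (here refl) _ = refl
  path-first (A⋖F ∷ p) (there H∈) A⋖H =
    ⋖-between A⋖H (⋖-flat A⋖F) (⋖-⊑ A⋖F) (proj₁ (proj₂ (Path-∈ p H∈))) (proj₂ (⋖-witness A⋖F))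

  no-loop : {A F : Subset n} {Gs : List (Subset n)} → A ⋖ F → Path F Gs A → ⊥
  no-loop A⋖F p with ⋖-witness A⋖F
  ... | e , e∈F , e∉A = clash (at (Path-⊑ p) e∈F) e∉A

  path-unique : {A B : Subset n} {Gs Hs : List (Subset n)} → Path A Gs B → Path A Hs B → (∀ {F} → F ∈ₗ Gs → F ∈ₗ Hs) → Gs ≡ Hs
  path-unique [] [] _ = refl
  path-unique [] (A⋖F ∷ q) _ = ⊥-elim (no-loop A⋖F q)
  path-unique (A⋖F ∷ p) [] _ = ⊥-elim (no-loop A⋖F p)
  path-unique {Gs = F ∷ Gs} {H ∷ Hs} (A⋖F ∷ p) (A⋖H ∷ q) sub with path-first (A⋖H ∷ q) (sub (here refl)) A⋖F
  ... | refl = cong (H ∷_) (path-unique p q sub′)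
    where
    sub′ : {F : Subset n} → F ∈ₗ Gs → F ∈ₗ Hs
    sub′ F∈ with sub (there F∈) | Path-∈ p F∈
    ... | there F∈Hs | _ = F∈Hs
    ... | here refl | _ , _ , e , e∈F , e∉F = clash e∈F e∉F

  path-split : {pre Gs : List (Subset n)} {A B : Subset n} → Descent pre A → Path ∅ᶠ Gs B → (∀ {F} → F ∈ₗ pre → F ∈ₗ Gs) →
    ∃ λ t → Gs ≡ pre ʳ++ t × Path A t B
  path-split [] p _ = _ , refl , p
  path-split {G ∷ pre} {B = B} (A⋖G ∷ d) p sub with path-split d p (sub ∘ there)
  ... | t , refl , q with ∈-ʳ++⁻ pre (sub (here refl))
  ...   | inj₁ G∈pre = ⊥-elim (no-loop A⋖G (subst (Path G []) (⊑-antisym (descent-⊑ d G∈pre) (⋖-⊑ A⋖G)) []))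
  ...   | inj₂ G∈t = first q G∈t
    where
    first : {t : List (Subset n)} → Path _ t B → G ∈ₗ t → ∃ λ t′ → pre ʳ++ t ≡ (G ∷ pre) ʳ++ t′ × Path G t′ B
    first (A⋖F ∷ q) G∈ with path-first (A⋖F ∷ q) G∈ A⋖G
    ... | refl = _ , refl , q

  module _ (gap : Gap) where
    open Gap gap

    ridge-⊆ : {G′ : Subset n} {F : Subset n} → F ∈ₗ ridge → F ∈ₗ dropLast (filled G′)
    ridge-⊆ {G′} {F} F∈ = subst (F ∈ₗ_) (sym (dropLast-ʳ++ pre))
      (skip (∈-ʳ++⁻ pre (subst (F ∈ₗ_) (dropLast-ʳ++ pre) F∈)))
      where
      skip : F ∈ₗ pre ⊎ F ∈ₗ dropLast (H ∷ post) → F ∈ₗ (pre ʳ++ (G′ ∷ dropLast (H ∷ post)))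
      skip (inj₁ F∈) = ∈-ʳ++⁺ˡ F∈
      skip (inj₂ F∈) = ∈-ʳ++⁺ʳ pre (there F∈)

    filled-contains : {G′ : Subset n} → containsᵇ M ridge (dropLast (filled G′)) ≡ true
    filled-contains {G′} = ∀⇒all _ {ridge} (∈⇒any= ∘ ridge-⊆ {G′})

    -- A saturated chain that contains `pre` has to begin with it. From `A` it cannot step to `H`
    -- directly, as `G` lies strictly between, and by `⋖-diamond` its first step is already covered
    -- by `H`; from `H` on it must coincide with `post`.
    contains⇒filled : {C : List (Subset n)} → IsFacet M C → containsᵇ M ridge C ≡ true →
      ∃ λ G′ → A ⋖ G′ × G′ ⋖ H × C ≡ dropLast (filled G′)
    contains⇒filled {C} facet contains with facet⇒path {C} facet
    ... | Gs , p , refl = resume (path-split below p (λ F∈ → in-Gs (∈-ʳ++⁺ˡ F∈)))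
      where
      E∈ : {A : Subset n} {t : List (Subset n)} → ∃ (E ∖∖ A) → Path A t E → E ∈ₗ t
      E∈ (e , e∈E , e∉E) [] = clash e∈E e∉E
      E∈ _ (_ ∷ []) = here refl
      E∈ _ (_ ∷ G⋖F ∷ q) = there (E∈ (proj₁ (⋖-witness G⋖F) , ∈-full , proj₂ (proj₂ (⋖-witness G⋖F))) (G⋖F ∷ q))
      ridge∋ : {F : Subset n} → F ∈ₗ (pre ʳ++ dropLast (H ∷ post)) → F ∈ₗ Gs
      ridge∋ {F} F∈ = ∈-dropLast Gs (any=⇒∈ (all⇒∀ (λ F → any (F =ᵇ_) (dropLast Gs)) {ridge} contains
        (subst (F ∈ₗ_) (sym (dropLast-ʳ++ pre)) F∈)))
      in-Gs : {F : Subset n} → F ∈ₗ (pre ʳ++ (H ∷ post)) → F ∈ₗ Gs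
      in-Gs F∈ with ∈-ʳ++⁻ pre F∈
      ... | inj₁ F∈pre = ridge∋ (∈-ʳ++⁺ˡ F∈pre)
      ... | inj₂ F∈post with path-last (G⋖H ∷ above) F∈post
      ...   | inj₁ F∈′ = ridge∋ (∈-ʳ++⁺ʳ pre F∈′)
      -- The ground set is not recorded in the ridge, but it is the last flat of every nonempty path
      -- to it.
      ...   | inj₂ refl = E∈ (proj₁ a , ∈-full , ∉-⊑ (loops-min (⋖-flatˡ A⋖G)) (proj₂ (proj₂ a))) p
        where a = ⋖-witness A⋖G
      beyond : {B F : Subset n} {t : List (Subset n)} → Gs ≡ pre ʳ++ t → A ⊑ F → ∃ (F ∖∖ A) → F ∈ₗ Gs → F ∈ₗ t
      beyond refl A⊑F (e , e∈F , e∉A) F∈ with ∈-ʳ++⁻ pre F∈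
      ... | inj₁ F∈pre = clash (at (descent-⊑ below F∈pre) e∈F) e∉A
      ... | inj₂ F∈t = F∈t
      in-tail : {F : Subset n} {t : List (Subset n)} → Gs ≡ pre ʳ++ t → F ∈ₗ (H ∷ post) → F ∈ₗ t
      in-tail Gs≡ F∈ with Path-∈ (A⋖G ∷ G⋖H ∷ above) (there F∈)
      ... | _ , A⊑F , w = beyond {A} Gs≡ A⊑F w (in-Gs (∈-ʳ++⁺ʳ pre F∈))
      resume : (∃ λ t → Gs ≡ pre ʳ++ t × Path A t E) → ∃ λ G′ → A ⋖ G′ × G′ ⋖ H × dropLast Gs ≡ dropLast (filled G′)
      resume (t , Gs≡ , q) = through q (in-tail Gs≡ (here refl)) (λ F∈ → in-tail Gs≡ (there F∈)) Gs≡
        where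
        through : {t : List (Subset n)} → Path A t E → H ∈ₗ t → (∀ {F} → F ∈ₗ post → F ∈ₗ t) → Gs ≡ pre ʳ++ t →
          ∃ λ G′ → A ⋖ G′ × G′ ⋖ H × dropLast Gs ≡ dropLast (filled G′)
        through (A⋖H ∷ q) (here refl) _ _ = ⊥-elim (no-loop G⋖H
          (subst (Path H []) (sym (⋖-between A⋖H (⋖-flat A⋖G) (⋖-⊑ A⋖G) (⋖-⊑ G⋖H) (proj₂ (⋖-witness A⋖G)))) []))
        through (_∷_ {F} A⋖F q) (there H∈) post∈ Gs≡ = F , A⋖F , F⋖H , cong dropLast (trans Gs≡ (cong (λ t → pre ʳ++ (F ∷ t)) (tail q H∈ post∈)))
          where
          F⋖H : F ⋖ H
          F⋖H with ≡⊎≢ F G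
          ... | inj₁ refl = G⋖H
          ... | inj₂ F≢G = ⋖-diamond A⋖G G⋖H A⋖F (proj₁ (proj₂ (Path-∈ q H∈))) F≢G
          tail : {t : List (Subset n)} → Path F t E → H ∈ₗ t → (∀ {K} → K ∈ₗ post → K ∈ₗ (F ∷ t)) → t ≡ H ∷ post
          tail {K ∷ t} (F⋖K ∷ q) H∈ post∈ with path-first (F⋖K ∷ q) H∈ F⋖H
          ... | refl = cong (H ∷_) (sym (path-unique above q after))
            where
            after : {K : Subset n} → K ∈ₗ post → K ∈ₗ t
            after K∈ with post∈ K∈ | Path-∈ above K∈
            ... | there (there K∈t) | _ = K∈t
            ... | there (here refl) | _ , _ , e , e∈K , e∉K = clash e∈K e∉K
            ... | here refl | _ , _ , e , e∈F , e∉H = clash (at (⋖-⊑ F⋖H) e∈F) e∉H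

-- Tangent spaces modulo two: vectors constant on the blocks of a chain

Along : {n : ℕ} → (Subset n → Subset n → Set) → Subset n → List (Subset n) → Set
Along Q A [] = ⊤
Along Q A (G ∷ Gs) = Q A G × Along Q G Gs

Along-map : {n : ℕ} {Q Q′ : Subset n → Subset n → Set} → (∀ {F G} → Q F G → Q′ F G) →
  {A : Subset n} (Gs : List (Subset n)) → Along Q A Gs → Along Q′ A Gs
Along-map f [] _ = tt
Along-map f (G ∷ Gs) (q , qs) = f q , Along-map f Gs qs

record Constant {n : ℕ} (v : Fin n → Bool) (F G : Subset n) : Set where
  constructor constant
  field level : {a b : Fin n} → (G ∖∖ F) a → (G ∖∖ F) b → v a ≡ v b
open Constant public

module Directions {n : ℕ} (M : Matroid n) where
  open Flats M
  open Facets M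

  private
    ∅ᶠ E : Subset n
    ∅ᶠ = loops M
    E = fullSet

  linComb-∷ : (c : ℚ) (cs : List ℚ) (g : Vec ℚ n) (gs : List (Vec ℚ n)) (e : Fin n) →
    lookup (linComb M (c ∷ cs) (g ∷ gs)) e ≡ c * lookup g e + lookup (linComb M cs gs) e
  linComb-∷ c cs g gs e =
    trans (lookup-zipWith _+_ e (map (c *_) g) _) (cong (_+ lookup (linComb M cs gs) e) (lookup-map e (c *_) g))

  linComb-[] : (gs : List (Vec ℚ n)) (e : Fin n) → lookup (linComb M [] gs) e ≡ 0ℚ
  linComb-[] gs e = lookup-replicate e 0ℚ

  linComb-same : (cs : List ℚ) (gs : List (Vec ℚ n)) {a b : Fin n} → (∀ {g} → g ∈ₗ gs → lookup g a ≡ lookup g b) →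
    lookup (linComb M cs gs) a ≡ lookup (linComb M cs gs) b
  linComb-same [] gs {a} {b} _ = trans (linComb-[] gs a) (sym (linComb-[] gs b))
  linComb-same (c ∷ cs) [] {a} {b} _ = trans (lookup-replicate a 0ℚ) (sym (lookup-replicate b 0ℚ))
  linComb-same (c ∷ cs) (g ∷ gs) {a} {b} same = trans (linComb-∷ c cs g gs a)
    (trans (cong₂ (λ p q → c * p + q) (same (here refl)) (linComb-same cs gs (same ∘ there))) (sym (linComb-∷ c cs g gs b)))

  scale-zero : (c : ℚ) {p q r : ℚ} → p ≡ 0ℚ → q ≡ r → c * p + q ≡ r
  scale-zero c {q = q} refl refl = trans (cong (_+ q) (ℚ.*-zeroʳ c)) (ℚ.+-identityˡ q)

  vec-in : {S : Subset n} {e : Fin n} → e ∊ S → lookup (vec M S) e ≡ - 1ℚ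
  vec-in {S} {e} (mem e∈S) = trans (lookup-map e _ S) (cong (λ b → if b then - 1ℚ else 0ℚ) e∈S)

  vec-out : {S : Subset n} {e : Fin n} → e ∉ S → lookup (vec M S) e ≡ 0ℚ
  vec-out {S} {e} (nonmem e∉S) = trans (lookup-map e _ S) (cong (λ b → if b then - 1ℚ else 0ℚ) e∉S)

  on-generators : {P : Vec ℚ n → Set} (C : List (Subset n)) → (∀ {F} → F ∈ₗ C → P (vec M (F ∖ ∅ᶠ))) →
    P (vec M (∁ ∅ᶠ)) → P (map -_ (vec M (∁ ∅ᶠ))) → ∀ {g} → g ∈ₗ generators M C → P g
  on-generators [] _ top -top (here refl) = top
  on-generators [] _ top -top (there (here refl)) = -top
  on-generators (F ∷ C) each _ _ (here refl) = each (here refl)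
  on-generators (F ∷ C) each top -top (there g∈) = on-generators C (each ∘ there) top -top g∈

  toℚ-injective : {y z : ℤ} → toℚ M y ≡ toℚ M z → y ≡ z
  toℚ-injective {y} {z} same with ℚ./-injective-≃ (mkℚᵘ y 0) (mkℚᵘ z 0) same
  ... | *≡* eq = trans (sym (ℤ.*-identityʳ y)) (trans eq (ℤ.*-identityʳ z))

  span-lookup : {C : List (Subset n)} (z : Vec ℤ n) → InSpan M (generators M C) (map (toℚ M) z) →
    ∃ λ cs → ∀ e → toℚ M (lookup z e) ≡ lookup (linComb M cs (generators M C)) e
  span-lookup z (cs , z≡) = cs , λ e → trans (sym (lookup-map e (toℚ M) z)) (cong (λ u → lookup u e) z≡)

  -- Every generator has equal entries at `a` and `b`, hence so does the integer point, and
  -- reduction preserves the equality.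
  TZ2⇒same : {C : List (Subset n)} {v : Vec Bool n} → TZ2 M C v → {a b : Fin n} → a ∉ ∅ᶠ → b ∉ ∅ᶠ →
    (∀ {F} → F ∈ₗ C → lookup F a ≡ lookup F b) → lookup v a ≡ lookup v b
  TZ2⇒same {C} (z , span , refl) {a} {b} a∉L b∉L same with span-lookup {C} z span
  ... | cs , z≡ = trans (lookup-map a (parity M) z) (trans (cong (parity M) za≡zb) (sym (lookup-map b (parity M) z)))
    where
    top : lookup (vec M (∁ ∅ᶠ)) a ≡ lookup (vec M (∁ ∅ᶠ)) b
    top = trans (vec-in (∁-in a∉L)) (sym (vec-in (∁-in b∉L)))
    each : ∀ {F} → F ∈ₗ C → lookup (vec M (F ∖ ∅ᶠ)) a ≡ lookup (vec M (F ∖ ∅ᶠ)) b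
    each {F} F∈ with ∈⊎∉ a F
    ... | inj₁ a∈F = trans (vec-in {F ∖ ∅ᶠ} (∈-∖⁺ (a∈F , a∉L))) (sym (vec-in {F ∖ ∅ᶠ} (∈-∖⁺ (b∈F , b∉L))))
      where b∈F = mem {A = F} (trans (sym (same F∈)) (holds a∈F))
    ... | inj₂ a∉F = trans (vec-out {F ∖ ∅ᶠ} (∉-∖⁺ (inj₁ a∉F))) (sym (vec-out {F ∖ ∅ᶠ} (∉-∖⁺ (inj₁ b∉F))))
      where b∉F = nonmem {A = F} (trans (sym (same F∈)) (fails a∉F))
    za≡zb : lookup z a ≡ lookup z b
    za≡zb = toℚ-injective (trans (z≡ a) (trans (linComb-same cs (generators M C)
      (on-generators {λ g → lookup g a ≡ lookup g b} C each top
        (trans (lookup-map a -_ (vec M (∁ ∅ᶠ))) (trans (cong -_ top) (sym (lookup-map b -_ (vec M (∁ ∅ᶠ)))))))) (sym (z≡ b))))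

  TZ2⇒constant : {Gs : List (Subset n)} {v : Vec Bool n} → Path ∅ᶠ Gs E → TZ2 M (dropLast Gs) v →
    Along (Constant (lookup v)) ∅ᶠ Gs
  TZ2⇒constant {Gs} {v} p tz = along p (TZ2⇒same tz)
    where
    along : {A : Subset n} {Gs : List (Subset n)} → Path A Gs E →
      ({a b : Fin n} → a ∉ A → b ∉ A → (∀ {F} → F ∈ₗ dropLast Gs → lookup F a ≡ lookup F b) → lookup v a ≡ lookup v b) →
      Along (Constant (lookup v)) A Gs
    along [] _ = tt
    along (A⋖G ∷ []) same = constant (λ (_ , a∉A) (_ , b∉A) → same a∉A b∉A λ ()) , tt
    along {A} {G ∷ H ∷ Gs} (A⋖G ∷ q@(G⋖H ∷ _)) same =
      constant (λ (a∈G , a∉A) (b∈G , b∉A) → same a∉A b∉A λ F∈ → trans (holds (at (above F∈) a∈G)) (sym (holds (at (above F∈) b∈G)))) ,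
      along q λ a∉G b∉G same-above → same (∉-⊑ (⋖-⊑ A⋖G) a∉G) (∉-⊑ (⋖-⊑ A⋖G) b∉G)
        λ { (here refl) → trans (fails a∉G) (sym (fails b∉G)) ; (there F∈) → same-above F∈ }
      where
      above : {F : Subset n} → F ∈ₗ (G ∷ dropLast (H ∷ Gs)) → G ⊑ F
      above (here refl) = ⊑-refl
      above (there F∈) = proj₁ (proj₂ (Path-∈ q (∈-dropLast _ F∈)))

  bit : Bool → ℚ
  bit b = if b then 1ℚ else 0ℚ

  -- The generators are negated indicator vectors, so the coefficient `bit τ + - bit t` changes the
  -- value on a flat from `τ` to `t`.
  jump : Bool → Bool → ℚ
  jump τ t = bit τ + - bit t

  jump-in : (τ t : Bool) {p q : ℚ} → p ≡ - 1ℚ → q ≡ bit τ → jump τ t * p + q ≡ bit t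
  jump-in true true refl refl = refl
  jump-in true false refl refl = refl
  jump-in false true refl refl = refl
  jump-in false false refl refl = refl

  record Combination (v : Vec Bool n) (A : Subset n) (C : List (Subset n)) : Set where
    field
      cs : List ℚ
      τ : Bool
      on-loops : {e : Fin n} → e ∊ ∅ᶠ → lookup (linComb M cs (generators M C)) e ≡ 0ℚ
      below : {e : Fin n} → e ∉ ∅ᶠ → e ∊ A → lookup (linComb M cs (generators M C)) e ≡ bit τ
      beyond : {e : Fin n} → e ∉ A → lookup (linComb M cs (generators M C)) e ≡ bit (lookup v e)

  -- A function that is constant on the blocks of a chain is reached by descending along the
  -- chain: the coefficient of G adjusts the value τ on G to the value of v on the block G ∖ A.
  combination : {v : Vec Bool n} {A : Subset n} {Gs : List (Subset n)} → ∅ᶠ ⊑ A → Path A Gs E →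
    Along (Constant (lookup v)) A Gs → Combination v A (dropLast Gs)
  combination {v} _ [] _ = record
    { cs = [] ; τ = false
    ; on-loops = λ {e} _ → linComb-[] (generators M []) e
    ; below = λ {e} _ _ → linComb-[] (generators M []) e
    ; beyond = λ e∉E → clash ∈-full e∉E }
  combination {v} {A} L⊑A (A⋖E ∷ []) (const , _) = record
    { cs = jump false t ∷ [] ; τ = t
    ; on-loops = λ {e} e∈L → trans (linComb-∷ (jump false t) [] (vec M (∁ ∅ᶠ)) -top e) (scale-zero (jump false t) (vec-out (∁-out e∈L)) (linComb-[] -top e))
    ; below = λ e∉L _ → value e∉L
    ; beyond = λ e∉A → trans (value (∉-⊑ L⊑A e∉A)) (cong bit (level const (proj₂ w) (∈-full , e∉A))) }
    where
    w = ⋖-witness A⋖E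
    t = lookup v (proj₁ w)
    -top = map -_ (vec M (∁ ∅ᶠ)) ∷ []
    value : {e : Fin n} → e ∉ ∅ᶠ → lookup (linComb M (jump false t ∷ []) (generators M [])) e ≡ bit t
    value {e} e∉L = trans (linComb-∷ (jump false t) [] (vec M (∁ ∅ᶠ)) -top e) (jump-in false t (vec-in (∁-in e∉L)) (linComb-[] -top e))
  combination {v} {A} {G ∷ H ∷ Gs} L⊑A (A⋖G ∷ q@(_ ∷ _)) (const , along) =
    extend (combination {v} (⊑-trans L⊑A (⋖-⊑ A⋖G)) q along)
    where
    w = ⋖-witness A⋖G
    t = lookup v (proj₁ w)
    extend : Combination v G (dropLast (H ∷ Gs)) → Combination v A (G ∷ dropLast (H ∷ Gs))
    extend record { cs = cs ; τ = τ ; on-loops = on-loops ; below = below ; beyond = beyond } = record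
      { cs = jump τ t ∷ cs ; τ = t
      ; on-loops = λ {e} e∈L → trans (unfold e) (scale-zero (jump τ t) (vec-out {G ∖ ∅ᶠ} (∉-∖⁺ (inj₂ e∈L))) (on-loops e∈L))
      ; below = λ e∉L e∈A → inside e∉L (at (⋖-⊑ A⋖G) e∈A)
      ; beyond = beyond′ }
      where
      unfold : (e : Fin n) → lookup (linComb M (jump τ t ∷ cs) (generators M (G ∷ dropLast (H ∷ Gs)))) e ≡
        jump τ t * lookup (vec M (G ∖ ∅ᶠ)) e + lookup (linComb M cs (generators M (dropLast (H ∷ Gs)))) e
      unfold = linComb-∷ (jump τ t) cs (vec M (G ∖ ∅ᶠ)) (generators M (dropLast (H ∷ Gs)))
      inside : {e : Fin n} → e ∉ ∅ᶠ → e ∊ G → lookup (linComb M (jump τ t ∷ cs) (generators M (G ∷ dropLast (H ∷ Gs)))) e ≡ bit t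
      inside {e} e∉L e∈G = trans (unfold e) (jump-in τ t (vec-in (∈-∖⁺ (e∈G , e∉L))) (below e∉L e∈G))
      beyond′ : {e : Fin n} → e ∉ A → lookup (linComb M (jump τ t ∷ cs) (generators M (G ∷ dropLast (H ∷ Gs)))) e ≡ bit (lookup v e)
      beyond′ {e} e∉A with ∈⊎∉ e G
      ... | inj₁ e∈G = trans (inside (∉-⊑ L⊑A e∉A) e∈G) (cong bit (level const (proj₂ w) (e∈G , e∉A)))
      ... | inj₂ e∉G = trans (unfold e) (scale-zero (jump τ t) (vec-out (∉-∖⁺ (inj₁ e∉G))) (beyond e∉G))

  -- The lift of `v` with integer entries 0 and 1 is constant on the same blocks and therefore lies
  -- in the rational span itself.
  TZ2⇐ : {Gs : List (Subset n)} {v : Vec Bool n} → Path ∅ᶠ Gs E → ZeroOnL M v → Along (Constant (lookup v)) ∅ᶠ Gs →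
    TZ2 M (dropLast Gs) v
  TZ2⇐ {Gs} {v} p zero-on-L along = map lift v , (cs , lookup-ext spans) , lookup-ext reduces
    where
    open Combination (combination {v} ⊑-refl p along)
    lift : Bool → ℤ
    lift b = if b then + 1 else + 0
    lift-bit : (b : Bool) → toℚ M (lift b) ≡ bit b
    lift-bit true = refl
    lift-bit false = refl
    parity-lift : (b : Bool) → parity M (lift b) ≡ b
    parity-lift true = refl
    parity-lift false = refl
    spans : ∀ e → lookup (map (toℚ M) (map lift v)) e ≡ lookup (linComb M cs (generators M (dropLast Gs))) e
    spans e = trans (lookup-map e (toℚ M) (map lift v)) (trans (cong (toℚ M) (lookup-map e lift v))
      (trans (lift-bit (lookup v e)) (sym value)))
      where
      value : lookup (linComb M cs (generators M (dropLast Gs))) e ≡ bit (lookup v e)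
      value with ∈⊎∉ e ∅ᶠ
      ... | inj₁ e∈L = trans (on-loops e∈L) (cong bit (sym (zero-on-L e (holds e∈L))))
      ... | inj₂ e∉L = beyond e∉L
    reduces : ∀ e → lookup v e ≡ lookup (map (parity M) (map lift v)) e
    reduces e = sym (trans (lookup-map e (parity M) (map lift v)) (trans (cong (parity M) (lookup-map e lift v))
      (parity-lift (lookup v e))))

-- From a real phase structure to a sign system

xor-⊕ : (a b : Bool) → (a ∧ not b) ∨ (not a ∧ b) ≡ a xor b
xor-⊕ true true = refl
xor-⊕ true false = refl
xor-⊕ false true = refl
xor-⊕ false false = refl

xor-chain : (a b c : Bool) → (a xor b) xor (b xor c) ≡ a xor c
xor-chain true true true = refl
xor-chain true true false = refl
xor-chain true false true = refl
xor-chain true false false = refl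
xor-chain false true true = refl
xor-chain false true false = refl
xor-chain false false true = refl
xor-chain false false false = refl

xor-not : (a : Bool) → a xor not a ≡ true
xor-not true = refl
xor-not false = refl

xor-≡ : {a b : Bool} → a xor b ≡ false → a ≡ b
xor-≡ {true} {true} _ = refl
xor-≡ {false} {false} _ = refl

≡-xor : {a b : Bool} → a ≡ b → a xor b ≡ false
≡-xor {a} refl = xor-same a

ʳ++-[] : {X : Set} (pre : List X) {t : List X} → (pre ʳ++ []) ++ t ≡ pre ʳ++ t
ʳ++-[] pre = go pre []
  where
  go : {X : Set} (pre s : List X) {t : List X} → (pre ʳ++ s) ++ t ≡ pre ʳ++ (s ++ t)
  go [] s = refl
  go (p ∷ pre) s = go pre (p ∷ s)

module _ {n : ℕ} where

  infixl 6 _⊻_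
  _⊻_ : Signs n → Signs n → Signs n
  (x ⊻ y) e = x e xor y e

  ⊻-agree : {x y : Signs n} {F G : Subset n} → (∀ {e} → (G ∖∖ F) e → x e ≡ y e) → Constant (x ⊻ y) F G
  ⊻-agree same = constant λ a∈ b∈ → trans (≡-xor (same a∈)) (sym (≡-xor (same b∈)))

  ⊻-trans : {x y z : Signs n} {F G : Subset n} → Constant (x ⊻ y) F G → Constant (y ⊻ z) F G → Constant (x ⊻ z) F G
  ⊻-trans {x} {y} {z} p q = constant λ {a} {b} a∈ b∈ →
    trans (sym (xor-chain (x a) (y a) (z a))) (trans (cong₂ _xor_ (level p a∈ b∈) (level q a∈ b∈)) (xor-chain (x b) (y b) (z b)))

  ⊻-sym : {x y : Signs n} {F G : Subset n} → Constant (x ⊻ y) F G → Constant (y ⊻ x) F G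
  ⊻-sym {x} {y} p = constant λ {a} {b} a∈ b∈ → trans (xor-comm (y a) (x a)) (trans (level p a∈ b∈) (xor-comm (x b) (y b)))

  ⊻-spread : {x y : Signs n} {F G : Subset n} {a b : Fin n} → Constant (x ⊻ y) F G → (G ∖∖ F) a → (G ∖∖ F) b → x a ≡ y a → x b ≡ y b
  ⊻-spread p a∈ b∈ same = xor-≡ (trans (sym (level p a∈ b∈)) (≡-xor same))

module Blocks {n : ℕ} (M : Matroid n) where
  open Flats M
  open Facets M

  along-zip : {Q₁ Q₂ Q : Subset n → Subset n → Set} → (∀ {F G} → F ⋖ G → Q₁ F G → Q₂ F G → Q F G) →
    {A B : Subset n} {Gs : List (Subset n)} → Path A Gs B → Along Q₁ A Gs → Along Q₂ A Gs → Along Q A Gs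
  along-zip f [] _ _ = tt
  along-zip f (A⋖G ∷ p) (q , qs) (q′ , qs′) = f A⋖G q q′ , along-zip f p qs qs′

  along-above : {Q : Subset n → Subset n → Set} {A B : Subset n} {Gs : List (Subset n)} → Path A Gs B →
    (∀ {F G} → F ⋖ G → A ⊑ F → Q F G) → Along Q A Gs
  along-above [] _ = tt
  along-above (A⋖G ∷ p) f = f A⋖G ⊑-refl , along-above p λ F⋖K G⊑F → f F⋖K (⊑-trans (⋖-⊑ A⋖G) G⊑F)

  along-ascend : {Q : Subset n → Subset n → Set} {A : Subset n} {pre Gs : List (Subset n)} → Descent pre A →
    (∀ {F G} → F ⋖ G → G ⊑ A → Q F G) → Along Q A Gs → Along Q (loops M) (pre ʳ++ Gs)
  along-ascend [] _ qs = qs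
  along-ascend (F⋖A ∷ d) f qs = along-ascend d (λ F′⋖G G⊑F → f F′⋖G (⊑-trans G⊑F (⋖-⊑ F⋖A))) (f F⋖A ⊑-refl , qs)

  along-project : {Q : Subset n → Subset n → Set} {A : Subset n} {pre Gs : List (Subset n)} → Descent pre A →
    Along Q (loops M) (pre ʳ++ Gs) → Along Q A Gs
  along-project [] qs = qs
  along-project (F⋖A ∷ d) qs = proj₂ (along-project d qs)

  descend : {pre Gs : List (Subset n)} {A B : Subset n} → Descent pre A → Path A Gs B → Descent (Gs ʳ++ pre) B
  descend d [] = d
  descend d (A⋖G ∷ p) = descend (A⋖G ∷ d) p

  descent-exists : {A : Subset n} → IsFlat M A → ∃ λ pre → Descent pre A
  descent-exists A-flat = _ , descend [] (proj₂ (Path-exists loops-flat A-flat (loops-min A-flat)))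

  Path-flat : {A B : Subset n} {Gs : List (Subset n)} → Path A Gs B → IsFlat M A → IsFlat M B
  Path-flat [] A-flat = A-flat
  Path-flat (A⋖G ∷ p) _ = Path-flat p (⋖-flat A⋖G)

  diamond-top : {A B G₁ G₂ : Subset n} {m₁ m₂ : List (Subset n)} → A ⋖ G₁ → A ⋖ G₂ → G₁ ≢ G₂ → Path G₁ m₁ B → Path G₂ m₂ B →
    ∃ λ H → ∃ λ m → G₁ ⋖ H × G₂ ⋖ H × Path H m B
  diamond-top {A} {B} {G₁} {G₂} A⋖G₁ A⋖G₂ G₁≢G₂ p₁ p₂ with ⋖-witness A⋖G₂
  ... | g , g∈ with Path-exists (⊔-flat {G₁} {g}) B-flat (⊔-min B-flat (Path-⊑ p₁) (at (Path-⊑ p₂) (proj₁ g∈)))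
    where B-flat = Path-flat p₁ (⋖-flat A⋖G₁)
  ...   | m , p = G₁ ⊔ g , m , G₁⋖H , ⋖-diamond A⋖G₁ G₁⋖H A⋖G₂ (⋖-min A⋖G₂ g∈ ⊔-flat (⊑-trans (⋖-⊑ A⋖G₁) ⊔-⊒) ⊔-∈) (G₁≢G₂ ∘ sym) , p
    where
    G₁⋖H : G₁ ⋖ G₁ ⊔ g
    G₁⋖H = ⊔-⋖ (⋖-flat A⋖G₁) (⋖-disjoint A⋖G₂ A⋖G₁ (G₁≢G₂ ∘ sym) g∈)

  open Systems M

  -- Phases are constrained only on vectors that vanish on the loops. Clearing those entries lets
  -- arbitrary sign functions be used; their values on loops never matter.
  toVec : Signs n → Vec Bool n
  toVec x = tabulate (splice (loops M) (λ _ → false) x)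

  toVec-zero : (x : Signs n) → ZeroOnL M (toVec x)
  toVec-zero x e e∈L = trans (lookup∘tabulate _ e) (splice-in (mem e∈L))

  lookup-toVec : {x : Signs n} {e : Fin n} → e ∉ loops M → lookup (toVec x) e ≡ x e
  lookup-toVec {e = e} e∉L = trans (lookup∘tabulate _ e) (splice-out e∉L)

  ⊕-zero : {u v : Vec Bool n} → ZeroOnL M u → ZeroOnL M v → ZeroOnL M (_⊕_ M u v)
  ⊕-zero {u} {v} zu zv e e∈L = trans (lookup-zipWith _ e u v) (cong₂ (λ a b → (a ∧ not b) ∨ (not a ∧ b)) (zu e e∈L) (zv e e∈L))

  lookup-⊕ : (u v : Vec Bool n) (e : Fin n) → lookup (_⊕_ M u v) e ≡ (lookup u ⊻ lookup v) e
  lookup-⊕ u v e = trans (lookup-zipWith _ e u v) (xor-⊕ (lookup u e) (lookup v e))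

  module Phases (P : RealPhaseStructure M) where

    Φ : List (Subset n) → Signs n → Set
    Φ Gs x = phase P (dropLast Gs) (toVec x) ≡ true

    above-loops : {F G : Subset n} {e : Fin n} → F ⋖ G → (G ∖∖ F) e → e ∉ loops M
    above-loops F⋖G (_ , e∉F) = ∉-⊑ (loops-min (⋖-flatˡ F⋖G)) e∉F

    difference : {x : Signs n} (v : Vec Bool n) {e : Fin n} → e ∉ loops M → lookup (_⊕_ M (toVec x) v) e ≡ (x ⊻ lookup v) e
    difference {x} v {e} e∉L = trans (lookup-⊕ (toVec x) v e) (cong (_xor lookup v e) (lookup-toVec {x} e∉L))

    module _ {Gs : List (Subset n)} (p : Path (loops M) Gs fullSet) where

      private
        origin : Vec Bool n
        origin = proj₁ (phase-affine P (dropLast Gs) (path⇒facet p))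

      Φ⇒direction : {x : Signs n} → Φ Gs x → Along (Constant (x ⊻ lookup origin)) (loops M) Gs
      Φ⇒direction {x} Φx with phase-affine P (dropLast Gs) (path⇒facet p)
      ... | a , _ , affine = along-zip {Q₂ = λ _ _ → ⊤} block p
          (Directions.TZ2⇒constant M p (proj₁ (affine (toVec x) (toVec-zero x)) Φx)) (along-above p λ _ _ → tt)
        where
        block : ∀ {F G} → F ⋖ G → Constant (lookup (_⊕_ M (toVec x) a)) F G → ⊤ → Constant (x ⊻ lookup a) F G
        block F⋖G const _ = constant λ a∈ b∈ → trans (sym (difference {x} a (above-loops F⋖G a∈))) (trans (level const a∈ b∈) (difference {x} a (above-loops F⋖G b∈)))

      direction⇒Φ : {x : Signs n} → Along (Constant (x ⊻ lookup origin)) (loops M) Gs → Φ Gs x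
      direction⇒Φ {x} along with phase-affine P (dropLast Gs) (path⇒facet p)
      ... | a , za , affine = proj₂ (affine (toVec x) (toVec-zero x))
          (Directions.TZ2⇐ M p (⊕-zero {toVec x} {a} (toVec-zero x) za) (along-zip {Q₂ = λ _ _ → ⊤} block p along (along-above p λ _ _ → tt)))
        where
        block : ∀ {F G} → F ⋖ G → Constant (x ⊻ lookup a) F G → ⊤ → Constant (lookup (_⊕_ M (toVec x) a)) F G
        block F⋖G const _ = constant λ a∈ b∈ → trans (difference {x} a (above-loops F⋖G a∈)) (trans (level const a∈ b∈) (sym (difference {x} a (above-loops F⋖G b∈))))

      Φ-difference : {x y : Signs n} → Φ Gs x → Φ Gs y → Along (Constant (x ⊻ y)) (loops M) Gs
      Φ-difference {x} {y} Φx Φy = along-zip (λ _ cx cy → ⊻-trans {x = x} cx (⊻-sym {x = y} cy)) p (Φ⇒direction Φx) (Φ⇒direction Φy)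

      Φ-translate : {x y : Signs n} → Φ Gs x → Along (Constant (x ⊻ y)) (loops M) Gs → Φ Gs y
      Φ-translate {x} {y} Φx along = direction⇒Φ (along-zip (λ _ cx cxy → ⊻-trans {x = y} (⊻-sym {x = x} cxy) cx) p (Φ⇒direction Φx) along)

      opaque
        Φ-exists : ∃ (Φ Gs)
        Φ-exists = lookup origin , direction⇒Φ (along-above p λ _ _ → ⊻-agree {x = lookup origin} {lookup origin} λ _ → refl)

    module _ (gap : Gap) where
      open Gap gap

      Edge : Subset n → Signs n → Set
      Edge G x = A ⋖ G × G ⋖ H × Φ (filled G) x

      -- `edge-even` is the even covering at the ridge, read through `contains⇒filled`. The other
      -- two conditions express the direction space of a facet: it contains the indicator vector of
      -- `G ∖ A`, and its members are constant on blocks.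
      ridge-necklace : Necklace A H Edge
      ridge-necklace = record
        { edge-⋖ = proj₁
        ; edge-⊑ = λ (_ , G⋖H , _) → ⋖-⊑ G⋖H
        ; edge-even = even
        ; edge-flip = flip
        ; edge-rigid = rigid
        }
        where
        even : {G : Subset n} {x : Signs n} → Edge G x → ∃ λ G′ → G′ ≢ G × Edge G′ x
        even {G₀} {x} (A⋖G₀ , G₀⋖H , Φx)
          with even⇒another (λ C → containsᵇ M ridge C ∧ phase P C (toVec x)) Unique-facets
                 (phase-even P ridge ridge-codim (toVec x) (toVec-zero x))
                 (∈-facets {dropLast (filled G₀)} (path⇒facet (filled-path A⋖G₀ G₀⋖H))) (∧-true (filled-contains gap {G₀}) Φx)
        ... | C , C≢ , C∈ , both
          with contains⇒filled gap {C} (facets-IsFacet C∈) (∧-conicalˡ _ (phase P C (toVec x)) both)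
        ...   | G₁ , A⋖G₁ , G₁⋖H , refl =
                G₁ , (λ G₁≡G₀ → C≢ (cong (dropLast ∘ filled) G₁≡G₀)) , A⋖G₁ , G₁⋖H , ∧-conicalʳ (containsᵇ M ridge C) _ both
        flip : {G : Subset n} {x : Signs n} → Edge G x → Edge G (splice (G ∖ A) (not ∘ x) x)
        flip {G} {x} (A⋖G , G⋖H , Φx) = A⋖G , G⋖H , Φ-translate (filled-path A⋖G G⋖H) Φx
          (along-ascend below (λ _ K⊑A → outside λ (e∈K , _) → inj₂ (at K⊑A e∈K))
            (inside , along-above (G⋖H ∷ above) λ _ G⊑F → outside λ (_ , e∉F) → inj₁ (∉-⊑ G⊑F e∉F)))
          where
          y = splice (G ∖ A) (not ∘ x) x
          outside : {F K : Subset n} → (∀ {e} → (K ∖∖ F) e → e ∉ G ⊎ e ∊ A) → Constant (x ⊻ y) F K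
          outside off = ⊻-agree {x = x} {y} λ e∈ → sym (splice-out (∉-∖⁺ (off e∈)))
          inside : Constant (x ⊻ y) A G
          inside = constant λ a∈ b∈ → trans (flipped a∈) (sym (flipped b∈))
            where
            flipped : {e : Fin n} → (G ∖∖ A) e → (x ⊻ y) e ≡ true
            flipped {e} e∈ = trans (cong (x e xor_) (splice-in (∈-∖⁺ e∈))) (xor-not (x e))
        rigid : {G : Subset n} {x y : Signs n} {a b : Fin n} → Edge G x → Edge G y → (H ∖∖ A) a → (H ∖∖ A) b →
          lookup G a ≡ lookup G b → x a ≡ y a → x b ≡ y b
        rigid {G} {x} {y} {a} (A⋖G , G⋖H , Φx) (_ , _ , Φy) (a∈H , a∉A) (b∈H , b∉A) same
          with along-project below (Φ-difference (filled-path A⋖G G⋖H) Φx Φy) | ∈⊎∉ a G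
        ... | const , _ | inj₁ a∈G = ⊻-spread {x = x} const (a∈G , a∉A) (mem (trans (sym same) (holds a∈G)) , b∉A)
        ... | _ , const , _ | inj₂ a∉G = ⊻-spread {x = x} const (a∈H , a∉G) (b∈H , nonmem (trans (sym same) (fails a∉G)))

      -- With just one element of `G ∖ A` and one of `G₂ ∖ A` kept visible inside the interval, a
      -- walk that leaves `G` can only stop at `G₂`.
      swap : {G₂ : Subset n} {x : Signs n} → A ⋖ G₂ → G₂ ⋖ H → Φ (filled G) x →
        ∃ λ y → Φ (filled G₂) y × (∀ {e} → e ∊ A ⊎ e ∉ H → y e ≡ x e)
      swap {G₂} {x} A⋖G₂ G₂⋖H Φx with ≡⊎≢ G₂ G
      ... | inj₁ refl = x , Φx , λ _ → refl
      ... | inj₂ G₂≢G = landed (exchange-on ridge-necklace S (A⋖G , G⋖H , Φx) (proj₂ w) (among⁺ (here refl))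
              (at (⋖-⊑ G₂⋖H) (proj₁ (proj₂ w₂)) , ⋖-disjoint A⋖G₂ A⋖G G₂≢G (proj₂ w₂)) (among⁺ (there (here refl))))
        where
        w = ⋖-witness A⋖G
        w₂ = ⋖-witness A⋖G₂
        marked = proj₁ w ∷ proj₁ w₂ ∷ []
        S = among marked
        landed : Exchange A H Edge G x (λ e → S e ≡ true ⊎ e ∊ A ⊎ e ∉ H) →
          ∃ λ y → Φ (filled G₂) y × (∀ {e} → e ∊ A ⊎ e ∉ H → y e ≡ x e)
        landed record { G′ = G′ ; x′ = y ; c = c ; G′≢G = G′≢G ; edge = (A⋖G′ , G′⋖H , Φy) ; c∈G′ = c∈G′ ; c-fixed = c-fixed ; agree = agree } =
          y , subst (λ G → Φ (filled G) y) (visible c-fixed) Φy , λ e∈ → agree (inj₂ e∈)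
          where
          visible : S c ≡ true ⊎ c ∊ A ⊎ c ∉ H → G′ ≡ G₂
          visible (inj₁ Sc) with among⁻ {xs = marked} Sc
          ... | here c≡ = ⊥-elim (G′≢G (⋖-unique A⋖G′ A⋖G c∈G′ (subst (_∊ G) (sym c≡) (proj₁ (proj₂ w)))))
          ... | there (here c≡) = ⋖-unique A⋖G′ A⋖G₂ c∈G′ (subst (_∊ G₂) (sym c≡) (proj₁ (proj₂ w₂)))
          visible (inj₂ (inj₁ c∈A)) = clash c∈A (proj₂ c∈G′)
          visible (inj₂ (inj₂ c∉H)) = clash (at (⋖-⊑ G′⋖H) (proj₁ c∈G′)) c∉H

    -- Maximal chains of an interval are connected by changing one flat at a time.
    Reroute : Subset n → Set
    Reroute A = {B : Subset n} {pre mid mid′ post : List (Subset n)} {x : Signs n} →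
      Descent pre A → Path A mid B → Path A mid′ B → Path B post fullSet → Φ (pre ʳ++ (mid ++ post)) x →
      ∃ λ y → Φ (pre ʳ++ (mid′ ++ post)) y × (∀ {e} → e ∊ A ⊎ e ∉ B → y e ≡ x e)

    reroute : {A : Subset n} → Reroute A
    reroute {A} = flat-induction {Reroute} go A
      where
      go : ∀ A → (∀ G → A ⊑ G → ∃ (G ∖∖ A) → Reroute G) → Reroute A
      go A rec d [] [] _ Φx = _ , Φx , λ _ → refl
      go A rec d [] (A⋖G ∷ p) _ _ = ⊥-elim (no-loop A⋖G p)
      go A rec d (A⋖G ∷ p) [] _ _ = ⊥-elim (no-loop A⋖G p)
      go A rec {B} {pre} {post = post} d (_∷_ {G₁} A⋖G₁ p₁) (_∷_ {G₂} A⋖G₂ p₂) q Φx with ≡⊎≢ G₁ G₂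
      ... | inj₁ refl with rec G₁ (⋖-⊑ A⋖G₁) (⋖-witness A⋖G₁) (A⋖G₁ ∷ d) p₁ p₂ q Φx
      ...   | y , Φy , y≡x = y , Φy , λ { (inj₁ e∈A) → y≡x (inj₁ (at (⋖-⊑ A⋖G₁) e∈A)) ; (inj₂ e∉B) → y≡x (inj₂ e∉B) }
      go A rec {B} {pre} {post = post} d (_∷_ {G₁} A⋖G₁ p₁) (_∷_ {G₂} A⋖G₂ p₂) q Φx
          | inj₂ G₁≢G₂ with diamond-top A⋖G₁ A⋖G₂ G₁≢G₂ p₁ p₂
      -- Three moves: above `G₁`, reroute through the join `H` of `G₁` and `G₂`; below `H`, swap
      -- `G₁` for `G₂`; above `G₂`, reroute to the target chain. Each of them leaves the signs on
      -- `A` and off `B` alone.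
      ... | H , m , G₁⋖H , G₂⋖H , p with rec G₁ (⋖-⊑ A⋖G₁) (⋖-witness A⋖G₁) (A⋖G₁ ∷ d) p₁ (G₁⋖H ∷ p) q Φx
      ...   | y₁ , Φy₁ , y₁≡x
          with swap (record { below = d ; A⋖G = A⋖G₁ ; G⋖H = G₁⋖H ; above = Path-++ p q }) A⋖G₂ G₂⋖H Φy₁
      ...     | y₂ , Φy₂ , y₂≡y₁ with rec G₂ (⋖-⊑ A⋖G₂) (⋖-witness A⋖G₂) (A⋖G₂ ∷ d) (G₂⋖H ∷ p) p₂ q Φy₂
      ...       | y₃ , Φy₃ , y₃≡y₂ = y₃ , Φy₃ , λ
        { (inj₁ e∈A) → trans (y₃≡y₂ (inj₁ (at (⋖-⊑ A⋖G₂) e∈A))) (trans (y₂≡y₁ (inj₁ e∈A)) (y₁≡x (inj₁ (at (⋖-⊑ A⋖G₁) e∈A))))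
        ; (inj₂ e∉B) → trans (y₃≡y₂ (inj₂ e∉B)) (trans (y₂≡y₁ (inj₂ (∉-⊑ (Path-⊑ p) e∉B))) (y₁≡x (inj₂ e∉B))) }

    R : Subset n → Subset n → Signs n → Set
    R F G x = ∃ λ pre → ∃ λ post → ∃ λ y →
      Descent pre F × Path G post fullSet × Φ (pre ʳ++ (G ∷ post)) y × (∀ {e} → (G ∖∖ F) e → x e ≡ y e)

    R-ext : {F G : Subset n} {x y : Signs n} → R F G x → (∀ {e} → (G ∖∖ F) e → y e ≡ x e) → R F G y
    R-ext (pre , post , z , d , p , Φz , x≡z) y≡x = pre , post , z , d , p , Φz , λ e∈ → trans (y≡x e∈) (x≡z e∈)

    -- The sign vector of a cover, up to a global sign, does not depend on the maximal chain through it.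
    R-constant : {F G : Subset n} {x x′ : Signs n} → F ⋖ G → R F G x → R F G x′ → Constant (x ⊻ x′) F G
    R-constant {F} {G} {x} {x′} F⋖G (pre , post , y , d , p , Φy , x≡y) (pre′ , post′ , y′ , d′ , p′ , Φy′ , x′≡y′)
      -- Rerouting above `G` keeps the signs on `G`, and rerouting below `F` keeps those off `F`;
      -- the block `G ∖ F` is untouched by both.
      with reroute (F⋖G ∷ d) p p′ [] (subst (λ t → Φ (pre ʳ++ (G ∷ t)) y) (sym (++-identityʳ post)) Φy)
    ... | y₁ , Φy₁ , y₁≡y
      with reroute [] (ascend d []) (ascend d′ []) (F⋖G ∷ p′)
             (subst (λ Gs → Φ Gs y₁) (sym (ʳ++-[] pre)) (subst (λ t → Φ (pre ʳ++ (G ∷ t)) y₁) (++-identityʳ post′) Φy₁))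
    ...   | y₂ , Φy₂ , y₂≡y₁ =
      ⊻-trans {x = x} (⊻-agree λ (e∈G , e∉F) → trans (x≡y (e∈G , e∉F)) (sym (trans (y₂≡y₁ (inj₂ e∉F)) (y₁≡y (inj₁ e∈G)))))
        (⊻-trans {x = y₂} (proj₁ (along-project d′ (Φ-difference (ascend d′ (F⋖G ∷ p′)) (subst (λ Gs → Φ Gs y₂) (ʳ++-[] pre′) Φy₂) Φy′)))
          (⊻-agree (sym ∘ x′≡y′)))

    Φ⇒R : {pre Gs : List (Subset n)} {A : Subset n} {x : Signs n} → Descent pre A → Path A Gs fullSet → Φ (pre ʳ++ Gs) x →
      Along (λ F G → R F G x) A Gs
    Φ⇒R d [] _ = tt
    Φ⇒R d (A⋖G ∷ p) Φx = (_ , _ , _ , d , p , Φx , λ _ → refl) , Φ⇒R (A⋖G ∷ d) p Φx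

    -- The phase of the facet is nonempty. On each block `x` agrees up to sign with a chosen member
    -- of it, so the two differ by a vector of the direction space.
    R⇒Φ : {Gs : List (Subset n)} {x : Signs n} → Path (loops M) Gs fullSet → Along (λ F G → R F G x) (loops M) Gs → Φ Gs x
    R⇒Φ p along with Φ-exists p
    ... | y , Φy = Φ-translate p Φy (along-zip R-constant p (Φ⇒R [] p Φy) along)

    phase-system : SignSystem
    phase-system = record
      { R = R
      ; R-ext = R-ext
      ; R-not = opposite
      ; R-rigid = λ F⋖G r r′ → ⊻-spread (R-constant F⋖G r r′)
      ; R-exists = exists
      ; R-even = even
      }
      where
      opposite : {F G : Subset n} {x : Signs n} → F ⋖ G → R F G x → R F G (not ∘ x)
      opposite {x = x} F⋖G (pre , post , y , d , p , Φy , x≡y) = pre , post , not ∘ y , d , p ,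
        Φ-translate path Φy (along-above path λ _ _ → constant λ {a} {b} _ _ → trans (xor-not (y a)) (sym (xor-not (y b)))) ,
        λ e∈ → cong not (x≡y e∈)
        where path = ascend d (F⋖G ∷ p)
      exists : {F G : Subset n} → F ⋖ G → ∃ (R F G)
      exists F⋖G with descent-exists (⋖-flatˡ F⋖G) | Path-exists (⋖-flat F⋖G) (flat-E M) ⊑-full
      ... | pre , d | post , p with Φ-exists (ascend d (F⋖G ∷ p))
      ...   | x , Φx = x , pre , post , x , d , p , Φx , λ _ → refl
      even : {A G H : Subset n} {x : Signs n} → A ⋖ G → G ⋖ H → R A G x → R G H x →
        ∃ λ G′ → G′ ≢ G × A ⋖ G′ × G′ ⋖ H × R A G′ x × R G′ H x
      even {A} {G} {H} {x} A⋖G G⋖H r s with descent-exists (⋖-flatˡ A⋖G) | Path-exists (⋖-flat G⋖H) (flat-E M) ⊑-full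
      ... | pre , d | post , p with Φ-exists (ascend d (A⋖G ∷ G⋖H ∷ p))
      ...   | y , Φy = leave (Necklace.edge-even (ridge-necklace gap) (A⋖G , G⋖H , Φx′))
        where
        gap = record { below = d ; A⋖G = A⋖G ; G⋖H = G⋖H ; above = p }
        -- The two hypotheses on `x` may come from different chains. Taking `y` on `A` and off `H`
        -- and keeping `x` in between yields, by `R-constant`, a member of the phase of one facet
        -- through both covers, to which the even covering applies.
        x′ = splice H (splice A y x) y
        x′-below : {e : Fin n} → e ∊ A → x′ e ≡ y e
        x′-below e∈A = trans (splice-in (at (⋖-⊑ G⋖H) (at (⋖-⊑ A⋖G) e∈A))) (splice-in e∈A)
        x′-above : {e : Fin n} → e ∉ H → x′ e ≡ y e
        x′-above = splice-out
        x′-within : {e : Fin n} → (H ∖∖ A) e → x′ e ≡ x e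
        x′-within (e∈H , e∉A) = trans (splice-in e∈H) (splice-out e∉A)
        along = Φ⇒R d (A⋖G ∷ G⋖H ∷ p) Φy
        Φx′ : Φ (pre ʳ++ (G ∷ H ∷ post)) x′
        Φx′ = Φ-translate (ascend d (A⋖G ∷ G⋖H ∷ p)) Φy
          (along-ascend d (λ _ K⊑A → ⊻-agree λ (e∈K , _) → sym (x′-below (at K⊑A e∈K)))
            ( R-constant A⋖G (proj₁ along) (R-ext r λ (e∈G , e∉A) → x′-within (at (⋖-⊑ G⋖H) e∈G , e∉A))
            , R-constant G⋖H (proj₁ (proj₂ along)) (R-ext s λ (e∈H , e∉G) → x′-within (e∈H , ∉-⊑ (⋖-⊑ A⋖G) e∉G))
            , along-above p λ _ H⊑F → ⊻-agree λ (_ , e∉F) → sym (x′-above (∉-⊑ H⊑F e∉F))))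
        leave : (∃ λ G′ → G′ ≢ G × A ⋖ G′ × G′ ⋖ H × Φ (pre ʳ++ (G′ ∷ H ∷ post)) x′) →
          ∃ λ G′ → G′ ≢ G × A ⋖ G′ × G′ ⋖ H × R A G′ x × R G′ H x
        leave (G′ , G′≢G , A⋖G′ , G′⋖H , Φ′) = G′ , G′≢G , A⋖G′ , G′⋖H ,
          (pre , H ∷ post , x′ , d , G′⋖H ∷ p , Φ′ , λ (e∈G′ , e∉A) → sym (x′-within (at (⋖-⊑ G′⋖H) e∈G′ , e∉A))) ,
          (G′ ∷ pre , post , x′ , A⋖G′ ∷ d , p , Φ′ , λ (e∈H , e∉G′) → sym (x′-within (e∈H , ∉-⊑ (⋖-⊑ A⋖G′) e∉G′)))

-- Sign vectors as zero sets with signs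

sgn : Bool → Sign
sgn b = if b then -s else +s

isNegative : Sign → Bool
isNegative -s = true
isNegative _ = false

sgn-≢0 : (b : Bool) → sgn b ≢ 0s
sgn-≢0 true ()
sgn-≢0 false ()

sgn-neg : {a b : Bool} → a ≢ b → sgn a ≡ negS (sgn b)
sgn-neg {true} {true} a≢b = ⊥-elim (a≢b refl)
sgn-neg {true} {false} _ = refl
sgn-neg {false} {true} _ = refl
sgn-neg {false} {false} a≢b = ⊥-elim (a≢b refl)

sgn-not : (b : Bool) → negS (sgn b) ≡ sgn (not b)
sgn-not true = refl
sgn-not false = refl

sgn-≢neg : (b : Bool) → sgn b ≢ negS (sgn b)
sgn-≢neg true ()
sgn-≢neg false ()

sgn-isNegative : (b : Bool) → isNegative (sgn b) ≡ b
sgn-isNegative true = refl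
sgn-isNegative false = refl

isZero-sgn : (b : Bool) → isZeroS (sgn b) ≡ false
isZero-sgn true = refl
isZero-sgn false = refl

compS-sgn : (b : Bool) (s : Sign) → compS (sgn b) s ≡ sgn b
compS-sgn true _ = refl
compS-sgn false _ = refl

isZero⇒ : {s : Sign} → isZeroS s ≡ true → s ≡ 0s
isZero⇒ {0s} _ = refl

nonZero⇒ : {s : Sign} → isZeroS s ≡ false → s ≡ sgn (isNegative s)
nonZero⇒ {+s} _ = refl
nonZero⇒ { -s} _ = refl

sgn-≤S : (b : Bool) {s : Sign} → sgn b ≤S s → s ≡ sgn b
sgn-≤S true = sym
sgn-≤S false = sym

module _ {n : ℕ} where

  -- The sign vector with zero set F and signs x off F; true stands for −1.
  opaque
    cv : Subset n → Signs n → SignVec n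
    cv F x = tabulate λ e → if lookup F e then 0s else sgn (x e)

    cv-in : {F : Subset n} {x : Signs n} {e : Fin n} → e ∊ F → lookup (cv F x) e ≡ 0s
    cv-in {x = x} {e} (mem e∈F) = trans (lookup∘tabulate _ e) (cong (λ b → if b then 0s else sgn (x e)) e∈F)

    cv-out : {F : Subset n} {x : Signs n} {e : Fin n} → e ∉ F → lookup (cv F x) e ≡ sgn (x e)
    cv-out {x = x} {e} (nonmem e∉F) = trans (lookup∘tabulate _ e) (cong (λ b → if b then 0s else sgn (x e)) e∉F)

  ≡-cv : {X : SignVec n} {F : Subset n} {x : Signs n} → (∀ {e} → e ∊ F → lookup X e ≡ 0s) →
    (∀ {e} → e ∉ F → lookup X e ≡ sgn (x e)) → X ≡ cv F x
  ≡-cv {X} {F} {x} on off = lookup-ext same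
    where
    same : ∀ e → lookup X e ≡ lookup (cv F x) e
    same e with ∈⊎∉ e F
    ... | inj₁ e∈F = trans (on e∈F) (sym (cv-in e∈F))
    ... | inj₂ e∉F = trans (off e∉F) (sym (cv-out e∉F))

  cv-ext : {F : Subset n} {x y : Signs n} → (∀ {e} → e ∉ F → x e ≡ y e) → cv F x ≡ cv F y
  cv-ext x≡y = ≡-cv cv-in λ e∉F → trans (cv-out e∉F) (cong sgn (x≡y e∉F))

  negatives : SignVec n → Signs n
  negatives X e = isNegative (lookup X e)

  ∈-zeroSet : {X : SignVec n} {e : Fin n} → e ∊ zeroSet X → lookup X e ≡ 0s
  ∈-zeroSet {X} {e} (mem e∈) = isZero⇒ (trans (sym (lookup-map e isZeroS X)) e∈)

  ∉-zeroSet : {X : SignVec n} {e : Fin n} → e ∉ zeroSet X → lookup X e ≡ sgn (negatives X e)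
  ∉-zeroSet {X} {e} (nonmem e∉) = nonZero⇒ (trans (sym (lookup-map e isZeroS X)) e∉)

  zero⇒∈ : {X : SignVec n} {e : Fin n} → lookup X e ≡ 0s → e ∊ zeroSet X
  zero⇒∈ {X} {e} z = mem (trans (lookup-map e isZeroS X) (cong isZeroS z))

  sgn⇒∉ : {X : SignVec n} {e : Fin n} {b : Bool} → lookup X e ≡ sgn b → e ∉ zeroSet X × negatives X e ≡ b
  sgn⇒∉ {X} {e} {b} s = nonmem (trans (lookup-map e isZeroS X) (trans (cong isZeroS s) (isZero-sgn b))) ,
    trans (cong isNegative s) (sgn-isNegative b)

  cv-zeroSet : (X : SignVec n) → X ≡ cv (zeroSet X) (negatives X)
  cv-zeroSet X = ≡-cv ∈-zeroSet ∉-zeroSet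

  zeroSet-cv : (F : Subset n) (x : Signs n) → zeroSet (cv F x) ≡ F
  zeroSet-cv F x = ⊑-antisym (incl into) (incl λ e∈F → zero⇒∈ (cv-in e∈F))
    where
    into : ∀ {e} → e ∊ zeroSet (cv F x) → e ∊ F
    into {e} e∈ with ∈⊎∉ e F
    ... | inj₁ e∈F = e∈F
    ... | inj₂ e∉F = clash e∈ (proj₁ (sgn⇒∉ (cv-out e∉F)))

  negatives-cv : {F : Subset n} {x : Signs n} {e : Fin n} → e ∉ F → negatives (cv F x) e ≡ x e
  negatives-cv {F} {x} e∉F = proj₂ (sgn⇒∉ {cv F x} (cv-out e∉F))

  zeroSV-cv : (x : Signs n) → zeroSV ≡ cv fullSet x
  zeroSV-cv x = ≡-cv (λ {e} _ → lookup-replicate e 0s) λ e∉ → clash ∈-full e∉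

  negV-cv : (F : Subset n) (x : Signs n) → negV (cv F x) ≡ cv F (not ∘ x)
  negV-cv F x = ≡-cv (λ {e} e∈F → trans (lookup-map e negS (cv F x)) (cong negS (cv-in e∈F)))
    (λ {e} e∉F → trans (lookup-map e negS (cv F x)) (trans (cong negS (cv-out e∉F)) (sgn-not (x e))))

  lookup-∘V : (X Y : SignVec n) (e : Fin n) → lookup (X ∘V Y) e ≡ compS (lookup X e) (lookup Y e)
  lookup-∘V X Y e = lookup-zipWith compS e X Y

  module _ {F G : Subset n} {x y : Signs n} {e : Fin n} where

    private
      composite : {s t : Sign} → lookup (cv F x) e ≡ s → lookup (cv G y) e ≡ t → lookup (cv F x ∘V cv G y) e ≡ compS s t
      composite X≡ Y≡ = trans (lookup-∘V (cv F x) (cv G y) e) (cong₂ compS X≡ Y≡)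

    ∘V-zero : e ∊ F → e ∊ G → lookup (cv F x ∘V cv G y) e ≡ 0s
    ∘V-zero e∈F e∈G = composite (cv-in e∈F) (cv-in e∈G)

    ∘V-left : e ∉ F → lookup (cv F x ∘V cv G y) e ≡ sgn (x e)
    ∘V-left e∉F = trans (composite (cv-out e∉F) refl) (compS-sgn (x e) (lookup (cv G y) e))

    ∘V-right : e ∊ F → e ∉ G → lookup (cv F x ∘V cv G y) e ≡ sgn (y e)
    ∘V-right e∈F e∉G = composite (cv-in e∈F) (cv-out e∉G)

  ∘V-cv : (F G : Subset n) (x y : Signs n) → (cv F x ∘V cv G y) ≡ cv (F ∩ G) (splice F y x)
  ∘V-cv F G x y = ≡-cv (λ e∈ → ∘V-zero (at ∩-⊑ˡ e∈) (at ∩-⊑ʳ e∈)) off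
    where
    off : ∀ {e} → e ∉ (F ∩ G) → lookup (cv F x ∘V cv G y) e ≡ sgn (splice F y x e)
    off {e} e∉ with ∈⊎∉ e F | ∈⊎∉ e G
    ... | inj₁ e∈F | inj₁ e∈G = clash (∈-∩⁺ e∈F e∈G) e∉
    ... | inj₁ e∈F | inj₂ e∉G = trans (∘V-right e∈F e∉G) (cong sgn (sym (splice-in e∈F)))
    ... | inj₂ e∉F | _ = trans (∘V-left e∉F) (cong sgn (sym (splice-out e∉F)))

  Separates-cv : {F G : Subset n} {x y : Signs n} {i : Fin n} → i ∉ F → i ∉ G → x i ≢ y i → Separates (cv F x) (cv G y) i
  Separates-cv {x = x} {y} {i} i∉F i∉G x≢y = (λ z → sgn-≢0 (x i) (trans (sym (cv-out i∉F)) z)) ,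
    trans (cv-out i∉F) (trans (sgn-neg x≢y) (cong negS (sym (cv-out i∉G))))

  ¬Separates-cv : {F G : Subset n} {x y : Signs n} {j : Fin n} → j ∊ F ⊎ j ∊ G ⊎ x j ≡ y j → ¬ Separates (cv F x) (cv G y) j
  ¬Separates-cv (inj₁ j∈F) (nonzero , _) = nonzero (cv-in j∈F)
  ¬Separates-cv (inj₂ (inj₁ j∈G)) (nonzero , opposite) = nonzero (trans opposite (cong negS (cv-in j∈G)))
  ¬Separates-cv {F} {G} {x} {y} {j} (inj₂ (inj₂ xj≡yj)) (nonzero , opposite) with ∈⊎∉ j F | ∈⊎∉ j G
  ... | inj₁ j∈F | _ = nonzero (cv-in j∈F)
  ... | _ | inj₁ j∈G = nonzero (trans opposite (cong negS (cv-in j∈G)))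
  ... | inj₂ j∉F | inj₂ j∉G = sgn-≢neg (y j) (trans (cong sgn (sym xj≡yj))
        (trans (sym (cv-out j∉F)) (trans opposite (cong negS (cv-out j∉G)))))

-- Covectors of an orientation: flags of faces and the diamond property

module Orientations {n : ℕ} (M : Matroid n) where
  open Flats M
  open Facets M
  open Blocks M

  private
    E : Subset n
    E = fullSet

  flags⇒along : {Q : Subset n → Set} {A : Subset n} {Gs : List (Subset n)} → Path A Gs E →
    (∀ {F} → F ∈ₗ (A ∷ dropLast Gs) → Q F) → Along (λ F _ → Q F) A Gs
  flags⇒along [] _ = tt
  flags⇒along (A⋖G ∷ []) q = q (here refl) , tt
  flags⇒along (A⋖G ∷ p@(_ ∷ _)) q = q (here refl) , flags⇒along p (q ∘ there)

  along⇒flags : {Q : Subset n → Set} {A : Subset n} {Gs : List (Subset n)} → Q E → Path A Gs E →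
    Along (λ F _ → Q F) A Gs → ∀ {F} → F ∈ₗ (A ∷ dropLast Gs) → Q F
  along⇒flags QE [] _ (here refl) = QE
  along⇒flags QE (_ ∷ []) (q , _) (here refl) = q
  along⇒flags QE (_ ∷ _ ∷ _) (q , _) (here refl) = q
  along⇒flags QE (_ ∷ p@(_ ∷ _)) (_ , qs) (there F∈) = along⇒flags QE p qs F∈

  along-replace : {Q : Subset n → Set} {A : Subset n} {pre Gs Hs : List (Subset n)} → Descent pre A →
    Along (λ F _ → Q F) (loops M) (pre ʳ++ Gs) → Along (λ F _ → Q F) A Hs → Along (λ F _ → Q F) (loops M) (pre ʳ++ Hs)
  along-replace [] _ new = new
  along-replace (F⋖A ∷ d) old new = along-replace d old (proj₁ (along-project d old) , new)

  module Covectors (𝓜 : OrientedMatroid n) (orients : IsOrientationOf 𝓜 M) where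

    K : Subset n → Signs n → Set
    K F x = IsCov 𝓜 (cv F x)

    K-ext : {F : Subset n} {x y : Signs n} → K F x → (∀ {e} → e ∉ F → y e ≡ x e) → K F y
    K-ext k y≡x = subst (IsCov 𝓜) (sym (cv-ext y≡x)) k

    K-flat : {F : Subset n} {x : Signs n} → K F x → IsFlat M F
    K-flat {F} {x} k = proj₂ (orients F) (cv F x , k , sym (zeroSet-cv F x))

    K-of : {X : SignVec n} → IsCov 𝓜 X → K (zeroSet X) (negatives X)
    K-of {X} = subst (IsCov 𝓜) (cv-zeroSet X)

    K-exists : {F : Subset n} → IsFlat M F → ∃ (K F)
    K-exists {F} F-flat with proj₁ (orients F) F-flat
    ... | X , X-cov , refl = negatives X , K-of X-cov

    K-E : {x : Signs n} → K E x
    K-E {x} = subst (IsCov 𝓜) (zeroSV-cv x) (cov-zero 𝓜)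

    K-not : {F : Subset n} {x : Signs n} → K F x → K F (not ∘ x)
    K-not {F} {x} k = subst (IsCov 𝓜) (negV-cv F x) (cov-neg 𝓜 _ k)

    K-comp : {F G : Subset n} {x y : Signs n} → G ⊑ F → K F x → K G y → K G (splice F y x)
    K-comp {F} {G} {x} {y} G⊑F k l = subst (λ H → K H (splice F y x)) F∩G≡G
      (subst (IsCov 𝓜) (∘V-cv F G x y) (cov-comp 𝓜 _ _ k l))
      where
      F∩G≡G : F ∩ G ≡ G
      F∩G≡G = ⊑-antisym ∩-⊑ʳ (incl λ e∈G → ∈-∩⁺ (at G⊑F e∈G) e∈G)

    -- As `F ⊑ G`, the composition of the two covectors is the first one. Coordinates that are not
    -- separated thus keep the sign of `x` off `F` and stay zero on `F`.
    K-elim : {F G : Subset n} {x y : Signs n} {i : Fin n} → F ⊑ G → K F x → K G y → i ∉ G → x i ≢ y i →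
      ∃ λ H → ∃ λ z → K H z × i ∊ H × F ⊑ H × (∀ {j} → j ∉ F → j ∊ G ⊎ x j ≡ y j → j ∉ H × z j ≡ x j)
    K-elim {F} {G} {x} {y} {i} F⊑G k l i∉G x≢y with cov-elim 𝓜 _ _ k l i (Separates-cv (∉-⊑ F⊑G i∉G) i∉G x≢y)
    ... | Z , Z-cov , Zi , Z≡ = zeroSet Z , negatives Z , K-of Z-cov , zero⇒∈ Zi , incl F⊑H , keep
      where
      F⊑H : ∀ {j} → j ∊ F → j ∊ zeroSet Z
      F⊑H {j} j∈F = zero⇒∈ (trans (Z≡ j (¬Separates-cv (inj₁ j∈F))) (∘V-zero j∈F (at F⊑G j∈F)))
      keep : ∀ {j} → j ∉ F → j ∊ G ⊎ x j ≡ y j → j ∉ zeroSet Z × negatives Z j ≡ x j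
      keep {j} j∉F j∈ = sgn⇒∉ (trans (Z≡ j (¬Separates-cv (inj₂ j∈))) (∘V-left j∉F))

    -- If the signs differed at `b`, elimination there would produce a flat that contains `b`, hence
    -- all of `G`, but avoids `a`, where they agree.
    K-rigid : {F G : Subset n} {x y : Signs n} {a b : Fin n} → F ⋖ G → K F x → K F y → K G x →
      (G ∖∖ F) a → (G ∖∖ F) b → x a ≡ y a → x b ≡ y b
    K-rigid {F} {G} {x} {y} {a} {b} F⋖G kx ky gx a∈ b∈ same with x b ≟B y b
    ... | yes xb≡yb = xb≡yb
    ... | no xb≢yb with K-elim ⊑-refl kx (K-comp (⋖-⊑ F⋖G) gx ky) (proj₂ b∈) (λ eq → xb≢yb (trans eq (splice-in (proj₁ b∈))))
    ...   | H , z , h , b∈H , F⊑H , keep =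
            clash (at (⋖-min F⋖G b∈ (K-flat h) F⊑H b∈H) (proj₁ a∈)) (proj₁ (keep (proj₂ a∈) (inj₂ (trans same (sym (splice-in (proj₁ a∈)))))))

    K-constant : {F G : Subset n} {x y : Signs n} → F ⋖ G → K F x → K F y → K G x → Constant (x ⊻ y) F G
    K-constant {x = x} {y} F⋖G kx ky gx = constant level′
      where
      level′ : ∀ {a b} → _ → _ → (x ⊻ y) a ≡ (x ⊻ y) b
      level′ {a} {b} a∈ b∈ with x a ≟B y a | x b ≟B y b
      ... | yes p | yes q = trans (≡-xor p) (sym (≡-xor q))
      ... | yes p | no ¬q = ⊥-elim (¬q (K-rigid F⋖G kx ky gx a∈ b∈ p))
      ... | no ¬p | yes q = ⊥-elim (¬p (K-rigid F⋖G kx ky gx b∈ a∈ q))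
      ... | no ¬p | no ¬q = trans (≢-xor ¬p) (sym (≢-xor ¬q))
        where
        ≢-xor : {a b : Bool} → a ≢ b → a xor b ≡ true
        ≢-xor {a} {b} a≢b with true⊎false (a xor b)
        ... | inj₁ t = t
        ... | inj₂ f = ⊥-elim (a≢b (xor-≡ f))

    Flag : Signs n → Subset n → List (Subset n) → Set
    Flag x = Along (λ F _ → K F x)

    flag-first : {x : Signs n} {A : Subset n} {Gs : List (Subset n)} → Path A Gs E → Flag x A Gs → K A x
    flag-first [] _ = K-E
    flag-first (_ ∷ _) (k , _) = k

    flag-ext : {x y : Signs n} {A : Subset n} {Gs : List (Subset n)} → Path A Gs E → (∀ {e} → e ∉ A → y e ≡ x e) →
      Flag x A Gs → Flag y A Gs
    flag-ext [] _ _ = tt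
    flag-ext (A⋖G ∷ p) y≡x (k , ks) = K-ext k y≡x , flag-ext p (λ e∉G → y≡x (∉-⊑ (⋖-⊑ A⋖G) e∉G)) ks

    flag-extend : {x : Signs n} {A G : Subset n} {Gs : List (Subset n)} → A ⋖ G → Path G Gs E → Flag x G Gs →
      ∃ λ y → Flag y A (G ∷ Gs) × (∀ {e} → e ∉ G → y e ≡ x e)
    flag-extend {x} A⋖G p flag with K-exists (⋖-flatˡ A⋖G)
    ... | w , k = splice _ w x , (K-comp (⋖-⊑ A⋖G) (flag-first p flag) k , flag-ext p splice-out flag) , splice-out

    flag-exists : {A : Subset n} {Gs : List (Subset n)} → Path A Gs E → ∃ λ x → Flag x A Gs
    flag-exists [] = (λ _ → true) , tt
    flag-exists (A⋖G ∷ p) with flag-extend A⋖G p (proj₂ (flag-exists p))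
    ... | y , flag , _ = y , flag

    flag-descend : {x : Signs n} {A : Subset n} {pre Gs : List (Subset n)} → Descent pre A → Path A Gs E → Flag x A Gs →
      ∃ λ y → Flag y (loops M) (pre ʳ++ Gs) × (∀ {e} → e ∉ A → y e ≡ x e)
    flag-descend [] _ flag = _ , flag , λ _ → refl
    flag-descend (F⋖A ∷ d) p flag with flag-extend F⋖A p flag
    ... | y , flag′ , y≡x with flag-descend d (F⋖A ∷ p) flag′
    ...   | z , flag″ , z≡y = z , flag″ , λ e∉A → trans (z≡y (∉-⊑ (⋖-⊑ F⋖A) e∉A)) (y≡x e∉A)

    flag-difference : {x y : Signs n} {A : Subset n} {Gs : List (Subset n)} → Path A Gs E → Flag x A Gs → Flag y A Gs →
      Along (Constant (x ⊻ y)) A Gs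
    flag-difference [] _ _ = tt
    flag-difference (A⋖G ∷ p) (k , ks) (l , ls) = K-constant A⋖G k l (flag-first p ks) , flag-difference p ks ls

    -- The induction supplies the face of `y` over `G`. On the block `G ∖ A`, `y` is `x` or its
    -- opposite, so composing that face with the covector of `x` over `A`, or with its negative,
    -- gives `y` over `A`.
    flag-translate : {x y : Signs n} {A : Subset n} {Gs : List (Subset n)} → Path A Gs E → Flag x A Gs →
      Along (Constant (x ⊻ y)) A Gs → Flag y A Gs
    flag-translate [] _ _ = tt
    flag-translate {x} {y} {A} (_∷_ {G} A⋖G p) (k , ks) (const , consts) = align (⋖-witness A⋖G) , flag
      where
      flag = flag-translate p ks consts
      use : {w : Signs n} → K A w → (∀ {e} → (G ∖∖ A) e → y e ≡ w e) → K A y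
      use {w} l y≡w = K-ext (K-comp (⋖-⊑ A⋖G) (flag-first p flag) l) same
        where
        same : ∀ {e} → e ∉ A → y e ≡ splice G w y e
        same {e} e∉A with ∈⊎∉ e G
        ... | inj₁ e∈G = trans (y≡w (e∈G , e∉A)) (sym (splice-in e∈G))
        ... | inj₂ e∉G = sym (splice-out e∉G)
      align : ∃ (G ∖∖ A) → K A y
      align (a , a∈) with x a ≟B y a
      ... | yes xa≡ya = use k λ e∈ → sym (⊻-spread {x = x} const a∈ e∈ xa≡ya)
      ... | no xa≢ya = use (K-not k) λ {e} e∈ → ¬-not λ ye≡xe → xa≢ya (⊻-spread {x = x} const e∈ a∈ (sym ye≡xe))

    -- z is moved towards x by eliminating, one at a time, the elements that separate them.
    approach : {F H : Subset n} {x z : Signs n} → K F x → K H z → F ⊑ H → ∃ (H ∖∖ F) →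
      ∃ λ H′ → K H′ x × F ⊑ H′ × ∃ (H′ ∖∖ F) × (∀ {j} → j ∉ H → z j ≡ x j → j ∉ H′)
    approach {F} {x = x} k h F⊑H w = go (allFin n) h F⊑H w λ _ _ → ∈-allFin _
      where
      go : (ss : List (Fin n)) {H : Subset n} {z : Signs n} → K H z → F ⊑ H → ∃ (H ∖∖ F) →
        (∀ {j} → j ∉ H → z j ≢ x j → j ∈ₗ ss) →
        ∃ λ H′ → K H′ x × F ⊑ H′ × ∃ (H′ ∖∖ F) × (∀ {j} → j ∉ H → z j ≡ x j → j ∉ H′)
      go [] {H} {z} h F⊑H w separators = H , K-ext h same , F⊑H , w , λ j∉H _ → j∉H
        where
        same : ∀ {e} → e ∉ H → x e ≡ z e
        same {e} e∉H with z e ≟B x e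
        ... | yes z≡x = sym z≡x
        ... | no z≢x with separators e∉H z≢x
        ...   | ()
      go (s ∷ ss) {H} {z} h F⊑H w separators with ∈⊎∉ s H | z s ≟B x s
      ... | inj₁ s∈H | _ = go ss h F⊑H w λ j∉H z≢x → others j∉H (separators j∉H z≢x)
        where
        others : ∀ {j} → j ∉ H → j ∈ₗ (s ∷ ss) → j ∈ₗ ss
        others j∉H (here refl) = clash s∈H j∉H
        others _ (there j∈) = j∈
      ... | _ | yes zs≡xs = go ss h F⊑H w λ j∉H z≢x → others z≢x (separators j∉H z≢x)
        where
        others : ∀ {j} → z j ≢ x j → j ∈ₗ (s ∷ ss) → j ∈ₗ ss
        others z≢x (here refl) = ⊥-elim (z≢x zs≡xs)
        others _ (there j∈) = j∈
      ... | inj₂ s∉H | no zs≢xs with K-elim F⊑H k h s∉H (zs≢xs ∘ sym)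
      ...   | H₂ , z₂ , h₂ , s∈H₂ , F⊑H₂ , keep
        with go ss h₂ F⊑H₂ (s , s∈H₂ , ∉-⊑ F⊑H s∉H) separators₂
        where
        separators₂ : ∀ {j} → j ∉ H₂ → z₂ j ≢ x j → j ∈ₗ ss
        separators₂ {j} j∉H₂ z₂≢x with ∈⊎∉ j H | z j ≟B x j
        ... | inj₁ j∈H | _ = ⊥-elim (z₂≢x (proj₂ (keep (∉-⊑ F⊑H₂ j∉H₂) (inj₁ j∈H))))
        ... | _ | yes z≡x = ⊥-elim (z₂≢x (proj₂ (keep (∉-⊑ F⊑H₂ j∉H₂) (inj₂ (sym z≡x)))))
        ... | inj₂ j∉H | no z≢x with separators j∉H z≢x
        ...   | here refl = clash s∈H₂ j∉H₂
        ...   | there j∈ = j∈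
      ...     | H′ , k′ , F⊑H′ , w′ , keep′ = H′ , k′ , F⊑H′ , w′ , λ j∉H z≡x →
                let j∉H₂ , z₂≡x = keep (∉-⊑ F⊑H j∉H) (inj₂ (sym z≡x)) in keep′ j∉H₂ z₂≡x

    -- The induction is on the size of `H`, which is `coSize (∁ H)`. If `H` is not `F ⊔ e`, let `g`
    -- be an element of `H` off `F ⊔ e`. A covector over `F ⊔ e` with the sign of `x` at `g` is
    -- composed behind the face `H` and moved towards `x`. Agreement at `g` and off `H` is kept on
    -- the way, so the new face of `x` has a zero set inside `H` that avoids `g`.
    face-cover : {F H : Subset n} {x : Signs n} → K F x → K H x → F ⊑ H → ∃ (H ∖∖ F) → ∃ λ G → F ⋖ G × K G x
    face-cover {F} {x = x} k = go _ _ ≤-refl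
      where
      go : (m : ℕ) (H : Subset n) → coSize (∁ H) < m → K H x → F ⊑ H → ∃ (H ∖∖ F) → ∃ λ G → F ⋖ G × K G x
      go (suc m) H (s≤s H≤m) h F⊑H (e , e∈H , e∉F) with H ⊑? (F ⊔ e)
      ... | inj₁ H⊑G = F ⊔ e , F⋖G , subst (λ H → K H x) (⊑-antisym H⊑G (⊔-min (K-flat h) F⊑H e∈H)) h
        where F⋖G = ⊔-⋖ (K-flat k) e∉F
      ... | inj₂ (g , g∈H , g∉G) = down
          (approach k (K-comp (⊔-min (K-flat h) F⊑H e∈H) h (proj₁ (proj₂ chosen))) ⊔-⊒ (e , ⊔-∈ , e∉F))
        where
        chosen : ∃ λ w → K (F ⊔ e) w × w g ≡ x g
        chosen with K-exists (⊔-flat {F} {e})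
        ... | w , l with w g ≟B x g
        ...   | yes wg≡xg = w , l , wg≡xg
        ...   | no wg≢xg = not ∘ w , K-not l , sym (¬-not (wg≢xg ∘ sym))
        W = splice H (proj₁ chosen) x
        down : (∃ λ H′ → K H′ x × F ⊑ H′ × ∃ (H′ ∖∖ F) × (∀ {j} → j ∉ (F ⊔ e) → W j ≡ x j → j ∉ H′)) → ∃ λ G → F ⋖ G × K G x
        down (H′ , h′ , F⊑H′ , w , keep) = go m H′ (<-≤-trans (coSize-strict _ _ ∁H⊑∁H′ (g , ∁-in g∉H′ , ∁-out g∈H)) H≤m) h′ F⊑H′ w
          where
          g∉H′ : g ∉ H′
          g∉H′ = keep g∉G (trans (splice-in g∈H) (proj₂ (proj₂ chosen)))
          shrink : ∀ {j} → j ∊ ∁ H → j ∊ ∁ H′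
          shrink {j} j∈ with ∈⊎∉ j H
          ... | inj₁ j∈H = clash j∈ (∁-out j∈H)
          ... | inj₂ j∉H = ∁-in (keep (∉-⊑ (⊔-min (K-flat h) F⊑H e∈H) j∉H) (splice-out j∉H))
          ∁H⊑∁H′ : ∁ H ⊑ ∁ H′
          ∁H⊑∁H′ = incl shrink

    flag-above : {F : Subset n} {x : Signs n} → K F x → ∃ λ Gs → Path F Gs E × Flag x F Gs
    flag-above {F} {x} = flat-induction {P} go F
      where
      P : Subset n → Set
      P F = K F x → ∃ λ Gs → Path F Gs E × Flag x F Gs
      go : ∀ F → (∀ G → F ⊑ G → ∃ (G ∖∖ F) → P G) → P F
      go F rec k with E ⊑? F
      ... | inj₁ E⊑F = [] , subst (Path F []) (⊑-antisym ⊑-full E⊑F) [] , tt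
      ... | inj₂ w with face-cover k K-E ⊑-full w
      ...   | G , F⋖G , g with rec G (⋖-⊑ F⋖G) (⋖-witness F⋖G) g
      ...     | Gs , p , flag = G ∷ Gs , F⋖G ∷ p , k , flag

    module Diamond {A H : Subset n} {x : Signs n} (kA : K A x) (kH : K H x) where

      -- The composition of `x` over `H`, the opposite of `x` over `G`, and `x` over `A`: the tope
      -- next to the ray opposite to `G`, with signs changed on `H ∖ G` only.
      reflected : {G : Subset n} → A ⋖ G → G ⋖ H → K G x → K A (splice G x (splice H (not ∘ x) x))
      reflected A⋖G G⋖H kG = K-comp (⋖-⊑ A⋖G) (K-comp (⋖-⊑ G⋖H) kH (K-not kG)) kA

      -- `x` and its reflection agree on `G ∖ A` and off `H`. Eliminating at an element of `H ∖ G`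
      -- and moving the result towards `x` gives a face of `x` whose zero set lies in `H`, exceeds
      -- `A` and avoids `G ∖ A`; in rank two this is a second cover of `A`.
      another : {G : Subset n} → A ⋖ G → G ⋖ H → K G x → ∃ λ G′ → G′ ≢ G × A ⋖ G′ × G′ ⋖ H × K G′ x
      another {G} A⋖G G⋖H kG with ⋖-witness G⋖H | ⋖-witness A⋖G
      ... | e , e∈H , e∉G | g , g∈G , g∉A
        with K-elim ⊑-refl kA (reflected A⋖G G⋖H kG) e∉A (λ same → not-≢ (trans (splice-out e∉G) (splice-in e∈H)) (sym same))
        where e∉A = ∉-⊑ (⋖-⊑ A⋖G) e∉G
      ... | H₂ , z , h₂ , e∈H₂ , A⊑H₂ , keep with approach kA h₂ A⊑H₂ (e , e∈H₂ , ∉-⊑ (⋖-⊑ A⋖G) e∉G)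
      ...   | H′ , h′ , A⊑H′ , (f , f∈H′ , f∉A) , keep′ =
              A ⊔ f , G₁≢G , A⋖G₁ , G₁⋖H , subst (λ F → K F x) H′≡G₁ h′
        where
        avoid : ∀ {j} → j ∉ A → x j ≡ splice G x (splice H (not ∘ x) x) j → j ∉ H′
        avoid j∉A same = let j∉H₂ , z≡x = keep j∉A (inj₂ same) in keep′ j∉H₂ z≡x
        G-avoids : ∀ {j} → (G ∖∖ A) j → j ∉ H′
        G-avoids (j∈G , j∉A) = avoid j∉A (sym (splice-in j∈G))
        H′⊑H : H′ ⊑ H
        H′⊑H = incl into
          where
          into : ∀ {j} → j ∊ H′ → j ∊ H
          into {j} j∈H′ with ∈⊎∉ j H
          ... | inj₁ j∈H = j∈H
          ... | inj₂ j∉H = clash j∈H′ (avoid (∉-⊑ (⊑-trans (⋖-⊑ A⋖G) (⋖-⊑ G⋖H)) j∉H)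
                (sym (trans (splice-out (∉-⊑ (⋖-⊑ G⋖H) j∉H)) (splice-out j∉H))))
        A⋖G₁ : A ⋖ A ⊔ f
        A⋖G₁ = ⊔-⋖ (⋖-flatˡ A⋖G) f∉A
        G₁⊑H′ : (A ⊔ f) ⊑ H′
        G₁⊑H′ = ⊔-min (K-flat h′) A⊑H′ f∈H′
        G₁≢G : A ⊔ f ≢ G
        G₁≢G G₁≡G = clash f∈H′ (G-avoids (subst (f ∊_) G₁≡G ⊔-∈ , f∉A))
        G₁⋖H : A ⊔ f ⋖ H
        G₁⋖H = ⋖-diamond A⋖G G⋖H A⋖G₁ (⊑-trans G₁⊑H′ H′⊑H) G₁≢G
        H′≡G₁ : H′ ≡ A ⊔ f
        H′≡G₁ with H′ ⊑? (A ⊔ f)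
        ... | inj₁ H′⊑G₁ = ⊑-antisym H′⊑G₁ G₁⊑H′
        ... | inj₂ (j , j∈) = clash (subst (g ∊_) (sym (⋖-between G₁⋖H (K-flat h′) G₁⊑H′ H′⊑H j∈)) (at (⋖-⊑ G⋖H) g∈G))
                                (G-avoids (g∈G , g∉A))

      -- Crossing `G₀` and reflecting at `G₁` both change the sign at `a` in `G₀` and keep it at `b`
      -- in `G₁`, but they differ at `e` in `G₂`. Eliminating `e` gives a covector over `G₂` that
      -- agrees with `x` at `b` and not at `a`, against the rigidity of `G₂ ⋖ H`.
      at-most-two : {G₀ G₁ G₂ : Subset n} → A ⋖ G₀ → G₀ ⋖ H → K G₀ x → A ⋖ G₁ → G₁ ⋖ H → K G₁ x → A ⋖ G₂ → G₂ ⋖ H → K G₂ x →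
        G₀ ≢ G₁ → G₀ ≢ G₂ → G₁ ≢ G₂ → ⊥
      at-most-two {G₀} {G₁} {G₂} A⋖G₀ G₀⋖H k₀ A⋖G₁ G₁⋖H k₁ A⋖G₂ G₂⋖H k₂ 0≢1 0≢2 1≢2
        with ⋖-witness A⋖G₀ | ⋖-witness A⋖G₁ | ⋖-witness A⋖G₂
      ... | a , a∈ | b , b∈ | e , e∈
        with K-elim ⊑-refl (K-comp (⋖-⊑ A⋖G₀) k₀ (K-not kA)) (reflected A⋖G₁ G₁⋖H k₁) (proj₂ e∈)
               (λ same → not-≢ (trans (sym (splice-out e∉G₀)) (trans same (trans (splice-out e∉G₁) (splice-in e∈H)))) refl)
        where
        e∉G₀ = ⋖-disjoint A⋖G₂ A⋖G₀ (0≢2 ∘ sym) e∈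
        e∉G₁ = ⋖-disjoint A⋖G₂ A⋖G₁ (1≢2 ∘ sym) e∈
        e∈H = at (⋖-⊑ G₂⋖H) (proj₁ e∈)
      ... | H′ , z , h′ , e∈H′ , A⊑H′ , keep = not-≢ za≡ (sym xa≡za)
        where
        a∉G₁ = ⋖-disjoint A⋖G₀ A⋖G₁ 0≢1 a∈
        b∉G₀ = ⋖-disjoint A⋖G₁ A⋖G₀ (0≢1 ∘ sym) b∈
        a∈H = at (⋖-⊑ G₀⋖H) (proj₁ a∈)
        b∈H = at (⋖-⊑ G₁⋖H) (proj₁ b∈)
        keep-a = keep (proj₂ a∈) (inj₂ (trans (splice-in (proj₁ a∈)) (sym (trans (splice-out a∉G₁) (splice-in a∈H)))))
        keep-b = keep (proj₂ b∈) (inj₂ (trans (splice-out b∉G₀) (sym (splice-in (proj₁ b∈)))))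
        za≡ : z a ≡ not (x a)
        za≡ = trans (proj₂ keep-a) (splice-in (proj₁ a∈))
        zb≡ : z b ≡ x b
        zb≡ = trans (proj₂ keep-b) (splice-out b∉G₀)
        H′⊑H : H′ ⊑ H
        H′⊑H = incl into
          where
          into : ∀ {j} → j ∊ H′ → j ∊ H
          into {j} j∈H′ with ∈⊎∉ j H
          ... | inj₁ j∈H = j∈H
          ... | inj₂ j∉H = clash j∈H′ (proj₁ (keep (∉-⊑ (⊑-trans (⋖-⊑ A⋖G₀) (⋖-⊑ G₀⋖H)) j∉H)
                (inj₂ (trans (splice-out (∉-⊑ (⋖-⊑ G₀⋖H) j∉H))
                  (sym (trans (splice-out (∉-⊑ (⋖-⊑ G₁⋖H) j∉H)) (splice-out j∉H)))))))
        G₂⊑H′ : G₂ ⊑ H′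
        G₂⊑H′ = ⋖-min A⋖G₂ e∈ (K-flat h′) A⊑H′ e∈H′
        H′≡G₂ : H′ ≡ G₂
        H′≡G₂ with H′ ⊑? G₂
        ... | inj₁ H′⊑G₂ = ⊑-antisym H′⊑G₂ G₂⊑H′
        ... | inj₂ (j , j∈) = clash (subst (a ∊_) (sym (⋖-between G₂⋖H (K-flat h′) G₂⊑H′ H′⊑H j∈)) a∈H) (proj₁ keep-a)
        xa≡za : x a ≡ z a
        xa≡za = K-rigid G₂⋖H k₂ (subst (λ F → K F z) H′≡G₂ h′) kH
          (b∈H , ⋖-disjoint A⋖G₁ A⋖G₂ 1≢2 b∈) (a∈H , ⋖-disjoint A⋖G₀ A⋖G₂ 0≢2 a∈) (sym zb≡)

-- The real phase structure of an orientation

ʳ++-cancelˡ : {X : Set} (pre : List X) {xs ys : List X} → pre ʳ++ xs ≡ pre ʳ++ ys → xs ≡ ys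
ʳ++-cancelˡ [] same = same
ʳ++-cancelˡ (p ∷ pre) same = ∷-injectiveʳ (ʳ++-cancelˡ pre same)

true-iff : {a b : Bool} → (a ≡ true → b ≡ true) → (b ≡ true → a ≡ true) → a ≡ b
true-iff {true} f _ = sym (f refl)
true-iff {false} {true} _ g = g refl
true-iff {false} {false} _ _ = refl

module PhasesOfOrientation {n : ℕ} (M : Matroid n) (𝓜 : OrientedMatroid n) (orients : IsOrientationOf 𝓜 M) where
  open Flats M
  open Facets M
  open Blocks M
  open Orientations M
  open Covectors 𝓜 orients public

  private
    L E : Subset n
    L = loops M
    E = fullSet

  signOf-cv : (ε : Vec Bool n) → signOf M 𝓜 ε ≡ cv L (lookup ε)
  signOf-cv ε = ≡-cv (λ {e} e∈L → trans (lookup-zipWith _ e L ε) (cong (λ l → if l then 0s else sgn (lookup ε e)) (holds e∈L)))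
    λ {e} e∉L → trans (lookup-zipWith _ e L ε) (cong (λ l → if l then 0s else sgn (lookup ε e)) (fails e∉L))

  restrictZero-cv : {F : Subset n} (x : Signs n) → L ⊑ F → restrictZero (cv L x) (F ∖ L) ≡ cv F x
  restrictZero-cv {F} x L⊑F = ≡-cv on off
    where
    X = cv L x
    entry : ∀ e → lookup (restrictZero X (F ∖ L)) e ≡ (if lookup (F ∖ L) e then 0s else lookup X e)
    entry e = lookup-zipWith (λ s b → if b then 0s else s) e X (F ∖ L)
    on : ∀ {e} → e ∊ F → lookup (restrictZero X (F ∖ L)) e ≡ 0s
    on {e} e∈F with ∈⊎∉ e L
    ... | inj₁ e∈L = trans (entry e) (trans (cong (λ b → if b then 0s else lookup X e) (fails (∉-∖⁺ {A = F} {L} (inj₂ e∈L)))) (cv-in e∈L))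
    ... | inj₂ e∉L = trans (entry e) (cong (λ b → if b then 0s else lookup X e) (holds (∈-∖⁺ (e∈F , e∉L))))
    off : ∀ {e} → e ∉ F → lookup (restrictZero X (F ∖ L)) e ≡ sgn (x e)
    off {e} e∉F = trans (entry e) (trans (cong (λ b → if b then 0s else lookup X e) (fails (∉-∖⁺ {A = F} {L} (inj₁ e∉F))))
      (cv-out (∉-⊑ L⊑F e∉F)))

  vanishes-on-loops : {X : SignVec n} {e : Fin n} → IsCov 𝓜 X → e ∊ L → lookup X e ≡ 0s
  vanishes-on-loops X-cov e∈L = ∈-zeroSet (at (loops-min (K-flat (K-of X-cov))) e∈L)

  covDel⇒cov : {Y : SignVec n} → IsCovDel M 𝓜 Y → IsCov 𝓜 Y
  covDel⇒cov {Y} (Y-zero , X , X-cov , Y≡X) = subst (IsCov 𝓜) (lookup-ext same) X-cov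
    where
    same : ∀ e → lookup X e ≡ lookup Y e
    same e with ∈⊎∉ e L
    ... | inj₁ e∈L = trans (vanishes-on-loops X-cov e∈L) (sym (Y-zero e (holds e∈L)))
    ... | inj₂ e∉L = sym (Y≡X e (fails e∉L))

  cov⇒covDel : {Y : SignVec n} → IsCov 𝓜 Y → IsCovDel M 𝓜 Y
  cov⇒covDel {Y} Y-cov = (λ e e∈L → vanishes-on-loops Y-cov (mem e∈L)) , Y , Y-cov , λ _ _ → refl

  tope : {x : Signs n} → K L x → IsTopeDel M 𝓜 (cv L x)
  tope {x} k = cov⇒covDel k , maximal
    where
    maximal : ∀ Z → IsCovDel M 𝓜 Z → cv L x ≤V Z → Z ≡ cv L x
    maximal Z (Z-zero , _) T≤Z = ≡-cv (λ {e} e∈L → Z-zero e (holds e∈L))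
      λ {e} e∉L → sgn-≤S (x e) (subst (_≤S lookup Z e) (cv-out e∉L) (T≤Z e))

  flag⇒ℰ : {Gs : List (Subset n)} {ε : Vec Bool n} → Path L Gs E → Flag (lookup ε) L Gs → ℰ M 𝓜 (dropLast Gs) ε
  flag⇒ℰ {Gs} {ε} p flag = subst (InTopesOfChain M 𝓜 (dropLast Gs)) (sym (signOf-cv ε))
      (tope (flag-first p flag) , All.tabulate λ F∈ → cov⇒covDel (face F∈))
    where
    flags = along⇒flags {λ F → K F (lookup ε)} K-E p flag
    above-loops : ∀ {F} → F ∈ₗ (L ∷ dropLast Gs) → L ⊑ F
    above-loops F∈ = loops-min (along⇒flags (flat-E M) p (flags⇒along {IsFlat M} p λ F∈ → K-flat (flags F∈)) F∈)
    face : ∀ {F} → F ∈ₗ (L ∷ dropLast Gs ++ [ E ]) → IsCov 𝓜 (restrictZero (cv L (lookup ε)) (F ∖ L))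
    face F∈ with ∈-++⁻ (L ∷ dropLast Gs) F∈
    ... | inj₁ F∈′ = subst (IsCov 𝓜) (sym (restrictZero-cv (lookup ε) (above-loops F∈′))) (flags F∈′)
    ... | inj₂ (here refl) = subst (IsCov 𝓜) (sym (restrictZero-cv (lookup ε) ⊑-full)) K-E

  ℰ⇒flag : {Gs : List (Subset n)} {ε : Vec Bool n} → Path L Gs E → ℰ M 𝓜 (dropLast Gs) ε → Flag (lookup ε) L Gs
  ℰ⇒flag {Gs} {ε} p chain = flags⇒along p λ {F} F∈ →
      subst (IsCov 𝓜) (restrictZero-cv (lookup ε) (above-loops F∈))
        (covDel⇒cov (All.lookup (proj₂ (subst (InTopesOfChain M 𝓜 (dropLast Gs)) (signOf-cv ε) chain)) (∈-++⁺ˡ {xs = L ∷ dropLast Gs} F∈)))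
    where
    above-loops : ∀ {F} → F ∈ₗ (L ∷ dropLast Gs) → L ⊑ F
    above-loops (here refl) = ⊑-refl
    above-loops (there F∈) = proj₁ (proj₁ (proj₂ (path-between p F∈)))

  -- A Boolean form of `ℰ`: the loops test the tope itself, the flats of `C` its faces, and the face
  -- over the ground set is the zero covector. A covector that is nonzero off the loops is
  -- automatically maximal, see `tope`.
  phaseᵇ : List (Subset n) → Vec Bool n → Bool
  phaseᵇ C ε = all (λ F → cov 𝓜 (cv F (lookup ε))) (L ∷ C)

  module _ {Gs : List (Subset n)} {ε : Vec Bool n} (p : Path L Gs E) where

    phase⇒flag : phaseᵇ (dropLast Gs) ε ≡ true → Flag (lookup ε) L Gs
    phase⇒flag ph = flags⇒along p (all⇒∀ (λ F → cov 𝓜 (cv F (lookup ε))) {L ∷ dropLast Gs} ph)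

    flag⇒phase : Flag (lookup ε) L Gs → phaseᵇ (dropLast Gs) ε ≡ true
    flag⇒phase flag = ∀⇒all (λ F → cov 𝓜 (cv F (lookup ε))) {L ∷ dropLast Gs} (along⇒flags {λ F → K F (lookup ε)} K-E p flag)

  affine : (C : List (Subset n)) → IsFacet M C → AffineWithDirection M (phaseᵇ C) (TZ2 M C)
  affine C facet with facet⇒path {C} facet
  ... | Gs , p , refl with flag-exists p
  ...   | x₀ , flag₀ = a , toVec-zero x₀ , λ x x-zero →
            (λ ph → Directions.TZ2⇐ M p (⊕-zero {x} {a} x-zero (toVec-zero x₀))
              (Along-map {Q = Constant (lookup x ⊻ lookup a)} (λ c → constant λ {s} {t} s∈ t∈ → trans (lookup-⊕ x a s) (trans (level c s∈ t∈) (sym (lookup-⊕ x a t)))) Gs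
                (flag-difference p (phase⇒flag {ε = x} p ph) flag-a))) ,
            λ tz → flag⇒phase {ε = x} p (flag-translate p flag-a
              (Along-map {Q = Constant (lookup (_⊕_ M x a))} (λ c → ⊻-sym {x = lookup x} (constant λ {s} {t} s∈ t∈ →
                trans (sym (lookup-⊕ x a s)) (trans (level c s∈ t∈) (lookup-⊕ x a t)))) Gs (Directions.TZ2⇒constant M p tz)))
    where
    a = toVec x₀
    flag-a : Flag (lookup a) L Gs
    flag-a = flag-ext p (λ e∉L → lookup-toVec {x₀} e∉L) flag₀

  module _ (gap : Gap) (ε : Vec Bool n) where
    open Gap gap hiding (G; A⋖G; G⋖H)

    Property : List (Subset n) → Set
    Property C = containsᵇ M ridge C ∧ phaseᵇ C ε ≡ true

    record Filling (C : List (Subset n)) : Set where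
      field
        G : Subset n
        A⋖G : A ⋖ G
        G⋖H : G ⋖ H
        filling : C ≡ dropLast (filled G)
        flag : Flag (lookup ε) L (filled G)

      kA : K A (lookup ε)
      kA = proj₁ (along-project below flag)
      kG : K G (lookup ε)
      kG = proj₁ (proj₂ (along-project below flag))
      kH : K H (lookup ε)
      kH = flag-first above (proj₂ (proj₂ (along-project below flag)))

    decode : {C : List (Subset n)} → C ∈ₗ facets M → Property C → Filling C
    decode {C} C∈ both = fill (contains⇒filled gap {C} (facets-IsFacet C∈) (∧-conicalˡ _ (phaseᵇ C ε) both))
      where
      fill : (∃ λ G → A ⋖ G × G ⋖ H × C ≡ dropLast (filled G)) → Filling C
      fill (G , A⋖G , G⋖H , C≡) = record
        { G = G ; A⋖G = A⋖G ; G⋖H = G⋖H ; filling = C≡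
        ; flag = phase⇒flag {ε = ε} (filled-path A⋖G G⋖H)
            (subst (λ C → phaseᵇ C ε ≡ true) C≡ (∧-conicalʳ (containsᵇ M ridge C) _ both)) }

    encode : {G : Subset n} → A ⋖ G → G ⋖ H → Flag (lookup ε) L (filled G) →
      dropLast (filled G) ∈ₗ facets M × Property (dropLast (filled G))
    encode {G} A⋖G G⋖H flag = ∈-facets {dropLast (filled G)} (path⇒facet (filled-path A⋖G G⋖H)) ,
      ∧-true (filled-contains gap {G}) (flag⇒phase {ε = ε} (filled-path A⋖G G⋖H) flag)

    filled-injective : {G G′ : Subset n} → dropLast (filled G) ≡ dropLast (filled G′) → G ≡ G′
    filled-injective same = ∷-injectiveˡ (ʳ++-cancelˡ pre (trans (sym (dropLast-ʳ++ pre)) (trans same (dropLast-ʳ++ pre))))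

    Partner : List (Subset n) → Set
    Partner C = ∃ λ D → D ≢ C × D ∈ₗ facets M × Property D × (∀ {B} → B ∈ₗ facets M → Property B → B ≡ C ⊎ B ≡ D)

    partner : {C : List (Subset n)} → Filling C → Partner C
    partner {C} f₀ = across (Diamond.another kA kH A⋖G G⋖H kG)
      where
      open Filling f₀
      across : (∃ λ G′ → G′ ≢ G × A ⋖ G′ × G′ ⋖ H × K G′ (lookup ε)) → Partner C
      across (G₁ , G₁≢G , A⋖G₁ , G₁⋖H , k₁) = dropLast (filled G₁) ,
          (λ same → G₁≢G (filled-injective (trans same filling))) , proj₁ coded , proj₂ coded , λ B∈ both → only (decode B∈ both)
        where
        coded = encode A⋖G₁ G₁⋖H (along-replace below flag (kA , k₁ , proj₂ (proj₂ (along-project below flag))))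
        only : {B : List (Subset n)} → Filling B → B ≡ C ⊎ B ≡ dropLast (filled G₁)
        only f₂ = compare (≡⊎≢ G F₂.G) (≡⊎≢ G₁ F₂.G)
          where
          module F₂ = Filling f₂
          compare : G ≡ F₂.G ⊎ G ≢ F₂.G → G₁ ≡ F₂.G ⊎ G₁ ≢ F₂.G → _
          compare (inj₁ 0≡2) _ = inj₁ (trans F₂.filling (trans (cong (dropLast ∘ filled) (sym 0≡2)) (sym filling)))
          compare _ (inj₁ 1≡2) = inj₂ (trans F₂.filling (cong (dropLast ∘ filled) (sym 1≡2)))
          compare (inj₂ 0≢2) (inj₂ 1≢2) = ⊥-elim (Diamond.at-most-two kA kH A⋖G G⋖H kG A⋖G₁ G₁⋖H k₁
            F₂.A⋖G F₂.G⋖H F₂.kG (G₁≢G ∘ sym) 0≢2 1≢2)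

    even-ridge : count M (λ C → containsᵇ M ridge C ∧ phaseᵇ C ε) (facets M) % 2 ≡ 0
    even-ridge = paired⇒even (λ C → containsᵇ M ridge C ∧ phaseᵇ C ε) Unique-facets λ C∈ both → partner (decode C∈ both)

  even : (Γ : List (Subset n)) → IsCodimOne M Γ → ∀ ε → ZeroOnL M ε →
    count M (λ C → containsᵇ M Γ C ∧ phaseᵇ C ε) (facets M) % 2 ≡ 0
  even Γ codim ε _ = at-ridge (codim⇒gap codim)
    where
    at-ridge : Σ Gap (λ gap → Γ ≡ Gap.ridge gap) → count M (λ C → containsᵇ M Γ C ∧ phaseᵇ C ε) (facets M) % 2 ≡ 0
    at-ridge (gap , refl) = even-ridge gap ε

  phases : RealPhaseStructure M
  phases = record { phase = phaseᵇ ; phase-affine = affine ; phase-even = even }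

  phases-represent : Represents M phases 𝓜
  phases-represent C facet ε _ = along (facet⇒path {C} facet)
    where
    along : (∃ λ Gs → Path L Gs E × C ≡ dropLast Gs) → (phaseᵇ C ε ≡ true → ℰ M 𝓜 C ε) × (ℰ M 𝓜 C ε → phaseᵇ C ε ≡ true)
    along (Gs , p , refl) = (λ ph → flag⇒ℰ {ε = ε} p (phase⇒flag {ε = ε} p ph)) , (λ e → flag⇒phase {ε = ε} p (ℰ⇒flag {ε = ε} p e))

-- The orientation of a real phase structure

module OrientationOfPhases {n : ℕ} (M : Matroid n) (P : RealPhaseStructure M) where
  open Flats M
  open Facets M
  open Blocks M
  open Orientations M
  open Phases P
  open Systems M
  open Topes phase-system

  private
    L E : Subset n
    L = loops M
    E = fullSet

  Consistent : Signs n → Subset n → List (Subset n) → Set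
  Consistent x = Along (λ F G → R F G x)

  consistent⇒T : {x : Signs n} {A B : Subset n} {Gs : List (Subset n)} → Path A Gs B → Consistent x A Gs → T x A B
  consistent⇒T [] _ = done
  consistent⇒T (A⋖G ∷ p) (r , rs) = step A⋖G r (consistent⇒T p rs)

  T⇒consistent : {x : Signs n} {A B : Subset n} → T x A B → ∃ λ Gs → Path A Gs B × Consistent x A Gs
  T⇒consistent done = [] , [] , tt
  T⇒consistent (step A⋖G r t) with T⇒consistent t
  ... | Gs , p , rs = _ ∷ Gs , A⋖G ∷ p , r , rs

  consistent-++ : {x : Signs n} {A B : Subset n} {Gs Hs : List (Subset n)} → Path A Gs B → Consistent x A Gs → Consistent x B Hs →
    Consistent x A (Gs ++ Hs)
  consistent-++ [] _ rs = rs
  consistent-++ (_ ∷ p) (r , rs) rs′ = r , consistent-++ p rs rs′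

  consistent-at : {x : Signs n} {A F : Subset n} {Gs : List (Subset n)} → IsFlat M A → Path A Gs E → Consistent x A Gs → F ∈ₗ (A ∷ Gs) →
    IsFlat M F × T x F E
  consistent-at A-flat p rs (here refl) = A-flat , consistent⇒T p rs
  consistent-at A-flat (A⋖G ∷ p) (_ , rs) (there F∈) = consistent-at (⋖-flat A⋖G) p rs F∈

  consistent⇒topes : {x : Signs n} {A : Subset n} {Gs : List (Subset n)} → Path A Gs E → Consistent x A Gs → Along (λ F _ → T x F E) A Gs
  consistent⇒topes [] _ = tt
  consistent⇒topes (A⋖G ∷ p) (r , rs) = consistent⇒T (A⋖G ∷ p) (r , rs) , consistent⇒topes p rs

  -- The topes over the successive flats may be witnessed by unrelated chains; `T-R` makes each of
  -- them compatible with the covers of the given chain.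
  topes⇒consistent : {x : Signs n} {A : Subset n} {Gs : List (Subset n)} → Path A Gs E → Along (λ F _ → T x F E) A Gs → Consistent x A Gs
  topes⇒consistent [] _ = tt
  topes⇒consistent (A⋖G ∷ p) (t , ts) = T-R A⋖G ⊑-full t , topes⇒consistent p ts

  path-end : {A B : Subset n} {Gs : List (Subset n)} → Path A Gs B → B ∈ₗ (A ∷ Gs)
  path-end [] = here refl
  path-end (A⋖G ∷ p) = there (path-end p)

  faceᵇ : SignVec n → Vec Bool n → Subset n → Bool
  faceᵇ X ε F = (F =ᵇ zeroSet X) ∧ ((tabulate (negatives X) ∖ F) =ᵇ (ε ∖ F))

  throughᵇ : SignVec n → List (Subset n) → Vec Bool n → Bool
  throughᵇ X C ε = phase P C (toVec (lookup ε)) ∧ any (faceᵇ X ε) (L ∷ C ++ [ E ])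

  opaque
    -- Covectors must be given by a Boolean test, so the facet, the element of its phase and the
    -- flat to be set to zero are searched for in finite lists. By `cov⇒tope` and `tope⇒cov` the
    -- test accepts `X` exactly when its signs are a tope over the flat `zeroSet X`.
    covᵇ : SignVec n → Bool
    covᵇ X = any (λ C → any (throughᵇ X C) (allSubsets n)) (facets M)

    cov⇒through : {X : SignVec n} → covᵇ X ≡ true → ∃ λ C → C ∈ₗ facets M × any (throughᵇ X C) (allSubsets n) ≡ true
    cov⇒through {X} = any⇒∃ (λ C → any (throughᵇ X C) (allSubsets n)) {facets M}

    through⇒cov : {X : SignVec n} {C : List (Subset n)} → C ∈ₗ facets M → any (throughᵇ X C) (allSubsets n) ≡ true → covᵇ X ≡ true
    through⇒cov {X} = ∃⇒any (λ C → any (throughᵇ X C) (allSubsets n)) {facets M}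

  faceᵇ⇒ : {X : SignVec n} {ε : Vec Bool n} {F : Subset n} → faceᵇ X ε F ≡ true →
    F ≡ zeroSet X × (∀ {e} → e ∉ F → negatives X e ≡ lookup ε e)
  faceᵇ⇒ {X} {ε} {F} ok = =ᵇ⇒≡ F (zeroSet X) (∧-conicalˡ _ _ ok) , λ {e} e∉F →
      trans (sym (lookup∘tabulate (negatives X) e)) (trans (sym (kept (tabulate (negatives X)) e∉F))
        (trans (cong (λ S → lookup S e) same) (kept ε e∉F)))
    where
    same = =ᵇ⇒≡ (tabulate (negatives X) ∖ F) (ε ∖ F) (∧-conicalʳ (F =ᵇ zeroSet X) _ ok)
    kept : (S : Subset n) {e : Fin n} → e ∉ F → lookup (S ∖ F) e ≡ lookup S e
    kept S {e} e∉F = trans (lookup-∖ S F e) (trans (cong (λ b → lookup S e ∧ not b) (fails e∉F)) (∧-identityʳ _))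

  ⇒faceᵇ : {X : SignVec n} {ε : Vec Bool n} → (∀ {e} → e ∉ zeroSet X → negatives X e ≡ lookup ε e) → faceᵇ X ε (zeroSet X) ≡ true
  ⇒faceᵇ {X} {ε} same = ∧-true (=ᵇ-refl (zeroSet X))
    (subst (λ S → ((tabulate (negatives X) ∖ zeroSet X) =ᵇ S) ≡ true) (lookup-ext equal) (=ᵇ-refl (tabulate (negatives X) ∖ zeroSet X)))
    where
    F = zeroSet X
    equal : ∀ e → lookup (tabulate (negatives X) ∖ F) e ≡ lookup (ε ∖ F) e
    equal e with ∈⊎∉ e F
    ... | inj₁ e∈F = trans (fails (∉-∖⁺ {A = tabulate (negatives X)} {F} (inj₂ e∈F))) (sym (fails (∉-∖⁺ {A = ε} {F} (inj₂ e∈F))))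
    ... | inj₂ e∉F = trans (lookup-∖ (tabulate (negatives X)) F e)
          (trans (cong (_∧ not (lookup F e)) (trans (lookup∘tabulate (negatives X) e) (same e∉F))) (sym (lookup-∖ ε F e)))

  cov⇒tope : {X : SignVec n} → covᵇ X ≡ true → IsFlat M (zeroSet X) × T (negatives X) (zeroSet X) E
  cov⇒tope {X} ok = in-facet (cov⇒through {X} ok)
    where
    Result = IsFlat M (zeroSet X) × T (negatives X) (zeroSet X) E
    located : {Gs : List (Subset n)} {ε : Vec Bool n} {F : Subset n} → Path L Gs E → Consistent (lookup ε) L Gs →
      F ∈ₗ (L ∷ dropLast Gs) ⊎ F ∈ₗ [ E ] → IsFlat M F × T (lookup ε) F E
    located p rs (inj₁ (here refl)) = consistent-at loops-flat p rs (here refl)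
    located p rs (inj₁ (there F∈)) = consistent-at loops-flat p rs (there (∈-dropLast _ F∈))
    located p rs (inj₂ (here refl)) = flat-E M , done
    at-face : {ε : Vec Bool n} {F : Subset n} → IsFlat M F × T (lookup ε) F E →
      F ≡ zeroSet X × (∀ {e} → e ∉ F → negatives X e ≡ lookup ε e) → Result
    at-face (F-flat , t) (F≡ , same) =
      subst (λ F → IsFlat M F × T (negatives X) F E) F≡ (F-flat , T-ext t λ (_ , e∉F) → same e∉F)
    in-phase : {Gs : List (Subset n)} → Path L Gs E → (∃ λ ε → ε ∈ₗ allSubsets n × throughᵇ X (dropLast Gs) ε ≡ true) → Result
    in-phase {Gs} p (ε , _ , through) =
      let F , F∈ , face = any⇒∃ (faceᵇ X ε) {L ∷ dropLast Gs ++ [ E ]} (∧-conicalʳ (phase P (dropLast Gs) (toVec (lookup ε))) _ through)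
      in at-face {ε} (located {ε = ε} p (Φ⇒R [] p (∧-conicalˡ _ (any (faceᵇ X ε) (L ∷ dropLast Gs ++ [ E ])) through)) (∈-++⁻ (L ∷ dropLast Gs) F∈))
           (faceᵇ⇒ {X} {ε} face)
    in-facet : (∃ λ C → C ∈ₗ facets M × any (throughᵇ X C) (allSubsets n) ≡ true) → Result
    in-facet (C , C∈ , some) = along-path (facet⇒path {C} (facets-IsFacet C∈))
      where
      along-path : (∃ λ Gs → Path L Gs E × C ≡ dropLast Gs) → Result
      along-path (Gs , p , C≡) =
        in-phase p (any⇒∃ (throughᵇ X (dropLast Gs)) {allSubsets n} (subst (λ C → any (throughᵇ X C) (allSubsets n) ≡ true) C≡ some))

  -- A facet also needs flats below the zero set, so an arbitrary tope `w` between the loops and the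
  -- zero set is spliced in. The zero set ends the lower part of the chain and is therefore among
  -- the flats tested.
  tope⇒cov′ : {X : SignVec n} → IsFlat M (zeroSet X) → T (negatives X) (zeroSet X) E → covᵇ X ≡ true
  tope⇒cov′ {X} F-flat t with T-exists loops-flat F-flat (loops-min F-flat)
  ... | w , s with T⇒consistent (T-ext s λ {e} (e∈F , _) → trans (lookup∘tabulate y e) (splice-in e∈F))
                 | T⇒consistent (T-ext t λ {e} (_ , e∉F) → trans (lookup∘tabulate y e) (splice-out e∉F))
    where y = splice (zeroSet X) w (negatives X)
  ...   | Gs , p , rs | Hs , q , rs′ =
          through⇒cov {X} (∈-facets {dropLast (Gs ++ Hs)} (path⇒facet (Path-++ p q)))
            (∃⇒any (throughᵇ X (dropLast (Gs ++ Hs))) {allSubsets n} (∈-allSubsets ε)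
              (∧-true (R⇒Φ (Path-++ p q) (consistent-++ p rs rs′))
                (∃⇒any (faceᵇ X ε) {L ∷ dropLast (Gs ++ Hs) ++ [ E ]} (F∈ (path-end p))
                  (⇒faceᵇ {X} {ε} λ {e} e∉F → sym (trans (lookup∘tabulate _ e) (splice-out e∉F))))))
    where
    ε = tabulate (splice (zeroSet X) w (negatives X))
    F∈ : zeroSet X ∈ₗ (L ∷ Gs) → zeroSet X ∈ₗ (L ∷ dropLast (Gs ++ Hs) ++ [ E ])
    F∈ (here F≡L) = here F≡L
    F∈ (there F∈Gs) with path-last (Path-++ p q) (∈-++⁺ˡ F∈Gs)
    ... | inj₁ F∈′ = there (∈-++⁺ˡ F∈′)
    ... | inj₂ F≡E = ∈-++⁺ʳ (L ∷ dropLast (Gs ++ Hs)) (here F≡E)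

  tope⇒cov : {F : Subset n} {x : Signs n} → IsFlat M F → T x F E → covᵇ (cv F x) ≡ true
  tope⇒cov {F} {x} F-flat t = tope⇒cov′ {cv F x} (subst (IsFlat M) (sym (zeroSet-cv F x)) F-flat)
    (subst (λ H → T (negatives (cv F x)) H E) (sym (zeroSet-cv F x)) (T-ext t λ (_ , e∉F) → negatives-cv e∉F))

  -- `y` is first extended over `G` by an arbitrary `u` to a tope over `F ∩ G`, to which `T-compose`
  -- applies. The choice of `u` does not show, since an element of `F` off `F ∩ G` lies off `G`.
  T-∘ : {F G : Subset n} {x y : Signs n} → IsFlat M F → IsFlat M G → T x F E → T y G E → T (splice F y x) (F ∩ G) E
  T-∘ {F} {G} {x} {y} F-flat G-flat s t with T-exists (flat-∩ M F G F-flat G-flat) G-flat ∩-⊑ʳ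
  ... | u , r = T-ext (T-compose F-flat ∩-⊑ˡ (T-splice r t) s) same
    where
    same : ∀ {e} → (E ∖∖ (F ∩ G)) e → splice F y x e ≡ splice F (splice G u y) x e
    same {e} (_ , e∉) with ∈⊎∉ e F | ∈⊎∉ e G
    ... | inj₁ e∈F | inj₁ e∈G = clash (∈-∩⁺ e∈F e∈G) e∉
    ... | inj₁ e∈F | inj₂ e∉G = trans (splice-in e∈F) (sym (trans (splice-in e∈F) (splice-out e∉G)))
    ... | inj₂ e∉F | _ = trans (splice-out e∉F) (sym (splice-out e∉F))

  Eliminates : Fin n → SignVec n → SignVec n → Set
  Eliminates i X Y = Separates X Y i →
    Σ (SignVec n) (λ Z → covᵇ Z ≡ true × lookup Z i ≡ 0s × (∀ j → ¬ Separates X Y j → lookup Z j ≡ lookup (X ∘V Y) j))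

  -- The two compositions, in either order, have the common zero set `F ∩ G`. Off it they agree
  -- exactly at the coordinates that are not separated, so elimination for topes with this list `D`
  -- is elimination for covectors.
  eliminates : {F G : Subset n} {x y : Signs n} (i : Fin n) → IsFlat M F → IsFlat M G → T x F E → T y G E → Eliminates i (cv F x) (cv G y)
  eliminates {F} {G} {x} {y} i F-flat G-flat s t (nonzero , opposite) = cv (A ⊔ i) z , tope⇒cov ⊔-flat tope , cv-in ⊔-∈ , keep
    where
    A = F ∩ G
    x′ = splice F y x
    y′ = splice G x y
    i∉F : i ∉ F
    i∉F with ∈⊎∉ i F
    ... | inj₁ i∈F = ⊥-elim (nonzero (cv-in i∈F))
    ... | inj₂ i∉F = i∉F
    i∉G : i ∉ G
    i∉G with ∈⊎∉ i G
    ... | inj₁ i∈G = ⊥-elim (nonzero (trans opposite (cong negS (cv-in i∈G))))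
    ... | inj₂ i∉G = i∉G
    xi≢yi : x i ≢ y i
    xi≢yi xi≡yi = ¬Separates-cv {F = F} {G} {x} {y} (inj₂ (inj₂ xi≡yi)) (nonzero , opposite)
    agreed? = λ d → (lookup A d ≟B false) ×-dec (x′ d ≟B y′ d)
    D = filter agreed? (allFin n)
    D⁺ : ∀ {d} → d ∉ A → x′ d ≡ y′ d → d ∈ₗ D
    D⁺ {d} d∉A same = ∈-filter⁺ agreed? (∈-allFin d) (fails d∉A , same)
    D⁻ : ∀ {d} → d ∈ₗ D → d ∉ A × x′ d ≡ y′ d
    D⁻ d∈ with ∈-filter⁻ agreed? {xs = allFin n} d∈
    ... | _ , d∉A , same = nonmem d∉A , same
    ∩-comm : G ∩ F ≡ A
    ∩-comm = ⊑-antisym (incl λ e∈ → ∈-∩⁺ (at ∩-⊑ʳ e∈) (at ∩-⊑ˡ e∈)) (incl λ e∈ → ∈-∩⁺ (at ∩-⊑ʳ e∈) (at ∩-⊑ˡ e∈))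
    eliminant : Eliminant x′ A i D
    eliminant = eliminate record
      { A-flat = flat-∩ M F G F-flat G-flat
      ; x-tope = T-∘ F-flat G-flat s t
      ; y-tope = subst (λ H → T y′ H E) ∩-comm (T-∘ G-flat F-flat t s)
      ; i∉A = ∉-⊑ ∩-⊑ˡ i∉F
      ; xi≢yi = λ same → xi≢yi (trans (sym (splice-out i∉F)) (trans same (splice-out i∉G)))
      ; D∉A = proj₁ ∘ D⁻
      ; x≡y = proj₂ ∘ D⁻ }
    open Eliminant eliminant
    kept : ∀ {j} → j ∉ A → x′ j ≡ y′ j → lookup (cv (A ⊔ i) z) j ≡ sgn (x′ j)
    kept j∉A same = let j∈D = D⁺ j∉A same in trans (cv-out (off j∈D)) (cong sgn (agree j∈D))
    keep : ∀ j → ¬ Separates (cv F x) (cv G y) j → lookup (cv (A ⊔ i) z) j ≡ lookup (cv F x ∘V cv G y) j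
    keep j unseparated = cases (∈⊎∉ j F) (∈⊎∉ j G) (x j ≟B y j)
      where
      Kept = lookup (cv (A ⊔ i) z) j ≡ lookup (cv F x ∘V cv G y) j
      cases : j ∊ F ⊎ j ∉ F → j ∊ G ⊎ j ∉ G → Dec (x j ≡ y j) → Kept
      cases (inj₁ j∈F) (inj₁ j∈G) _ = trans (cv-in (at ⊔-⊒ (∈-∩⁺ j∈F j∈G))) (sym (∘V-zero j∈F j∈G))
      cases (inj₁ j∈F) (inj₂ j∉G) _ = trans (kept (∉-⊑ ∩-⊑ʳ j∉G) (trans (splice-in j∈F) (sym (splice-out j∉G))))
        (trans (cong sgn (splice-in j∈F)) (sym (∘V-right j∈F j∉G)))
      cases (inj₂ j∉F) (inj₁ j∈G) _ = trans (kept (∉-⊑ ∩-⊑ˡ j∉F) (trans (splice-out j∉F) (sym (splice-in j∈G))))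
        (trans (cong sgn (splice-out j∉F)) (sym (∘V-left j∉F)))
      cases (inj₂ j∉F) (inj₂ j∉G) (no xj≢yj) = ⊥-elim (unseparated (Separates-cv j∉F j∉G xj≢yj))
      cases (inj₂ j∉F) (inj₂ j∉G) (yes xj≡yj) =
        trans (kept (∉-⊑ ∩-⊑ˡ j∉F) (trans (splice-out j∉F) (trans xj≡yj (sym (splice-out j∉G)))))
          (trans (cong sgn (splice-out j∉F)) (sym (∘V-left j∉F)))

  orientation : OrientedMatroid n
  orientation = record
    { cov = covᵇ
    ; cov-zero = subst (λ X → covᵇ X ≡ true) (sym (zeroSV-cv (λ _ → true))) (tope⇒cov (flat-E M) done)
    ; cov-neg = λ X c → let F-flat , t = cov⇒tope {X} c in
        subst (λ Y → covᵇ Y ≡ true) (sym (trans (cong negV (cv-zeroSet X)) (negV-cv (zeroSet X) (negatives X)))) (tope⇒cov F-flat (T-not t))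
    ; cov-comp = λ X Y c d → let F-flat , s = cov⇒tope {X} c ; G-flat , t = cov⇒tope {Y} d in
        subst (λ Z → covᵇ Z ≡ true)
          (sym (trans (cong₂ _∘V_ (cv-zeroSet X) (cv-zeroSet Y)) (∘V-cv (zeroSet X) (zeroSet Y) (negatives X) (negatives Y))))
          (tope⇒cov (flat-∩ M (zeroSet X) (zeroSet Y) F-flat G-flat) (T-∘ F-flat G-flat s t))
    ; cov-elim = λ X Y c d i → let F-flat , s = cov⇒tope {X} c ; G-flat , t = cov⇒tope {Y} d in
        subst₂ (Eliminates i) (sym (cv-zeroSet X)) (sym (cv-zeroSet Y)) (eliminates i F-flat G-flat s t)
    }

  orients : IsOrientationOf orientation M
  orients F = flat⇒ , λ { (X , c , refl) → proj₁ (cov⇒tope {X} c) }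
    where
    flat⇒ : IsFlat M F → Σ (SignVec n) (λ X → covᵇ X ≡ true × F ≡ zeroSet X)
    flat⇒ F-flat with T-exists F-flat (flat-E M) ⊑-full
    ... | x , t = cv F x , tope⇒cov F-flat t , sym (zeroSet-cv F x)

  open PhasesOfOrientation M orientation orients using (K; flag⇒ℰ; ℰ⇒flag)

  K⇒T : {F : Subset n} {x : Signs n} → K F x → T x F E
  K⇒T {F} {x} k = T-ext (subst (λ H → T (negatives (cv F x)) H E) (zeroSet-cv F x) (proj₂ (cov⇒tope {cv F x} k)))
    λ (_ , e∉F) → sym (negatives-cv e∉F)

  -- Three conditions on `ε` are equivalent: membership in the phase of the facet, compatibility
  -- with each cover of the chain, and being a tope over each flat of the chain. The last is the
  -- flag condition to which `ℰ` amounts.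
  represents : Represents M P orientation
  represents C facet ε ε-zero = along (facet⇒path {C} facet)
    where
    toVec-ε : toVec (lookup ε) ≡ ε
    toVec-ε = lookup-ext same
      where
      same : ∀ e → lookup (toVec (lookup ε)) e ≡ lookup ε e
      same e with ∈⊎∉ e L
      ... | inj₁ e∈L = trans (toVec-zero (lookup ε) e (holds e∈L)) (sym (ε-zero e (holds e∈L)))
      ... | inj₂ e∉L = lookup-toVec {lookup ε} e∉L
    along : (∃ λ Gs → Path L Gs E × C ≡ dropLast Gs) →
      (phase P C ε ≡ true → ℰ M orientation C ε) × (ℰ M orientation C ε → phase P C ε ≡ true)
    along (Gs , p , refl) =
      (λ ph → flag⇒ℰ {ε = ε} p (along-zip {Q₂ = λ _ _ → ⊤} (λ F⋖G t _ → tope⇒cov (⋖-flatˡ F⋖G) t) p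
        (consistent⇒topes p (Φ⇒R [] p (subst (λ v → phase P (dropLast Gs) v ≡ true) (sym toVec-ε) ph))) (along-above p λ _ _ → tt))) ,
      (λ e → subst (λ v → phase P (dropLast Gs) v ≡ true) toVec-ε
        (R⇒Φ p (topes⇒consistent p (Along-map {Q = λ F _ → K F (lookup ε)} K⇒T Gs (ℰ⇒flag {ε = ε} p e)))))

-- Injectivity and the bijection

module _ {n : ℕ} (M : Matroid n) where
  open Flats M
  open Facets M
  open Blocks M

  -- A covector is T ∖ F for a tope T and a flat F of some maximal chain C with T ∈ 𝓣(C).
  phases-determine-covectors : (𝓜 𝓝 : OrientedMatroid n) → IsOrientationOf 𝓜 M → IsOrientationOf 𝓝 M →
    (P Q : RealPhaseStructure M) → Represents M P 𝓜 → Represents M Q 𝓝 → SameRPS M P Q → ∀ {X} → IsCov 𝓜 X → IsCov 𝓝 X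
  phases-determine-covectors 𝓜 𝓝 𝓜-orients 𝓝-orients P Q P-rep Q-rep same {X} X-cov =
      along (𝓜.flag-above k) (descent-exists F-flat)
    where
    module 𝓜 = PhasesOfOrientation M 𝓜 𝓜-orients
    module 𝓝 = PhasesOfOrientation M 𝓝 𝓝-orients
    F = zeroSet X
    x = negatives X
    k : 𝓜.K F x
    k = 𝓜.K-of X-cov
    F-flat : IsFlat M F
    F-flat = 𝓜.K-flat k
    transfer : {Gs : List (Subset n)} {ε : Vec Bool n} → Path (loops M) Gs fullSet → ZeroOnL M ε →
      𝓜.Flag (lookup ε) (loops M) Gs → 𝓝.Flag (lookup ε) (loops M) Gs
    transfer {Gs} {ε} p ε-zero flag = 𝓝.ℰ⇒flag {ε = ε} p (proj₁ (Q-rep C facet ε ε-zero)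
        (trans (sym (same C facet ε ε-zero)) (proj₂ (P-rep C facet ε ε-zero) (𝓜.flag⇒ℰ {ε = ε} p flag))))
      where
      C = dropLast Gs
      facet = path⇒facet p
    along : (∃ λ Gs → Path F Gs fullSet × 𝓜.Flag x F Gs) → (∃ λ pre → Descent pre F) → IsCov 𝓝 X
    along (Gs , p , flag) (pre , d) = conclude (𝓜.flag-descend d p flag)
      where
      conclude : (∃ λ y → 𝓜.Flag y (loops M) (pre ʳ++ Gs) × (∀ {e} → e ∉ F → y e ≡ x e)) → IsCov 𝓝 X
      conclude (y , flag′ , y≡x) = subst (IsCov 𝓝) (sym (cv-zeroSet X))
        (𝓝.K-ext (𝓝.flag-first p (along-project d
            (transfer {ε = toVec y} (ascend d p) (toVec-zero y) (𝓜.flag-ext (ascend d p) (λ e∉L → lookup-toVec {y} e∉L) flag′))))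
          λ e∉F → sym (trans (lookup-toVec {y} (∉-⊑ (loops-min F-flat) e∉F)) (y≡x e∉F)))

theorem1p1 : (n : ℕ) (M : Matroid n) →
    -- the map 𝓜 ↦ ℰ_𝓜 is well defined: ℰ_𝓜 is a real phase structure on Σ_M
    ((𝓜 : OrientedMatroid n) → IsOrientationOf 𝓜 M →
       Σ (RealPhaseStructure M) (λ P → Represents M P 𝓜))
    -- injective
    × ((𝓜 𝓝 : OrientedMatroid n) → IsOrientationOf 𝓜 M → IsOrientationOf 𝓝 M →
       (P Q : RealPhaseStructure M) → Represents M P 𝓜 → Represents M Q 𝓝 →
       SameRPS M P Q → SameOM 𝓜 𝓝)
    -- surjective
    × ((P : RealPhaseStructure M) →
       Σ (OrientedMatroid n) (λ 𝓜 → IsOrientationOf 𝓜 M × Represents M P 𝓜))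
theorem1p1 n M =
  (λ 𝓜 o → PhasesOfOrientation.phases M 𝓜 o , PhasesOfOrientation.phases-represent M 𝓜 o) ,
  (λ 𝓜 𝓝 o o′ P Q r r′ same X → true-iff
    (phases-determine-covectors M 𝓜 𝓝 o o′ P Q r r′ same)
    (phases-determine-covectors M 𝓝 𝓜 o′ o Q P r′ r (λ C facet x x-zero → sym (same C facet x x-zero)))) ,
  λ P → OrientationOfPhases.orientation M P , OrientationOfPhases.orients M P , OrientationOfPhases.represents M P
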